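{- Let $q$ be a prime power, $n\ge 1$ an integer, and $r\in\mathbb{Z}_{\ge0}$. Then: (a) The $G$-module $\mathcal{IR}_q^r$ has a basis given by $$\{v_K\mid K\in\mathcal{P}_{n\times r}(q)\},$$ and thus $\dim(\mathcal{IR}_q^r)=d_{n,r}(q)$. (b) The $L$-module $\mathcal{IR}_q^{r+\frac12}$ (identified with the subspace $1\otimes_{\mathbb{C}P}e_U\mathcal{IR}_q^r$ of $\mathcal{IR}_q^{r+1}$) has a basis given by $$\{v_K\mid K=((k_1,a^{(1)}),\ldots,(k_{r+1},a^{(r+1)}))\in\mathcal{P}_{n\times (r+1)}(q)\text{ with }k_1=0\},$$ and thus $\dim(\mathcal{IR}_q^{r+\frac12})=d_{n,r+1}(q)/[n]$.
   Context: All modules are over $\mathbb{C}$. $G=\mathrm{GL}_n(\mathbb{F}_q)$. $L\subseteq G$ is the subgroup of block-diagonal matrices with blocks of sizes $1$ and $n-1$ (in this order). $U\subseteq G$ is the subgroup of matrices with ones on the diagonal whose only other possibly nonzero entries are in positions $(1,j)$, $2\le j\le n$. $P=LU$, and $e_U=\frac1{|U|}\sum_{u\in U}u\in\mathbb{C}G$. Harish-Chandra restriction is $\mathrm{Resf}_L^G(M)=e_UM$ for a left $G$-module $M$. Harish-Chandra induction is $\mathrm{Indf}_L^G(W)=\mathbb{C}G\otimes_{\mathbb{C}P}\mathrm{Inf}(W)$ for a left $L$-module $W$, where $\mathrm{Inf}(W)$ is $W$ regarded as a $P$-module with $U$ acting trivially. With $\mathbf 1$ the trivial $G$-module, $$\mathcal{IR}_q^r=(\mathrm{Indf}_L^G\,\mathrm{Resf}_L^G)^r(\mathbf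 1),\qquad \mathcal{IR}_q^{r+\frac12}=\mathrm{Resf}_L^G(\mathcal{IR}_q^r)=e_U\mathcal{IR}_q^r .$$ For $g\in\mathbb{C}G$ and $v$ in a left $G$-module $M$, write $g\otimes_U v=g\otimes e_Uv\in\mathbb{C}G\otimes_{\mathbb{C}P}e_UM=\mathrm{Indf}_L^G\mathrm{Resf}_L^G(M)$; iterated expressions $g_1\otimes_Ug_2\otimes_U\cdots\otimes_Ug_r\otimes_U\mathbf 1$ (with $\mathbf 1$ also denoting a fixed nonzero vector of the trivial module) are bracketed to the right and lie in $\mathcal{IR}_q^r$. For $1\le i<j\le n$ and $t\in\mathbb{F}_q$, $x_{ij}(t)$ is the matrix with $t$ in position $(i,j)$, ones on the diagonal, and zeros elsewhere. $s_i$ is the permutation matrix of the transposition $(i,i+1)$, and $s_i(t)=x_{i,i+1}(t)s_i$. $\mathbb{Z}_n^r=\{(k_1,\ldots,k_r)\in\mathbb{Z}^r\mid 0\le k_1,\ldots,k_r\le n-1\}$. The $\ast$-height $k^*$ of $k\in\mathbb{Z}_n^r$ is defined by $k_1^*=0$ and $k_j^*=\min\{k_j,\max\{k_1^*+1,\ldots,k_{j-1}^*+1\}\}$ for $j\ge2$. Set $$\mathcal{P}_{n\times r}(q)=\{((k_1,a^{(1)}),\ldots,(k_r,a^{(r)}))\mid (k_1,\ldots,k_r)\in\mathbb{Z}_n^r,\ a^{(j)}\in\mathbb{F}_q^{\,k_j-k_j^*}\}.$$ For $0\le k^*\le k\le n-1$ and $a=(a_1,\ldots,a_{k-k^*})\in\mathbb{F}_q^{k-k^*}$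 put $$\overset{\ast}{w}_k(a)=s_k(a_{k-k^*})s_{k-1}(a_{k-k^*-1})\cdots s_{k^*+1}(a_1)\cdot\frac1{q^{k^*}}\sum_{b\in\mathbb{F}_q^{k^*}}s_{k^*}(b_{k^*})\cdots s_1(b_1)\in\mathbb{C}G$$ (empty products are $1$). For $K=((k_1,a^{(1)}),\ldots,(k_r,a^{(r)}))\in\mathcal{P}_{n\times r}(q)$ put $$v_K=\overset{\ast}{w}_{k_1}(a^{(1)})\otimes_U\overset{\ast}{w}_{k_2}(a^{(2)})\otimes_U\cdots\otimes_U\overset{\ast}{w}_{k_r}(a^{(r)})\otimes_U\mathbf 1,$$ where $\overset{\ast}{w}_{k_j}(a^{(j)})$ is formed using $k_j^*$, the $j$th entry of the $\ast$-height of $(k_1,\ldots,k_r)$. $[i]=\frac{q^i-1}{q-1}$, $S(r,\ell)$ is the Stirling number of the second kind, $d_{n,r}(q)=\sum_{\ell=1}^nS(r,\ell)[n][n-1]\cdots[n-\ell+1]$ for $r\ge1$, and $d_{n,0}(q)=1$. In part (b), $e_U\mathcal{IR}_q^r$ is identified with its image under $v\mapsto 1\otimes v$ in $\mathbb{C}G\otimes_{\mathbb{C}P}e_U\mathcal{IR}_q^r=\mathcal{IR}_q^{r+1}$. -}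

module Defs where

open import Level using (0ℓ)
open import Algebra.Bundles using (CommutativeRing; Ring; Group; AbelianGroup; Monoid)
open import Algebra.Structures using (IsCommutativeRing)
open import Algebra.Module.Bundles using (LeftModule; Bimodule)
import Algebra.Module.Construct.TensorUnit as TensorUnit
open import Algebra.Morphism.Bundles using (RingHomomorphism; GroupHomomorphism)
open import Data.Bool using (if_then_else_; _∧_)
open import Data.Fin as Fin using (Fin; zero; suc; toℕ; inject₁; fromℕ<)
import Data.Fin.Properties as Finₚ
open import Data.Fin.Permutation using (Permutation′; permutation; _⟨$⟩ʳ_; _⟨$⟩ˡ_; transpose)
import Data.Fin.Permutation as Perm
import Data.Integer as ℤ
open import Data.List as List using (List; applyUpTo)
open import Data.List.Membership.Propositional using (_∈_)
open import Data.List.Relation.Unary.Unique.Propositional using (Unique)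
open import Data.Nat as ℕ using (ℕ; zero; suc; NonZero; _∸_; _⊓_; _⊔_; _^_; _≤_)
open import Data.Nat.DivMod using (_/_)
import Data.Nat.ListAction as ℕ-List
open import Data.Nat.Primality using (Prime)
import Data.Nat.Properties as ℕₚ
open import Data.Product using (Σ; ∃; _×_; _,_; proj₁; proj₂)
open import Data.Product.Function.NonDependent.Propositional using (_×-↔_)
open import Data.Rational as ℚ using (ℚ; 0ℚ; 1ℚ; ½; ∣_∣; Positive; positive)
import Data.Rational.Properties as ℚₚ
open import Data.Unit using (⊤)
open import Data.Vec as Vec using (Vec; []; _∷_; zip; lookup; tabulate)
import Data.Vec.Properties as Vecₚ
open import Data.Vec.Functional using (Vector)
open import Data.Vec.Relation.Unary.All using (All; []; _∷_)
open import Function.Base using (_∘_)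
open import Function.Bundles using (Inverse; _↔_; mk↔ₛ′)
open import Function.Properties.Inverse using (↔-trans)
open import Relation.Binary.Bundles using (Setoid)
open import Relation.Binary.PropositionalEquality as ≡ using (_≡_; _≢_)
open import Relation.Nullary using (yes; no; does; contradiction)
open import Relation.Nullary.Decidable using (dec-true; dec-false)

private module Identities (R : CommutativeRing 0ℓ 0ℓ) where
  open CommutativeRing R
  open import Algebra.Properties.Ring ring using (x[y-z]≈xy-xz; [y-z]x≈yx-zx)
  open import Algebra.Properties.AbelianGroup +-abelianGroup using (⁻¹-∙-comm)
  open import Algebra.Properties.Group +-group using (⁻¹-anti-homo-//; //-rightDividesˡ; ε⁻¹≈ε)
  open import Algebra.Properties.CommutativeSemigroup +-commutativeSemigroup using (interchange)

  sub-add : ∀ a b → a ≈ (a - b) + b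
  sub-add a b = sym (//-rightDividesˡ b a)

  sub-+-sub : ∀ a b c d → (a - b) + (c - d) ≈ (a + c) - (b + d)
  sub-+-sub a b c d = trans (interchange a (- b) c (- d)) (+-congˡ (⁻¹-∙-comm b d))

  neg-sub : ∀ a b → - (a - b) ≈ - a - - b
  neg-sub a b = sym (⁻¹-∙-comm a (- b))

  neg-flip : ∀ a b → - (a - b) ≈ b - a
  neg-flip a b = ⁻¹-anti-homo-// a b

  sub-0 : ∀ {x y} → x ≈ 0# → y - x ≈ y
  sub-0 e = trans (+-congˡ (trans (-‿cong e) ε⁻¹≈ε)) (+-identityʳ _)

  telescope : ∀ a b c → (a - b) + (b - c) ≈ a - c
  telescope a b c = trans (sym (+-assoc (a - b) b (- c))) (+-congʳ (//-rightDividesˡ b a))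

  product-diff : ∀ a b c d → a * (c - d) + d * (a - b) ≈ a * c - b * d
  product-diff a b c d = trans
    (+-cong (x[y-z]≈xy-xz a c d) (trans (*-comm d (a - b)) ([y-z]x≈yx-zx d a b)))
    (telescope (a * c) (a * d) (b * d))

  shuffle-sub : ∀ x y z w → (x - y) - (z + w) ≈ (x - z) - (w + y)
  shuffle-sub x y z w = trans (+-congˡ (sym (⁻¹-∙-comm z w)))
    (trans (interchange x (- y) (- z) (- w))
    (+-congˡ (trans (⁻¹-∙-comm y w) (-‿cong (+-comm y w)))))

  shuffle-add : ∀ x y z w → (x - y) + (z + w) ≈ (x + z) + (w - y)
  shuffle-add x y z w = trans (interchange x (- y) z w) (+-congˡ (+-comm (- y) w))

module Eventual {I : Set} (Past : ℕ → I → Set)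
  (past-mono : ∀ {M N i} → M ℕ.≤ N → Past N i → Past M i) where

  Null : (I → ℚ) → Set
  Null z = (ε : ℚ) → 0ℚ ℚ.< ε → ∃ λ N → ∀ i → Past N i → ∣ z i ∣ ℚ.< ε

  Bounded : (I → ℚ) → Set
  Bounded z = Σ ℚ λ B → Positive B × ∃ λ N → ∀ i → Past N i → ∣ z i ∣ ℚ.≤ B

  null-≗ : ∀ {y z} → (∀ i → y i ≡ z i) → Null y → Null z
  null-≗ e ny ε 0<ε with ny ε 0<ε
  ... | N , h = N , λ i p → ≡.subst (λ t → ∣ t ∣ ℚ.< ε) (e i) (h i p)

  null-0 : ∀ {z} → (∀ i → z i ≡ 0ℚ) → Null z
  null-0 e ε 0<ε = 0 , λ i _ → ≡.subst (λ t → ∣ t ∣ ℚ.< ε) (≡.sym (e i)) 0<ε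

  null-neg : ∀ {z} → Null z → Null (λ i → ℚ.- z i)
  null-neg {z} nz ε 0<ε with nz ε 0<ε
  ... | N , h = N , λ i p → ≡.subst (ℚ._< ε) (≡.sym (ℚₚ.∣-p∣≡∣p∣ (z i))) (h i p)

  null-+ : ∀ {y z} → Null y → Null z → Null (λ i → y i ℚ.+ z i)
  null-+ {y} {z} ny nz ε 0<ε with ny (½ ℚ.* ε) 0<½ε | nz (½ ℚ.* ε) 0<½ε
    where
    0<½ε : 0ℚ ℚ.< ½ ℚ.* ε
    0<½ε = ℚₚ.positive⁻¹ (½ ℚ.* ε) {{ℚₚ.pos*pos⇒pos ½ ε {{positive 0<ε}}}}
  ... | M , h | N , k = M ℕ.⊔ N , λ i p → begin-strict
      ∣ y i ℚ.+ z i ∣           ≤⟨ ℚₚ.∣p+q∣≤∣p∣+∣q∣ (y i) (z i) ⟩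
      ∣ y i ∣ ℚ.+ ∣ z i ∣       <⟨ ℚₚ.+-mono-< (h i (past-mono (ℕₚ.m≤m⊔n M N) p))
                                                (k i (past-mono (ℕₚ.m≤n⊔m M N) p)) ⟩
      ½ ℚ.* ε ℚ.+ ½ ℚ.* ε       ≡⟨ ℚₚ.*-distribʳ-+ ε ½ ½ ⟨
      (½ ℚ.+ ½) ℚ.* ε           ≡⟨ ℚₚ.*-identityˡ ε ⟩
      ε ∎
    where open ℚₚ.≤-Reasoning

  null-* : ∀ {y z} → Bounded y → Null z → Null (λ i → y i ℚ.* z i)
  null-* {y} {z} (B , B>0 , M , h) nz ε 0<ε with nz δ 0<δ
    where
    instance
      _ : Positive B
      _ = B>0
      _ : ℚ.NonZero B
      _ = ℚₚ.pos⇒nonZero B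
    δ = ℚ.1/ B ℚ.* ε
    0<δ : 0ℚ ℚ.< δ
    0<δ = ℚₚ.positive⁻¹ δ {{ℚₚ.pos*pos⇒pos (ℚ.1/ B) {{ℚₚ.1/pos⇒pos B}} ε {{positive 0<ε}}}}
  ... | N , k = M ℕ.⊔ N , λ i p → begin-strict
      ∣ y i ℚ.* z i ∣           ≡⟨ ℚₚ.∣p*q∣≡∣p∣*∣q∣ (y i) (z i) ⟩
      ∣ y i ∣ ℚ.* ∣ z i ∣       ≤⟨ ℚₚ.*-monoʳ-≤-nonNeg ∣ z i ∣ {{ℚ.nonNegative (ℚₚ.0≤∣p∣ (z i))}}
                                     (h i (past-mono (ℕₚ.m≤m⊔n M N) p)) ⟩
      B ℚ.* ∣ z i ∣             <⟨ ℚₚ.*-monoʳ-<-pos B (k i (past-mono (ℕₚ.m≤n⊔m M N) p)) ⟩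
      B ℚ.* (ℚ.1/ B ℚ.* ε)      ≡⟨ ℚₚ.*-assoc B (ℚ.1/ B) ε ⟨
      (B ℚ.* ℚ.1/ B) ℚ.* ε      ≡⟨ ≡.cong (ℚ._* ε) (ℚₚ.*-inverseʳ B) ⟩
      1ℚ ℚ.* ε                  ≡⟨ ℚₚ.*-identityˡ ε ⟩
      ε ∎
    where
    open ℚₚ.≤-Reasoning
    instance
      _ : Positive B
      _ = B>0
      _ : ℚ.NonZero B
      _ = ℚₚ.pos⇒nonZero B

  null-*+* : ∀ {a b c d} → Bounded a → Null b → Bounded c → Null d →
             Null (λ i → a i ℚ.* b i ℚ.+ c i ℚ.* d i)
  null-*+* ba nb bc nd = null-+ (null-* ba nb) (null-* bc nd)

module At = Eventual {ℕ} ℕ._≤_ ℕₚ.≤-trans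
module At₂ = Eventual {ℕ × ℕ} (λ N (m , n) → N ℕ.≤ m × N ℕ.≤ n)
  (λ M≤N (p , q) → ℕₚ.≤-trans M≤N p , ℕₚ.≤-trans M≤N q)

-- Real numbers are Cauchy sequences of rationals (each with a modulus), two of
-- them being equal when their difference tends to 0.
record ℝ : Set where
  field
    seq    : ℕ → ℚ
    cauchy : At₂.Null (λ (m , n) → seq m ℚ.- seq n)
open ℝ

infix 4 _≈ℝ_
record _≈ℝ_ (x y : ℝ) : Set where
  constructor mk≈ℝ
  field
    null : At.Null (λ n → seq x n ℚ.- seq y n)

private module ℚ-id = Identities ℚₚ.+-*-commutativeRing

bounded : (x : ℝ) → At.Bounded (seq x)
bounded x with cauchy x 1ℚ (ℚₚ.positive⁻¹ 1ℚ)
... | N , h = 1ℚ ℚ.+ ∣ c ∣ , pos , N , λ n N≤n → begin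
      ∣ seq x n ∣                        ≡⟨ ≡.cong ∣_∣ (ℚ-id.sub-add (seq x n) c) ⟩
      ∣ (seq x n ℚ.- c) ℚ.+ c ∣          ≤⟨ ℚₚ.∣p+q∣≤∣p∣+∣q∣ (seq x n ℚ.- c) c ⟩
      ∣ seq x n ℚ.- c ∣ ℚ.+ ∣ c ∣        ≤⟨ ℚₚ.+-monoˡ-≤ ∣ c ∣ (ℚₚ.<⇒≤ (h (n , N) (N≤n , ℕₚ.≤-refl))) ⟩
      1ℚ ℚ.+ ∣ c ∣ ∎
  where
  open ℚₚ.≤-Reasoning
  c = seq x N
  pos : Positive (1ℚ ℚ.+ ∣ c ∣)
  pos = ℚₚ.pos+nonNeg⇒pos 1ℚ ∣ c ∣ {{ℚ.nonNegative (ℚₚ.0≤∣p∣ c)}}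

bounded₁ : (x : ℝ) → At₂.Bounded (λ (m , n) → seq x m)
bounded₁ x with bounded x
... | B , B>0 , N , h = B , B>0 , N , λ (m , n) (p , q) → h m p

bounded₂ : (x : ℝ) → At₂.Bounded (λ (m , n) → seq x n)
bounded₂ x with bounded x
... | B , B>0 , N , h = B , B>0 , N , λ (m , n) (p , q) → h n q

constℝ : ℚ → ℝ
constℝ p = record { seq = λ _ → p ; cauchy = At₂.null-0 (λ _ → ℚₚ.+-inverseʳ p) }

infixl 6 _+ℝ_
infixl 7 _*ℝ_
infix  8 -ℝ_

_+ℝ_ : ℝ → ℝ → ℝ
x +ℝ y = record
  { seq    = λ n → seq x n ℚ.+ seq y n
  ; cauchy = At₂.null-≗ (λ (m , n) → ℚ-id.sub-+-sub (seq x m) (seq x n) (seq y m) (seq y n))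
                        (At₂.null-+ (cauchy x) (cauchy y))
  }

-ℝ_ : ℝ → ℝ
-ℝ x = record
  { seq    = λ n → ℚ.- seq x n
  ; cauchy = At₂.null-≗ (λ (m , n) → ℚ-id.neg-sub (seq x m) (seq x n)) (At₂.null-neg (cauchy x))
  }

_*ℝ_ : ℝ → ℝ → ℝ
x *ℝ y = record
  { seq    = λ n → seq x n ℚ.* seq y n
  ; cauchy = At₂.null-≗ (λ (m , n) → ℚ-id.product-diff (seq x m) (seq x n) (seq y m) (seq y n))
                        (At₂.null-*+* (bounded₁ x) (cauchy y) (bounded₂ y) (cauchy x))
  }

private
  pointwise : ∀ {x y} → (∀ n → seq x n ≡ seq y n) → x ≈ℝ y
  pointwise {x} {y} e = mk≈ℝ (At.null-0 λ n →
    ≡.trans (≡.cong (ℚ._- seq y n) (e n)) (ℚₚ.+-inverseʳ (seq y n)))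

ℝ-commutativeRing : CommutativeRing 0ℓ 0ℓ
ℝ-commutativeRing = record
  { Carrier = ℝ
  ; _≈_ = _≈ℝ_
  ; _+_ = _+ℝ_
  ; _*_ = _*ℝ_
  ; -_  = -ℝ_
  ; 0#  = constℝ 0ℚ
  ; 1#  = constℝ 1ℚ
  ; isCommutativeRing = record
    { isRing = record
      { +-isAbelianGroup = record
        { isGroup = record
          { isMonoid = record
            { isSemigroup = record
              { isMagma = record
                { isEquivalence = record
                  { refl  = λ {x} → pointwise {x} {x} (λ _ → ≡.refl)
                  ; sym   = λ {x} {y} → ≈-sym {x} {y}
                  ; trans = λ {x} {y} {z} → ≈-trans {x} {y} {z}
                  }
                ; ∙-cong = λ {x} {x′} {y} {y′} → +-cong {x} {x′} {y} {y′}
                }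
              ; assoc = λ x y z → pointwise (λ n → ℚₚ.+-assoc (seq x n) (seq y n) (seq z n))
              }
            ; identity = (λ x → pointwise (λ n → ℚₚ.+-identityˡ (seq x n)))
                       , (λ x → pointwise (λ n → ℚₚ.+-identityʳ (seq x n)))
            }
          ; inverse = (λ x → pointwise (λ n → ℚₚ.+-inverseˡ (seq x n)))
                    , (λ x → pointwise (λ n → ℚₚ.+-inverseʳ (seq x n)))
          ; ⁻¹-cong = λ {x} {y} → neg-cong {x} {y}
          }
        ; comm = λ x y → pointwise (λ n → ℚₚ.+-comm (seq x n) (seq y n))
        }
      ; *-cong = λ {x} {x′} {y} {y′} → *-cong {x} {x′} {y} {y′}
      ; *-assoc = λ x y z → pointwise (λ n → ℚₚ.*-assoc (seq x n) (seq y n) (seq z n))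
      ; *-identity = (λ x → pointwise (λ n → ℚₚ.*-identityˡ (seq x n)))
                   , (λ x → pointwise (λ n → ℚₚ.*-identityʳ (seq x n)))
      ; distrib = (λ x y z → pointwise (λ n → ℚₚ.*-distribˡ-+ (seq x n) (seq y n) (seq z n)))
                , (λ x y z → pointwise (λ n → ℚₚ.*-distribʳ-+ (seq x n) (seq y n) (seq z n)))
      }
    ; *-comm = λ x y → pointwise (λ n → ℚₚ.*-comm (seq x n) (seq y n))
    }
  }
  where
  ≈-sym : ∀ {x y} → x ≈ℝ y → y ≈ℝ x
  ≈-sym {x} {y} (mk≈ℝ e) = mk≈ℝ (At.null-≗ (λ n → ℚ-id.neg-flip (seq x n) (seq y n)) (At.null-neg e))
  ≈-trans : ∀ {x y z} → x ≈ℝ y → y ≈ℝ z → x ≈ℝ z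
  ≈-trans {x} {y} {z} (mk≈ℝ e) (mk≈ℝ f) =
    mk≈ℝ (At.null-≗ (λ n → ℚ-id.telescope (seq x n) (seq y n) (seq z n)) (At.null-+ e f))
  +-cong : ∀ {x x′ y y′} → x ≈ℝ x′ → y ≈ℝ y′ → (x +ℝ y) ≈ℝ (x′ +ℝ y′)
  +-cong {x} {x′} {y} {y′} (mk≈ℝ e) (mk≈ℝ f) =
    mk≈ℝ (At.null-≗ (λ n → ℚ-id.sub-+-sub (seq x n) (seq x′ n) (seq y n) (seq y′ n)) (At.null-+ e f))
  neg-cong : ∀ {x y} → x ≈ℝ y → (-ℝ x) ≈ℝ (-ℝ y)
  neg-cong {x} {y} (mk≈ℝ e) = mk≈ℝ (At.null-≗ (λ n → ℚ-id.neg-sub (seq x n) (seq y n)) (At.null-neg e))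
  *-cong : ∀ {x x′ y y′} → x ≈ℝ x′ → y ≈ℝ y′ → (x *ℝ y) ≈ℝ (x′ *ℝ y′)
  *-cong {x} {x′} {y} {y′} (mk≈ℝ e) (mk≈ℝ f) =
    mk≈ℝ (At.null-≗ (λ n → ℚ-id.product-diff (seq x n) (seq x′ n) (seq y n) (seq y′ n))
                    (At.null-*+* (bounded x) f (bounded y′) e))

-- Adjoins a square root of -1: (a , b) stands for a + i b.
module Complexification (R : CommutativeRing 0ℓ 0ℓ) where
  open CommutativeRing R
  open import Algebra.Properties.Ring ring using (x[y-z]≈xy-xz; [y-z]x≈yx-zx)
  open import Algebra.Properties.CommutativeSemigroup +-commutativeSemigroup using (interchange)
  open Identities R

  complexification : CommutativeRing 0ℓ 0ℓ
  complexification = record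
    { Carrier = Carrier × Carrier
    ; _≈_ = λ (a , b) (c , d) → a ≈ c × b ≈ d
    ; _+_ = λ (a , b) (c , d) → a + c , b + d
    ; _*_ = λ (a , b) (c , d) → a * c - b * d , a * d + b * c
    ; -_  = λ (a , b) → - a , - b
    ; 0#  = 0# , 0#
    ; 1#  = 1# , 0#
    ; isCommutativeRing = record
      { isRing = record
        { +-isAbelianGroup = record
          { isGroup = record
            { isMonoid = record
              { isSemigroup = record
                { isMagma = record
                  { isEquivalence = record
                    { refl  = refl , refl
                    ; sym   = λ (e , f) → sym e , sym f
                    ; trans = λ (e , f) (e′ , f′) → trans e e′ , trans f f′
                    }
                  ; ∙-cong = λ (e , f) (e′ , f′) → +-cong e e′ , +-cong f f′
                  }
                ; assoc = λ (a , b) (c , d) (e , f) → +-assoc a c e , +-assoc b d f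
                }
              ; identity = (λ (a , b) → +-identityˡ a , +-identityˡ b)
                         , (λ (a , b) → +-identityʳ a , +-identityʳ b)
              }
            ; inverse = (λ (a , b) → -‿inverseˡ a , -‿inverseˡ b)
                      , (λ (a , b) → -‿inverseʳ a , -‿inverseʳ b)
            ; ⁻¹-cong = λ (e , f) → -‿cong e , -‿cong f
            }
          ; comm = λ (a , b) (c , d) → +-comm a c , +-comm b d
          }
        ; *-cong = λ (e , f) (e′ , f′) →
            +-cong (*-cong e e′) (-‿cong (*-cong f f′)) , +-cong (*-cong e f′) (*-cong f e′)
        ; *-assoc = λ (a , b) (c , d) (e , f) → assoc-re a b c d e f , assoc-im a b c d e f
        ; *-identity = (λ (a , b) → idˡ-re a b , idˡ-im a b) , (λ (a , b) → idʳ-re a b , idʳ-im a b)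
        ; distrib = (λ (a , b) (c , d) (e , f) → dˡ-re a b c d e f , dˡ-im a b c d e f)
                  , (λ (a , b) (c , d) (e , f) → dʳ-re a b c d e f , dʳ-im a b c d e f)
        }
      ; *-comm = λ (a , b) (c , d) → comm-re a b c d , comm-im a b c d
      }
    }
    where
    assoc-re : ∀ a b c d e f → (a * c - b * d) * e - (a * d + b * c) * f
                             ≈ a * (c * e - d * f) - b * (c * f + d * e)
    assoc-re a b c d e f = trans
      (+-cong (trans ([y-z]x≈yx-zx e (a * c) (b * d)) (+-cong (*-assoc a c e) (-‿cong (*-assoc b d e))))
              (-‿cong (trans (distribʳ f (a * d) (b * c)) (+-cong (*-assoc a d f) (*-assoc b c f)))))
      (trans (shuffle-sub (a * (c * e)) (b * (d * e)) (a * (d * f)) (b * (c * f)))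
      (sym (+-cong (x[y-z]≈xy-xz a (c * e) (d * f)) (-‿cong (distribˡ b (c * f) (d * e))))))
    assoc-im : ∀ a b c d e f → (a * c - b * d) * f + (a * d + b * c) * e
                             ≈ a * (c * f + d * e) + b * (c * e - d * f)
    assoc-im a b c d e f = trans
      (+-cong (trans ([y-z]x≈yx-zx f (a * c) (b * d)) (+-cong (*-assoc a c f) (-‿cong (*-assoc b d f))))
              (trans (distribʳ e (a * d) (b * c)) (+-cong (*-assoc a d e) (*-assoc b c e))))
      (trans (shuffle-add (a * (c * f)) (b * (d * f)) (a * (d * e)) (b * (c * e)))
      (sym (+-cong (distribˡ a (c * f) (d * e)) (x[y-z]≈xy-xz b (c * e) (d * f)))))
    idˡ-re : ∀ a b → 1# * a - 0# * b ≈ a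
    idˡ-re a b = trans (sub-0 (zeroˡ b)) (*-identityˡ a)
    idˡ-im : ∀ a b → 1# * b + 0# * a ≈ b
    idˡ-im a b = trans (+-cong (*-identityˡ b) (zeroˡ a)) (+-identityʳ b)
    idʳ-re : ∀ a b → a * 1# - b * 0# ≈ a
    idʳ-re a b = trans (sub-0 (zeroʳ b)) (*-identityʳ a)
    idʳ-im : ∀ a b → a * 0# + b * 1# ≈ b
    idʳ-im a b = trans (+-cong (zeroʳ a) (*-identityʳ b)) (+-identityˡ b)
    dˡ-re : ∀ a b c d e f → a * (c + e) - b * (d + f) ≈ (a * c - b * d) + (a * e - b * f)
    dˡ-re a b c d e f = trans (+-cong (distribˡ a c e) (-‿cong (distribˡ b d f)))
      (sym (sub-+-sub (a * c) (b * d) (a * e) (b * f)))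
    dˡ-im : ∀ a b c d e f → a * (d + f) + b * (c + e) ≈ (a * d + b * c) + (a * f + b * e)
    dˡ-im a b c d e f = trans (+-cong (distribˡ a d f) (distribˡ b c e))
      (interchange (a * d) (a * f) (b * c) (b * e))
    dʳ-re : ∀ a b c d e f → (c + e) * a - (d + f) * b ≈ (c * a - d * b) + (e * a - f * b)
    dʳ-re a b c d e f = trans (+-cong (distribʳ a c e) (-‿cong (distribʳ b d f)))
      (sym (sub-+-sub (c * a) (d * b) (e * a) (f * b)))
    dʳ-im : ∀ a b c d e f → (c + e) * b + (d + f) * a ≈ (c * b + d * a) + (e * b + f * a)
    dʳ-im a b c d e f = trans (+-cong (distribʳ b c e) (distribʳ a d f))
      (interchange (c * b) (e * b) (d * a) (f * a))
    comm-re : ∀ a b c d → a * c - b * d ≈ c * a - d * b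
    comm-re a b c d = +-cong (*-comm a c) (-‿cong (*-comm b d))
    comm-im : ∀ a b c d → a * d + b * c ≈ c * b + d * a
    comm-im a b c d = trans (+-cong (*-comm a d) (*-comm b c)) (+-comm (d * a) (c * b))

ℂ : CommutativeRing 0ℓ 0ℓ
ℂ = Complexification.complexification ℝ-commutativeRing

recipℂ : (m : ℕ) .{{_ : NonZero m}} → CommutativeRing.Carrier ℂ
recipℂ m = constℝ (ℤ.+ 1 ℚ./ m) , constℝ 0ℚ

restrictScalars : {R S : Ring 0ℓ 0ℓ} →
  RingHomomorphism (Ring.rawRing R) (Ring.rawRing S) →
  LeftModule S 0ℓ 0ℓ → LeftModule R 0ℓ 0ℓ
restrictScalars {R} φ M = record
  { Carrierᴹ = Carrierᴹ
  ; _≈ᴹ_ = _≈ᴹ_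
  ; _+ᴹ_ = _+ᴹ_
  ; _*ₗ_ = λ r x → ⟦ r ⟧ *ₗ x
  ; 0ᴹ = 0ᴹ
  ; -ᴹ_ = -ᴹ_
  ; isLeftModule = record
    { isLeftSemimodule = record
      { +ᴹ-isCommutativeMonoid = +ᴹ-isCommutativeMonoid
      ; isPreleftSemimodule = record
        { *ₗ-cong = λ e f → *ₗ-cong (⟦⟧-cong e) f
        ; *ₗ-zeroˡ = λ x → ≈ᴹ-trans (*ₗ-congʳ 0#-homo) (*ₗ-zeroˡ x)
        ; *ₗ-distribʳ = λ x r s → ≈ᴹ-trans (*ₗ-congʳ (+-homo r s)) (*ₗ-distribʳ x ⟦ r ⟧ ⟦ s ⟧)
        ; *ₗ-identityˡ = λ x → ≈ᴹ-trans (*ₗ-congʳ 1#-homo) (*ₗ-identityˡ x)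
        ; *ₗ-assoc = λ r s x → ≈ᴹ-trans (*ₗ-congʳ (*-homo r s)) (*ₗ-assoc ⟦ r ⟧ ⟦ s ⟧ x)
        ; *ₗ-zeroʳ = λ r → *ₗ-zeroʳ ⟦ r ⟧
        ; *ₗ-distribˡ = λ r → *ₗ-distribˡ ⟦ r ⟧
        }
      }
    ; -ᴹ‿cong = -ᴹ‿cong
    ; -ᴹ‿inverse = -ᴹ‿inverse
    }
  }
  where
  open LeftModule M
  open RingHomomorphism φ

-- S as an (S , R)-bimodule, R acting on the right through φ.
ringAsBimodule : {R S : Ring 0ℓ 0ℓ} →
  RingHomomorphism (Ring.rawRing R) (Ring.rawRing S) → Bimodule S R 0ℓ 0ℓ
ringAsBimodule {R} {S} φ = record
  { Carrierᴹ = Carrier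
  ; _≈ᴹ_ = _≈_
  ; _+ᴹ_ = _+_
  ; _*ₗ_ = _*_
  ; _*ᵣ_ = λ s r → s * ⟦ r ⟧
  ; 0ᴹ = 0#
  ; -ᴹ_ = -_
  ; isBimodule = record
    { isBisemimodule = record
      { +ᴹ-isCommutativeMonoid = +-isCommutativeMonoid
      ; isPreleftSemimodule = LeftModule.isPreleftSemimodule (TensorUnit.leftModule {R = S})
      ; isPrerightSemimodule = record
        { *ᵣ-cong = λ e f → *-cong e (⟦⟧-cong f)
        ; *ᵣ-zeroʳ = λ s → trans (*-congˡ 0#-homo) (zeroʳ s)
        ; *ᵣ-distribˡ = λ s r r′ → trans (*-congˡ (+-homo r r′)) (distribˡ s ⟦ r ⟧ ⟦ r′ ⟧)
        ; *ᵣ-identityʳ = λ s → trans (*-congˡ 1#-homo) (*-identityʳ s)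
        ; *ᵣ-assoc = λ s r r′ → trans (*-assoc s ⟦ r ⟧ ⟦ r′ ⟧) (*-congˡ (sym (*-homo r r′)))
        ; *ᵣ-zeroˡ = λ r → zeroˡ ⟦ r ⟧
        ; *ᵣ-distribʳ = λ r s s′ → distribʳ ⟦ r ⟧ s s′
        }
      ; *ₗ-*ᵣ-assoc = λ s t r → *-assoc s t ⟦ r ⟧
      }
    ; -ᴹ‿cong = -‿cong
    ; -ᴹ‿inverse = -‿inverse
    }
  }
  where
  open Ring S
  open RingHomomorphism φ

-- M ⊗_R N: the abelian group generated by the symbols m ⊗ n subject to
-- biadditivity and (m r) ⊗ n = m ⊗ (r n).
module TensorProduct {S R : Ring 0ℓ 0ℓ} (M : Bimodule S R 0ℓ 0ℓ) (N : LeftModule R 0ℓ 0ℓ) where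
  private
    module S = Ring S
    module R = Ring R
    module M = Bimodule M
    module N = LeftModule N

  infixr 7 _⊗_
  infixl 6 _⊕_
  infix  4 _≋_

  data Tensor : Set where
    _⊗_ : M.Carrierᴹ → N.Carrierᴹ → Tensor
    _⊕_ : Tensor → Tensor → Tensor
    𝟎   : Tensor
    ⊖_  : Tensor → Tensor

  data _≋_ : Tensor → Tensor → Set where
    refl     : ∀ {x} → x ≋ x
    sym      : ∀ {x y} → x ≋ y → y ≋ x
    trans    : ∀ {x y z} → x ≋ y → y ≋ z → x ≋ z
    ⊕-cong   : ∀ {x x′ y y′} → x ≋ x′ → y ≋ y′ → x ⊕ y ≋ x′ ⊕ y′
    ⊖-cong   : ∀ {x y} → x ≋ y → ⊖ x ≋ ⊖ y
    ⊕-assoc  : ∀ x y z → (x ⊕ y) ⊕ z ≋ x ⊕ (y ⊕ z)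
    ⊕-comm   : ∀ x y → x ⊕ y ≋ y ⊕ x
    ⊕-identityˡ : ∀ x → 𝟎 ⊕ x ≋ x
    ⊖-inverseˡ  : ∀ x → ⊖ x ⊕ x ≋ 𝟎
    ⊗-cong   : ∀ {m m′ n n′} → m M.≈ᴹ m′ → n N.≈ᴹ n′ → m ⊗ n ≋ m′ ⊗ n′
    ⊗-distribʳ : ∀ m m′ n → (m M.+ᴹ m′) ⊗ n ≋ m ⊗ n ⊕ m′ ⊗ n
    ⊗-distribˡ : ∀ m n n′ → m ⊗ (n N.+ᴹ n′) ≋ m ⊗ n ⊕ m ⊗ n′
    ⊗-balanced : ∀ m r n → (m M.*ᵣ r) ⊗ n ≋ m ⊗ (r N.*ₗ n)

  tensorGroup : AbelianGroup 0ℓ 0ℓ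
  tensorGroup = record
    { Carrier = Tensor
    ; _≈_ = _≋_
    ; _∙_ = _⊕_
    ; ε = 𝟎
    ; _⁻¹ = ⊖_
    ; isAbelianGroup = record
      { isGroup = record
        { isMonoid = record
          { isSemigroup = record
            { isMagma = record
              { isEquivalence = record { refl = refl ; sym = sym ; trans = trans }
              ; ∙-cong = ⊕-cong
              }
            ; assoc = ⊕-assoc
            }
          ; identity = ⊕-identityˡ , λ x → trans (⊕-comm x 𝟎) (⊕-identityˡ x)
          }
        ; inverse = ⊖-inverseˡ , λ x → trans (⊕-comm x (⊖ x)) (⊖-inverseˡ x)
        ; ⁻¹-cong = ⊖-cong
        }
      ; comm = ⊕-comm
      }
    }

  infixr 7 _·_
  _·_ : S.Carrier → Tensor → Tensor
  s · (m ⊗ n) = (s M.*ₗ m) ⊗ n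
  s · (x ⊕ y) = s · x ⊕ s · y
  s · 𝟎       = 𝟎
  s · (⊖ x)   = ⊖ (s · x)

  open import Algebra.Properties.AbelianGroup tensorGroup using (⁻¹-∙-comm)
  open import Algebra.Properties.Group (AbelianGroup.group tensorGroup) using (identityʳ-unique; ε⁻¹≈ε)
  open import Algebra.Properties.CommutativeSemigroup (AbelianGroup.commutativeSemigroup tensorGroup)
    using (interchange)

  ·-congˡ : ∀ s {x y} → x ≋ y → s · x ≋ s · y
  ·-congˡ s refl = refl
  ·-congˡ s (sym e) = sym (·-congˡ s e)
  ·-congˡ s (trans e f) = trans (·-congˡ s e) (·-congˡ s f)
  ·-congˡ s (⊕-cong e f) = ⊕-cong (·-congˡ s e) (·-congˡ s f)
  ·-congˡ s (⊖-cong e) = ⊖-cong (·-congˡ s e)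
  ·-congˡ s (⊕-assoc x y z) = ⊕-assoc (s · x) (s · y) (s · z)
  ·-congˡ s (⊕-comm x y) = ⊕-comm (s · x) (s · y)
  ·-congˡ s (⊕-identityˡ x) = ⊕-identityˡ (s · x)
  ·-congˡ s (⊖-inverseˡ x) = ⊖-inverseˡ (s · x)
  ·-congˡ s (⊗-cong e f) = ⊗-cong (M.*ₗ-congˡ e) f
  ·-congˡ s (⊗-distribʳ m m′ n) =
    trans (⊗-cong (M.*ₗ-distribˡ s m m′) N.≈ᴹ-refl) (⊗-distribʳ (s M.*ₗ m) (s M.*ₗ m′) n)
  ·-congˡ s (⊗-distribˡ m n n′) = ⊗-distribˡ (s M.*ₗ m) n n′
  ·-congˡ s (⊗-balanced m r n) =
    trans (⊗-cong (M.≈ᴹ-sym (M.*ₗ-*ᵣ-assoc s m r)) N.≈ᴹ-refl) (⊗-balanced (s M.*ₗ m) r n)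

  ·-congʳ : ∀ {s t} x → s S.≈ t → s · x ≋ t · x
  ·-congʳ (m ⊗ n) e = ⊗-cong (M.*ₗ-congʳ e) N.≈ᴹ-refl
  ·-congʳ (x ⊕ y) e = ⊕-cong (·-congʳ x e) (·-congʳ y e)
  ·-congʳ 𝟎 e = refl
  ·-congʳ (⊖ x) e = ⊖-cong (·-congʳ x e)

  ·-distribʳ : ∀ x s t → (s S.+ t) · x ≋ s · x ⊕ t · x
  ·-distribʳ (m ⊗ n) s t =
    trans (⊗-cong (M.*ₗ-distribʳ m s t) N.≈ᴹ-refl) (⊗-distribʳ (s M.*ₗ m) (t M.*ₗ m) n)
  ·-distribʳ (x ⊕ y) s t = trans (⊕-cong (·-distribʳ x s t) (·-distribʳ y s t))
    (interchange (s · x) (t · x) (s · y) (t · y))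
  ·-distribʳ 𝟎 s t = sym (⊕-identityˡ 𝟎)
  ·-distribʳ (⊖ x) s t = trans (⊖-cong (·-distribʳ x s t)) (sym (⁻¹-∙-comm (s · x) (t · x)))

  ·-zeroˡ : ∀ x → S.0# · x ≋ 𝟎
  ·-zeroˡ x = identityʳ-unique (S.0# · x) (S.0# · x)
    (trans (sym (·-distribʳ x S.0# S.0#)) (·-congʳ x (S.+-identityˡ S.0#)))

  ·-identityˡ : ∀ x → S.1# · x ≋ x
  ·-identityˡ (m ⊗ n) = ⊗-cong (M.*ₗ-identityˡ m) N.≈ᴹ-refl
  ·-identityˡ (x ⊕ y) = ⊕-cong (·-identityˡ x) (·-identityˡ y)
  ·-identityˡ 𝟎 = refl
  ·-identityˡ (⊖ x) = ⊖-cong (·-identityˡ x)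

  ·-assoc : ∀ s t x → (s S.* t) · x ≋ s · (t · x)
  ·-assoc s t (m ⊗ n) = ⊗-cong (M.*ₗ-assoc s t m) N.≈ᴹ-refl
  ·-assoc s t (x ⊕ y) = ⊕-cong (·-assoc s t x) (·-assoc s t y)
  ·-assoc s t 𝟎 = refl
  ·-assoc s t (⊖ x) = ⊖-cong (·-assoc s t x)

  tensorModule : LeftModule S 0ℓ 0ℓ
  tensorModule = record
    { Carrierᴹ = Tensor
    ; _≈ᴹ_ = _≋_
    ; _+ᴹ_ = _⊕_
    ; _*ₗ_ = _·_
    ; 0ᴹ = 𝟎
    ; -ᴹ_ = ⊖_
    ; isLeftModule = record
      { isLeftSemimodule = record
        { +ᴹ-isCommutativeMonoid = AbelianGroup.isCommutativeMonoid tensorGroup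
        ; isPreleftSemimodule = record
          { *ₗ-cong = λ {s} {t} {x} {y} e f → trans (·-congʳ x e) (·-congˡ t f)
          ; *ₗ-zeroˡ = ·-zeroˡ
          ; *ₗ-distribʳ = ·-distribʳ
          ; *ₗ-identityˡ = ·-identityˡ
          ; *ₗ-assoc = ·-assoc
          ; *ₗ-zeroʳ = λ _ → refl
          ; *ₗ-distribˡ = λ _ _ _ → refl
          }
        }
      ; -ᴹ‿cong = ⊖-cong
      ; -ᴹ‿inverse = AbelianGroup.inverse tensorGroup
      }
    }

-- The free k-module on X: formal k-linear combinations of elements of X.
module FreeModule (k : CommutativeRing 0ℓ 0ℓ) (X : Setoid 0ℓ 0ℓ) where
  private
    module k = CommutativeRing k
    module X = Setoid X

  infixr 7 _·_
  infixl 6 _⊕_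
  infix  4 _≋_

  data FormalSum : Set where
    gen : X.Carrier → FormalSum
    _⊕_ : FormalSum → FormalSum → FormalSum
    𝟎   : FormalSum
    _·_ : k.Carrier → FormalSum → FormalSum

  data _≋_ : FormalSum → FormalSum → Set where
    refl     : ∀ {x} → x ≋ x
    sym      : ∀ {x y} → x ≋ y → y ≋ x
    trans    : ∀ {x y z} → x ≋ y → y ≋ z → x ≋ z
    gen-cong : ∀ {g h} → g X.≈ h → gen g ≋ gen h
    ⊕-cong   : ∀ {x x′ y y′} → x ≋ x′ → y ≋ y′ → x ⊕ y ≋ x′ ⊕ y′
    ·-cong   : ∀ {r s x y} → r k.≈ s → x ≋ y → r · x ≋ s · y
    ⊕-assoc  : ∀ x y z → (x ⊕ y) ⊕ z ≋ x ⊕ (y ⊕ z)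
    ⊕-comm   : ∀ x y → x ⊕ y ≋ y ⊕ x
    ⊕-identityˡ : ∀ x → 𝟎 ⊕ x ≋ x
    ·-zeroˡ     : ∀ x → k.0# · x ≋ 𝟎
    ·-identityˡ : ∀ x → k.1# · x ≋ x
    ·-assoc     : ∀ r s x → (r k.* s) · x ≋ r · (s · x)
    ·-distribˡ  : ∀ r x y → r · (x ⊕ y) ≋ r · x ⊕ r · y
    ·-distribʳ  : ∀ x r s → (r k.+ s) · x ≋ r · x ⊕ s · x

  ⊖_ : FormalSum → FormalSum
  ⊖ x = (k.- k.1#) · x

  ·-zeroʳ : ∀ r → r · 𝟎 ≋ 𝟎
  ·-zeroʳ r = trans (·-cong k.refl (sym (·-zeroˡ 𝟎)))
    (trans (sym (·-assoc r k.0# 𝟎)) (trans (·-cong (k.zeroʳ r) refl) (·-zeroˡ 𝟎)))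

  ⊖-inverseˡ : ∀ x → ⊖ x ⊕ x ≋ 𝟎
  ⊖-inverseˡ x = trans (⊕-cong refl (sym (·-identityˡ x)))
    (trans (sym (·-distribʳ x (k.- k.1#) k.1#)) (trans (·-cong (k.-‿inverseˡ k.1#) refl) (·-zeroˡ x)))

  freeModule : LeftModule k.ring 0ℓ 0ℓ
  freeModule = record
    { Carrierᴹ = FormalSum
    ; _≈ᴹ_ = _≋_
    ; _+ᴹ_ = _⊕_
    ; _*ₗ_ = _·_
    ; 0ᴹ = 𝟎
    ; -ᴹ_ = ⊖_
    ; isLeftModule = record
      { isLeftSemimodule = record
        { +ᴹ-isCommutativeMonoid = record
          { isMonoid = record
            { isSemigroup = record
              { isMagma = record
                { isEquivalence = record { refl = refl ; sym = sym ; trans = trans }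
                ; ∙-cong = ⊕-cong
                }
              ; assoc = ⊕-assoc
              }
            ; identity = ⊕-identityˡ , λ x → trans (⊕-comm x 𝟎) (⊕-identityˡ x)
            }
          ; comm = ⊕-comm
          }
        ; isPreleftSemimodule = record
          { *ₗ-cong = ·-cong
          ; *ₗ-zeroˡ = ·-zeroˡ
          ; *ₗ-distribʳ = ·-distribʳ
          ; *ₗ-identityˡ = ·-identityˡ
          ; *ₗ-assoc = ·-assoc
          ; *ₗ-zeroʳ = ·-zeroʳ
          ; *ₗ-distribˡ = ·-distribˡ
          }
        }
      ; -ᴹ‿cong = ·-cong k.refl
      ; -ᴹ‿inverse = ⊖-inverseˡ , λ x → trans (⊕-comm x (⊖ x)) (⊖-inverseˡ x)
      }
    }

  module LinearExtension (M : LeftModule k.ring 0ℓ 0ℓ) where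
    private module M = LeftModule M

    extend : (X.Carrier → M.Carrierᴹ) → FormalSum → M.Carrierᴹ
    extend f (gen g) = f g
    extend f (x ⊕ y) = extend f x M.+ᴹ extend f y
    extend f 𝟎       = M.0ᴹ
    extend f (r · x) = r M.*ₗ extend f x

    extend-cong : ∀ f → (∀ {g h} → g X.≈ h → f g M.≈ᴹ f h) →
                  ∀ {x y} → x ≋ y → extend f x M.≈ᴹ extend f y
    extend-cong f c refl = M.≈ᴹ-refl
    extend-cong f c (sym e) = M.≈ᴹ-sym (extend-cong f c e)
    extend-cong f c (trans e e′) = M.≈ᴹ-trans (extend-cong f c e) (extend-cong f c e′)
    extend-cong f c (gen-cong e) = c e
    extend-cong f c (⊕-cong e e′) = M.+ᴹ-cong (extend-cong f c e) (extend-cong f c e′)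
    extend-cong f c (·-cong r e) = M.*ₗ-cong r (extend-cong f c e)
    extend-cong f c (⊕-assoc x y z) = M.+ᴹ-assoc (extend f x) (extend f y) (extend f z)
    extend-cong f c (⊕-comm x y) = M.+ᴹ-comm (extend f x) (extend f y)
    extend-cong f c (⊕-identityˡ x) = M.+ᴹ-identityˡ (extend f x)
    extend-cong f c (·-zeroˡ x) = M.*ₗ-zeroˡ (extend f x)
    extend-cong f c (·-identityˡ x) = M.*ₗ-identityˡ (extend f x)
    extend-cong f c (·-assoc r s x) = M.*ₗ-assoc r s (extend f x)
    extend-cong f c (·-distribˡ r x y) = M.*ₗ-distribˡ r (extend f x) (extend f y)
    extend-cong f c (·-distribʳ x r s) = M.*ₗ-distribʳ (extend f x) r s

    extend-≗ : ∀ {f g} → (∀ h → f h M.≈ᴹ g h) → ∀ x → extend f x M.≈ᴹ extend g x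
    extend-≗ e (gen h) = e h
    extend-≗ e (x ⊕ y) = M.+ᴹ-cong (extend-≗ e x) (extend-≗ e y)
    extend-≗ e 𝟎 = M.≈ᴹ-refl
    extend-≗ e (r · x) = M.*ₗ-congˡ (extend-≗ e x)

-- The group algebra kG: the free k-module on G with multiplication extended
-- bilinearly from that of G.
module GroupAlgebra (k : CommutativeRing 0ℓ 0ℓ) (G : Group 0ℓ 0ℓ) where
  private
    module k = CommutativeRing k
    module G = Group G

  open FreeModule k G.setoid public
  open LinearExtension freeModule

  translate : G.Carrier → FormalSum → FormalSum
  translate g = extend (λ h → gen (g G.∙ h))

  infixl 7 _⊛_
  _⊛_ : FormalSum → FormalSum → FormalSum
  x ⊛ y = extend (λ g → translate g y) x

  translate-cong : ∀ {g g′ y y′} → g G.≈ g′ → y ≋ y′ → translate g y ≋ translate g′ y′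
  translate-cong {g} {g′} {y} e f = trans
    (extend-≗ (λ h → gen-cong (G.∙-congʳ e)) y)
    (extend-cong _ (λ e → gen-cong (G.∙-congˡ e)) f)

  ⊛-cong : ∀ {x x′ y y′} → x ≋ x′ → y ≋ y′ → x ⊛ y ≋ x′ ⊛ y′
  ⊛-cong {x} {x′} {y} {y′} e f = trans
    (extend-≗ (λ g → translate-cong G.refl f) x)
    (extend-cong _ (λ h → translate-cong {y = y′} h refl) e)

  private
    module kG = LeftModule freeModule
    open import Algebra.Properties.CommutativeSemigroup
      (AbelianGroup.commutativeSemigroup kG.+ᴹ-abelianGroup) using (interchange)

  ⊛-distribˡ : ∀ x y z → x ⊛ (y ⊕ z) ≋ x ⊛ y ⊕ x ⊛ z
  ⊛-distribˡ (gen g) y z = refl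
  ⊛-distribˡ (x ⊕ x′) y z = trans (⊕-cong (⊛-distribˡ x y z) (⊛-distribˡ x′ y z))
    (interchange (x ⊛ y) (x ⊛ z) (x′ ⊛ y) (x′ ⊛ z))
  ⊛-distribˡ 𝟎 y z = sym (⊕-identityˡ 𝟎)
  ⊛-distribˡ (r · x) y z = trans (·-cong k.refl (⊛-distribˡ x y z)) (·-distribˡ r (x ⊛ y) (x ⊛ z))

  ⊛-zeroʳ : ∀ x → x ⊛ 𝟎 ≋ 𝟎
  ⊛-zeroʳ (gen g) = refl
  ⊛-zeroʳ (x ⊕ y) = trans (⊕-cong (⊛-zeroʳ x) (⊛-zeroʳ y)) (⊕-identityˡ 𝟎)
  ⊛-zeroʳ 𝟎 = refl
  ⊛-zeroʳ (r · x) = trans (·-cong k.refl (⊛-zeroʳ x)) (·-zeroʳ r)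

  ·-swap : ∀ r s x → r · (s · x) ≋ s · (r · x)
  ·-swap r s x = trans (sym (·-assoc r s x)) (trans (·-cong (k.*-comm r s) refl) (·-assoc s r x))

  ⊛-· : ∀ r x y → x ⊛ (r · y) ≋ r · (x ⊛ y)
  ⊛-· r (gen g) y = refl
  ⊛-· r (x ⊕ x′) y = trans (⊕-cong (⊛-· r x y) (⊛-· r x′ y)) (sym (·-distribˡ r (x ⊛ y) (x′ ⊛ y)))
  ⊛-· r 𝟎 y = sym (·-zeroʳ r)
  ⊛-· r (s · x) y = trans (·-cong k.refl (⊛-· r x y)) (·-swap s r (x ⊛ y))

  translate-translate : ∀ g h z → translate (g G.∙ h) z ≋ translate g (translate h z)
  translate-translate g h (gen x) = gen-cong (G.assoc g h x)
  translate-translate g h (x ⊕ y) = ⊕-cong (translate-translate g h x) (translate-translate g h y)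
  translate-translate g h 𝟎 = refl
  translate-translate g h (r · x) = ·-cong k.refl (translate-translate g h x)

  translate-⊛ : ∀ g y z → translate g y ⊛ z ≋ translate g (y ⊛ z)
  translate-⊛ g (gen h) z = translate-translate g h z
  translate-⊛ g (x ⊕ y) z = ⊕-cong (translate-⊛ g x z) (translate-⊛ g y z)
  translate-⊛ g 𝟎 z = refl
  translate-⊛ g (r · x) z = ·-cong k.refl (translate-⊛ g x z)

  ⊛-assoc : ∀ x y z → (x ⊛ y) ⊛ z ≋ x ⊛ (y ⊛ z)
  ⊛-assoc (gen g) y z = translate-⊛ g y z
  ⊛-assoc (x ⊕ x′) y z = ⊕-cong (⊛-assoc x y z) (⊛-assoc x′ y z)
  ⊛-assoc 𝟎 y z = refl
  ⊛-assoc (r · x) y z = ·-cong k.refl (⊛-assoc x y z)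

  ⊛-identityˡ : ∀ x → gen G.ε ⊛ x ≋ x
  ⊛-identityˡ (gen g) = gen-cong (G.identityˡ g)
  ⊛-identityˡ (x ⊕ y) = ⊕-cong (⊛-identityˡ x) (⊛-identityˡ y)
  ⊛-identityˡ 𝟎 = refl
  ⊛-identityˡ (r · x) = ·-cong k.refl (⊛-identityˡ x)

  ⊛-identityʳ : ∀ x → x ⊛ gen G.ε ≋ x
  ⊛-identityʳ (gen g) = gen-cong (G.identityʳ g)
  ⊛-identityʳ (x ⊕ y) = ⊕-cong (⊛-identityʳ x) (⊛-identityʳ y)
  ⊛-identityʳ 𝟎 = refl
  ⊛-identityʳ (r · x) = ·-cong k.refl (⊛-identityʳ x)

  groupAlgebra : Ring 0ℓ 0ℓ
  groupAlgebra = record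
    { Carrier = FormalSum
    ; _≈_ = _≋_
    ; _+_ = _⊕_
    ; _*_ = _⊛_
    ; -_ = ⊖_
    ; 0# = 𝟎
    ; 1# = gen G.ε
    ; isRing = record
      { +-isAbelianGroup = kG.+ᴹ-isAbelianGroup
      ; *-cong = ⊛-cong
      ; *-assoc = ⊛-assoc
      ; *-identity = ⊛-identityˡ , ⊛-identityʳ
      ; distrib = ⊛-distribˡ , λ _ _ _ → refl
      }
    }

  scalar : RingHomomorphism k.rawRing (Ring.rawRing groupAlgebra)
  scalar = record
    { ⟦_⟧ = λ r → r · gen G.ε
    ; isRingHomomorphism = record
      { isSemiringHomomorphism = record
        { isNearSemiringHomomorphism = record
          { +-isMonoidHomomorphism = record
            { isMagmaHomomorphism = record
              { isRelHomomorphism = record { cong = λ e → ·-cong e refl }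
              ; homo = ·-distribʳ (gen G.ε)
              }
            ; ε-homo = ·-zeroˡ (gen G.ε)
            }
          ; *-homo = λ r s → trans (·-assoc r s (gen G.ε))
              (·-cong k.refl (·-cong k.refl (sym (gen-cong (G.identityˡ G.ε)))))
          }
        ; 1#-homo = ·-identityˡ (gen G.ε)
        }
      ; -‿homo = λ r → trans (·-cong (k.sym (-1*x≈-x r)) refl) (·-assoc (k.- k.1#) r (gen G.ε))
      }
    }
    where open import Algebra.Properties.Ring k.ring using (-1*x≈-x)

  augmentation : RingHomomorphism (Ring.rawRing groupAlgebra) k.rawRing
  augmentation = record
    { ⟦_⟧ = aug
    ; isRingHomomorphism = record
      { isSemiringHomomorphism = record
        { isNearSemiringHomomorphism = record
          { +-isMonoidHomomorphism = record
            { isMagmaHomomorphism = record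
              { isRelHomomorphism = record { cong = K.extend-cong _ (λ _ → k.refl) }
              ; homo = λ _ _ → k.refl
              }
            ; ε-homo = k.refl
            }
          ; *-homo = aug-⊛
          }
        ; 1#-homo = k.refl
        }
      ; -‿homo = λ x → -1*x≈-x (aug x)
      }
    }
    where
    open import Algebra.Properties.Ring k.ring using (-1*x≈-x)
    module K = LinearExtension (TensorUnit.leftModule {R = k.ring})
    aug : FormalSum → k.Carrier
    aug = K.extend (λ _ → k.1#)
    aug-translate : ∀ g y → aug (translate g y) k.≈ aug y
    aug-translate g (gen h) = k.refl
    aug-translate g (x ⊕ y) = k.+-cong (aug-translate g x) (aug-translate g y)
    aug-translate g 𝟎 = k.refl
    aug-translate g (r · x) = k.*-congˡ (aug-translate g x)
    aug-⊛ : ∀ x y → aug (x ⊛ y) k.≈ aug x k.* aug y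
    aug-⊛ (gen g) y = k.trans (aug-translate g y) (k.sym (k.*-identityˡ (aug y)))
    aug-⊛ (x ⊕ x′) y = k.trans (k.+-cong (aug-⊛ x y) (aug-⊛ x′ y)) (k.sym (k.distribʳ (aug y) (aug x) (aug x′)))
    aug-⊛ 𝟎 y = k.sym (k.zeroˡ (aug y))
    aug-⊛ (r · x) y = k.trans (k.*-congˡ (aug-⊛ x y)) (k.sym (k.*-assoc r (aug x) (aug y)))

  trivialModule : LeftModule groupAlgebra 0ℓ 0ℓ
  trivialModule = restrictScalars {R = groupAlgebra} {S = k.ring} augmentation (TensorUnit.leftModule {R = k.ring})

module _ (k : CommutativeRing 0ℓ 0ℓ) {G H : Group 0ℓ 0ℓ}
         (φ : GroupHomomorphism (Group.rawGroup G) (Group.rawGroup H)) where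
  private
    module k = CommutativeRing k
    module G = Group G
    module H = Group H
    module kG = GroupAlgebra k G
    module kH = GroupAlgebra k H
    module φ = GroupHomomorphism φ
    open kG using (gen; _⊕_; 𝟎; _·_)

  open kG.LinearExtension kH.freeModule

  mapAlgebra : RingHomomorphism (Ring.rawRing kG.groupAlgebra) (Ring.rawRing kH.groupAlgebra)
  mapAlgebra = record
    { ⟦_⟧ = map
    ; isRingHomomorphism = record
      { isSemiringHomomorphism = record
        { isNearSemiringHomomorphism = record
          { +-isMonoidHomomorphism = record
            { isMagmaHomomorphism = record
              { isRelHomomorphism = record { cong = extend-cong _ (λ e → kH.gen-cong (φ.⟦⟧-cong e)) }
              ; homo = λ _ _ → kH.refl
              }
            ; ε-homo = kH.refl
            }
          ; *-homo = map-⊛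
          }
        ; 1#-homo = kH.gen-cong φ.ε-homo
        }
      ; -‿homo = λ _ → kH.refl
      }
    }
    where
    map : kG.FormalSum → kH.FormalSum
    map = extend (λ g → kH.gen φ.⟦ g ⟧)
    map-translate : ∀ g y → map (kG.translate g y) kH.≋ kH.translate φ.⟦ g ⟧ (map y)
    map-translate g (gen h) = kH.gen-cong (φ.homo g h)
    map-translate g (x ⊕ y) = kH.⊕-cong (map-translate g x) (map-translate g y)
    map-translate g 𝟎 = kH.refl
    map-translate g (r · x) = kH.·-cong k.refl (map-translate g x)
    map-⊛ : ∀ x y → map (x kG.⊛ y) kH.≋ (map x kH.⊛ map y)
    map-⊛ (gen g) y = map-translate g y
    map-⊛ (x ⊕ x′) y = kH.⊕-cong (map-⊛ x y) (map-⊛ x′ y)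
    map-⊛ 𝟎 y = kH.refl
    map-⊛ (r · x) y = kH.·-cong k.refl (map-⊛ x y)

record Subgroup (G : Group 0ℓ 0ℓ) : Set₁ where
  open Group G
  field
    Member    : Carrier → Set
    resp      : ∀ {x y} → x ≈ y → Member x → Member y
    ∙-closed  : ∀ {x y} → Member x → Member y → Member (x ∙ y)
    ε-closed  : Member ε
    ⁻¹-closed : ∀ {x} → Member x → Member (x ⁻¹)

  group : Group 0ℓ 0ℓ
  group = record
    { Carrier = Σ Carrier Member
    ; _≈_ = λ x y → proj₁ x ≈ proj₁ y
    ; _∙_ = λ (x , p) (y , q) → x ∙ y , ∙-closed p q
    ; ε = ε , ε-closed
    ; _⁻¹ = λ (x , p) → x ⁻¹ , ⁻¹-closed p
    ; isGroup = record
      { isMonoid = record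
        { isSemigroup = record
          { isMagma = record
            { isEquivalence = record { refl = refl ; sym = sym ; trans = trans }
            ; ∙-cong = ∙-cong
            }
          ; assoc = λ (x , _) (y , _) (z , _) → assoc x y z
          }
        ; identity = (λ (x , _) → identityˡ x) , (λ (x , _) → identityʳ x)
        }
      ; inverse = (λ (x , _) → inverseˡ x) , (λ (x , _) → inverseʳ x)
      ; ⁻¹-cong = ⁻¹-cong
      }
    }

  inclusion : GroupHomomorphism (Group.rawGroup group) rawGroup
  inclusion = record
    { ⟦_⟧ = proj₁
    ; isGroupHomomorphism = record
      { isMonoidHomomorphism = record
        { isMagmaHomomorphism = record
          { isRelHomomorphism = record { cong = λ e → e }
          ; homo = λ _ _ → refl
          }
        ; ε-homo = refl
        }
      ; ⁻¹-homo = λ _ → refl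
      }
    }

-- Subgroups L and U of G such that P = LU is a semidirect product, U finite.
record LeviPair (G : Group 0ℓ 0ℓ) : Set₁ where
  open Group G
  field
    L U : Subgroup G
  module L = Subgroup L
  module U = Subgroup U
  field
    normalises : ∀ {l u} → L.Member l → U.Member u → U.Member (l ∙ u ∙ l ⁻¹)
    disjoint   : ∀ {g} → L.Member g → U.Member g → g ≈ ε
    ∣U∣        : ℕ
    enumerateU : Inverse (≡.setoid (Fin ∣U∣)) (Group.setoid U.group)

  instance
    ∣U∣-nonZero : NonZero ∣U∣
    ∣U∣-nonZero = Finₚ.nonZeroIndex (Inverse.from enumerateU (Group.ε U.group))

  open import Algebra.Properties.Group G
    using (⁻¹-anti-homo-∙; ⁻¹-involutive; x∙y⁻¹≈ε⇒x≈y; //-rightDividesˡ; //-rightDividesʳ; \\-leftDividesʳ; \\-leftDividesˡ)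
  open import Relation.Binary.Reasoning.Setoid setoid

  conj⁻¹ : ∀ {l u} → L.Member l → U.Member u → U.Member (l ⁻¹ ∙ u ∙ l)
  conj⁻¹ {l} p q = U.resp (∙-congˡ (⁻¹-involutive l)) (normalises (L.⁻¹-closed p) q)

  private
    mul-lemma : ∀ l u l′ u′ → (l ∙ u) ∙ (l′ ∙ u′) ≈ (l ∙ l′) ∙ ((l′ ⁻¹ ∙ u ∙ l′) ∙ u′)
    mul-lemma l u l′ u′ = begin
      (l ∙ u) ∙ (l′ ∙ u′)                      ≈⟨ assoc l u (l′ ∙ u′) ⟩
      l ∙ (u ∙ (l′ ∙ u′))                      ≈⟨ ∙-congˡ (assoc u l′ u′) ⟨
      l ∙ ((u ∙ l′) ∙ u′)                      ≈⟨ ∙-congˡ (∙-congʳ (\\-leftDividesˡ l′ (u ∙ l′))) ⟨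
      l ∙ ((l′ ∙ (l′ ⁻¹ ∙ (u ∙ l′))) ∙ u′)     ≈⟨ ∙-congˡ (∙-congʳ (∙-congˡ (assoc (l′ ⁻¹) u l′))) ⟨
      l ∙ ((l′ ∙ (l′ ⁻¹ ∙ u ∙ l′)) ∙ u′)       ≈⟨ ∙-congˡ (assoc l′ _ u′) ⟩
      l ∙ (l′ ∙ ((l′ ⁻¹ ∙ u ∙ l′) ∙ u′))       ≈⟨ assoc l l′ _ ⟨
      (l ∙ l′) ∙ ((l′ ⁻¹ ∙ u ∙ l′) ∙ u′)       ∎

    inv-lemma : ∀ l u → (l ∙ u) ⁻¹ ≈ l ⁻¹ ∙ (l ∙ u ⁻¹ ∙ l ⁻¹)
    inv-lemma l u = begin
      (l ∙ u) ⁻¹                        ≈⟨ ⁻¹-anti-homo-∙ l u ⟩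
      u ⁻¹ ∙ l ⁻¹                       ≈⟨ \\-leftDividesʳ l (u ⁻¹ ∙ l ⁻¹) ⟨
      l ⁻¹ ∙ (l ∙ (u ⁻¹ ∙ l ⁻¹))        ≈⟨ ∙-congˡ (assoc l (u ⁻¹) (l ⁻¹)) ⟨
      l ⁻¹ ∙ (l ∙ u ⁻¹ ∙ l ⁻¹)          ∎

    levi-unique : ∀ {l u l′ u′} → L.Member l → U.Member u → L.Member l′ → U.Member u′ →
                  l ∙ u ≈ l′ ∙ u′ → l ≈ l′
    levi-unique {l} {u} {l′} {u′} pl pu pl′ pu′ e = begin
      l                          ≈⟨ \\-leftDividesˡ l′ l ⟨
      l′ ∙ (l′ ⁻¹ ∙ l)           ≈⟨ ∙-congˡ (disjoint (L.∙-closed (L.⁻¹-closed pl′) pl)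
                                      (U.resp (sym key) (U.∙-closed pu′ (U.⁻¹-closed pu)))) ⟩
      l′ ∙ ε                     ≈⟨ identityʳ l′ ⟩
      l′ ∎
      where
      key : l′ ⁻¹ ∙ l ≈ u′ ∙ u ⁻¹
      key = begin
        l′ ⁻¹ ∙ l                      ≈⟨ ∙-congˡ (//-rightDividesʳ u l) ⟨
        l′ ⁻¹ ∙ ((l ∙ u) ∙ u ⁻¹)       ≈⟨ ∙-congˡ (∙-congʳ e) ⟩
        l′ ⁻¹ ∙ ((l′ ∙ u′) ∙ u ⁻¹)     ≈⟨ ∙-congˡ (assoc l′ u′ (u ⁻¹)) ⟩
        l′ ⁻¹ ∙ (l′ ∙ (u′ ∙ u ⁻¹))     ≈⟨ \\-leftDividesʳ l′ (u′ ∙ u ⁻¹) ⟩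
        u′ ∙ u ⁻¹                      ∎

  P : Subgroup G
  P = record
    { Member = λ g → Σ (Carrier × Carrier) λ (l , u) → L.Member l × U.Member u × g ≈ l ∙ u
    ; resp = λ e (lu , pl , pu , f) → lu , pl , pu , trans (sym e) f
    ; ∙-closed = λ ((l , u) , pl , pu , f) ((l′ , u′) , pl′ , pu′ , f′) →
        (l ∙ l′ , (l′ ⁻¹ ∙ u ∙ l′) ∙ u′) , L.∙-closed pl pl′ , U.∙-closed (conj⁻¹ pl′ pu) pu′
        , trans (∙-cong f f′) (mul-lemma l u l′ u′)
    ; ε-closed = (ε , ε) , L.ε-closed , U.ε-closed , sym (identityˡ ε)
    ; ⁻¹-closed = λ ((l , u) , pl , pu , f) →
        (l ⁻¹ , l ∙ u ⁻¹ ∙ l ⁻¹) , L.⁻¹-closed pl , normalises pl (U.⁻¹-closed pu)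
        , trans (⁻¹-cong f) (inv-lemma l u)
    }
  module P = Subgroup P

  -- The projection l u ↦ l.
  P→L : GroupHomomorphism (Group.rawGroup P.group) (Group.rawGroup L.group)
  P→L = record
    { ⟦_⟧ = λ (g , (l , u) , pl , pu , f) → l , pl
    ; isGroupHomomorphism = record
      { isMonoidHomomorphism = record
        { isMagmaHomomorphism = record
          { isRelHomomorphism = record
            { cong = λ {(_ , _ , pl , pu , f)} {(_ , _ , pl′ , pu′ , f′)} e →
                levi-unique pl pu pl′ pu′ (trans (sym f) (trans e f′)) }
          ; homo = λ _ _ → refl
          }
        ; ε-homo = refl
        }
      ; ⁻¹-homo = λ _ → refl
      }
    }

  conjugation : ∀ {l} → L.Member l → Permutation′ ∣U∣
  conjugation {l} p = permutation
    (λ i → from (c (to i))) (λ i → from (c⁻¹ (to i)))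
    (λ i → from-inverse {i} (U-trans {c (to (from (c⁻¹ (to i))))} {c (c⁻¹ (to i))} {to i}
             (∙-congʳ (∙-congˡ (strictlyInverseˡ (c⁻¹ (to i))))) (cc⁻¹ (proj₁ (to i)))))
    (λ i → from-inverse {i} (U-trans {c⁻¹ (to (from (c (to i))))} {c⁻¹ (c (to i))} {to i}
             (∙-congʳ (∙-congˡ (strictlyInverseˡ (c (to i))))) (c⁻¹c (proj₁ (to i)))))
    where
    open Inverse enumerateU using (to; from; strictlyInverseˡ) renaming (inverseʳ to from-inverse)
    U-trans : ∀ {x y z : Group.Carrier U.group} → proj₁ x ≈ proj₁ y → proj₁ y ≈ proj₁ z → proj₁ x ≈ proj₁ z
    U-trans = trans
    c c⁻¹ : Group.Carrier U.group → Group.Carrier U.group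
    c (u , q) = l ∙ u ∙ l ⁻¹ , normalises p q
    c⁻¹ (u , q) = l ⁻¹ ∙ u ∙ l , conj⁻¹ p q
    cc⁻¹ : ∀ u → l ∙ (l ⁻¹ ∙ u ∙ l) ∙ l ⁻¹ ≈ u
    cc⁻¹ u = begin
      l ∙ (l ⁻¹ ∙ u ∙ l) ∙ l ⁻¹      ≈⟨ ∙-congʳ (∙-congˡ (assoc (l ⁻¹) u l)) ⟩
      l ∙ (l ⁻¹ ∙ (u ∙ l)) ∙ l ⁻¹    ≈⟨ ∙-congʳ (\\-leftDividesˡ l (u ∙ l)) ⟩
      (u ∙ l) ∙ l ⁻¹                 ≈⟨ //-rightDividesʳ l u ⟩
      u ∎
    c⁻¹c : ∀ u → l ⁻¹ ∙ (l ∙ u ∙ l ⁻¹) ∙ l ≈ u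
    c⁻¹c u = begin
      l ⁻¹ ∙ (l ∙ u ∙ l ⁻¹) ∙ l      ≈⟨ ∙-congʳ (∙-congˡ (assoc l u (l ⁻¹))) ⟩
      l ⁻¹ ∙ (l ∙ (u ∙ l ⁻¹)) ∙ l    ≈⟨ ∙-congʳ (\\-leftDividesʳ l (u ∙ l ⁻¹)) ⟩
      (u ∙ l ⁻¹) ∙ l                 ≈⟨ //-rightDividesˡ l u ⟩
      u ∎

-- recip m stands for 1/m in k.
module HarishChandra (k : CommutativeRing 0ℓ 0ℓ)
  (recip : (m : ℕ) .{{_ : NonZero m}} → CommutativeRing.Carrier k)
  (G : Group 0ℓ 0ℓ) (levi : LeviPair G) where

  private
    module k = CommutativeRing k
    module G = Group G
  open LeviPair levi
  private
    module kL = GroupAlgebra k L.group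
    module kP = GroupAlgebra k P.group
  module kG = GroupAlgebra k G
  open kG using (gen; _⊛_; _≋_; translate)

  private
    𝕜G 𝕜L 𝕜P : Ring 0ℓ 0ℓ
    𝕜G = kG.groupAlgebra
    𝕜L = kL.groupAlgebra
    𝕜P = kP.groupAlgebra

    open import Algebra.Properties.CommutativeMonoid.Sum (Ring.+-commutativeMonoid 𝕜G)
      using (sum; sum-cong-≋; sum-permute)

    elementU : Fin ∣U∣ → G.Carrier
    elementU i = proj₁ (Inverse.to enumerateU i)

  e_U : kG.FormalSum
  e_U = recip ∣U∣ kG.· sum (λ i → gen (elementU i))

  L→G : RingHomomorphism (Ring.rawRing 𝕜L) (Ring.rawRing 𝕜G)
  L→G = mapAlgebra k {L.group} {G} L.inclusion
  private module L→G = RingHomomorphism L→G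

  translate-sum : ∀ g {n} (f : Vector G.Carrier n) →
    translate g (sum (λ i → gen (f i))) ≋ sum (λ i → gen (g G.∙ f i))
  translate-sum g {zero} f = kG.refl
  translate-sum g {suc n} f = kG.⊕-cong kG.refl (translate-sum g (λ i → f (Fin.suc i)))

  sum-⊛ : ∀ g {n} (f : Vector G.Carrier n) →
    sum (λ i → gen (f i)) ⊛ gen g ≋ sum (λ i → gen (f i G.∙ g))
  sum-⊛ g {zero} f = kG.refl
  sum-⊛ g {suc n} f = kG.⊕-cong kG.refl (sum-⊛ g (λ i → f (Fin.suc i)))

  l-e_U : ∀ {l} → L.Member l → gen l ⊛ e_U ≋ e_U ⊛ gen l
  l-e_U {l} p = kG.·-cong k.refl (kG.trans (translate-sum l elementU)
    (kG.trans (sum-cong-≋ (λ i → kG.gen-cong (move i)))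
    (kG.trans (kG.sym (sum-permute (λ i → gen (elementU i G.∙ l)) (conjugation p)))
    (kG.sym (sum-⊛ l elementU)))))
    where
    open import Algebra.Properties.Group G using (//-rightDividesˡ)
    move : ∀ i → l G.∙ elementU i G.≈ elementU (conjugation p ⟨$⟩ʳ i) G.∙ l
    move i = G.trans (G.sym (//-rightDividesˡ l (l G.∙ elementU i)))
      (G.∙-congʳ (G.sym (Inverse.strictlyInverseˡ enumerateU
        (l G.∙ elementU i G.∙ l G.⁻¹ , normalises p (proj₂ (Inverse.to enumerateU i))))))

  e_U-central : ∀ a → L→G.⟦ a ⟧ ⊛ e_U ≋ e_U ⊛ L→G.⟦ a ⟧
  e_U-central (kL.gen (l , p)) = l-e_U p
  e_U-central (a kL.⊕ b) = kG.trans (kG.⊕-cong (e_U-central a) (e_U-central b))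
    (kG.sym (kG.⊛-distribˡ e_U L→G.⟦ a ⟧ L→G.⟦ b ⟧))
  e_U-central kL.𝟎 = kG.sym (kG.⊛-zeroʳ e_U)
  e_U-central (r kL.· a) = kG.trans (kG.·-cong k.refl (e_U-central a))
    (kG.sym (kG.⊛-· r e_U L→G.⟦ a ⟧))

  -- Harish-Chandra restriction e_U M: the elements x of M of the form e_U y.
  Resf : LeftModule 𝕜G 0ℓ 0ℓ → LeftModule 𝕜L 0ℓ 0ℓ
  Resf M = record
    { Carrierᴹ = Σ Carrierᴹ λ x → ∃ λ y → x ≈ᴹ e_U *ₗ y
    ; _≈ᴹ_ = λ x y → proj₁ x ≈ᴹ proj₁ y
    ; _+ᴹ_ = λ (x , y , e) (x′ , y′ , e′) →
        x +ᴹ x′ , y +ᴹ y′ , ≈ᴹ-trans (+ᴹ-cong e e′) (≈ᴹ-sym (*ₗ-distribˡ e_U y y′))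
    ; _*ₗ_ = λ a (x , y , e) → L→G.⟦ a ⟧ *ₗ x , L→G.⟦ a ⟧ *ₗ y ,
        ≈ᴹ-trans (*ₗ-congˡ e) (≈ᴹ-trans (≈ᴹ-sym (*ₗ-assoc L→G.⟦ a ⟧ e_U y))
          (≈ᴹ-trans (*ₗ-congʳ (e_U-central a)) (*ₗ-assoc e_U L→G.⟦ a ⟧ y)))
    ; 0ᴹ = 0ᴹ , 0ᴹ , ≈ᴹ-sym (*ₗ-zeroʳ e_U)
    ; -ᴹ_ = λ (x , y , e) → -ᴹ x , -ᴹ y , ≈ᴹ-trans (-ᴹ‿cong e)
        (≈ᴹ-sym (inverseˡ-uniqueᴹ (e_U *ₗ -ᴹ y) (e_U *ₗ y)
          (≈ᴹ-trans (≈ᴹ-sym (*ₗ-distribˡ e_U (-ᴹ y) y))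
            (≈ᴹ-trans (*ₗ-congˡ (-ᴹ‿inverseˡ y)) (*ₗ-zeroʳ e_U)))))
    ; isLeftModule = record
      { isLeftSemimodule = record
        { +ᴹ-isCommutativeMonoid = record
          { isMonoid = record
            { isSemigroup = record
              { isMagma = record
                { isEquivalence = record { refl = ≈ᴹ-refl ; sym = ≈ᴹ-sym ; trans = ≈ᴹ-trans }
                ; ∙-cong = +ᴹ-cong
                }
              ; assoc = λ (x , _) (y , _) (z , _) → +ᴹ-assoc x y z
              }
            ; identity = (λ (x , _) → +ᴹ-identityˡ x) , (λ (x , _) → +ᴹ-identityʳ x)
            }
          ; comm = λ (x , _) (y , _) → +ᴹ-comm x y
          }
        ; isPreleftSemimodule = record
          { *ₗ-cong = LM.*ₗ-cong
          ; *ₗ-zeroˡ = λ (x , _) → LM.*ₗ-zeroˡ x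
          ; *ₗ-distribʳ = λ (x , _) → LM.*ₗ-distribʳ x
          ; *ₗ-identityˡ = λ (x , _) → LM.*ₗ-identityˡ x
          ; *ₗ-assoc = λ a b (x , _) → LM.*ₗ-assoc a b x
          ; *ₗ-zeroʳ = LM.*ₗ-zeroʳ
          ; *ₗ-distribˡ = λ a (x , _) (y , _) → LM.*ₗ-distribˡ a x y
          }
        }
      ; -ᴹ‿cong = -ᴹ‿cong
      ; -ᴹ‿inverse = (λ (x , _) → -ᴹ‿inverseˡ x) , (λ (x , _) → -ᴹ‿inverseʳ x)
      }
    }
    where
    open LeftModule M
    open import Algebra.Module.Properties.LeftModule M using (inverseˡ-uniqueᴹ)
    module LM = LeftModule (restrictScalars {R = 𝕜L} {S = 𝕜G} L→G M)

  Inf : LeftModule 𝕜L 0ℓ 0ℓ → LeftModule 𝕜P 0ℓ 0ℓ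
  Inf = restrictScalars {R = 𝕜P} {S = 𝕜L} (mapAlgebra k {P.group} {L.group} P→L)

  module Ind (W : LeftModule 𝕜L 0ℓ 0ℓ) =
    TensorProduct {S = 𝕜G} {R = 𝕜P}
      (ringAsBimodule {R = 𝕜P} {S = 𝕜G} (mapAlgebra k {P.group} {G} P.inclusion)) (Inf W)

  Indf : LeftModule 𝕜L 0ℓ 0ℓ → LeftModule 𝕜G 0ℓ 0ℓ
  Indf W = Ind.tensorModule W

  IR : ℕ → LeftModule 𝕜G 0ℓ 0ℓ
  IR zero    = kG.trivialModule
  IR (suc r) = Indf (Resf (IR r))

  IR½ : ℕ → LeftModule 𝕜L 0ℓ 0ℓ
  IR½ r = Resf (IR r)

  _⊗[_]_ : kG.FormalSum → (M : LeftModule 𝕜G 0ℓ 0ℓ) → LeftModule.Carrierᴹ M →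
           LeftModule.Carrierᴹ (Indf (Resf M))
  g ⊗[ M ] v = Ind._⊗_ {Resf M} g (e_U *ₗ v , v , ≈ᴹ-refl)
    where open LeftModule M

  overScalars : LeftModule 𝕜G 0ℓ 0ℓ → LeftModule k.ring 0ℓ 0ℓ
  overScalars = restrictScalars {R = k.ring} {S = 𝕜G} kG.scalar

  overScalarsL : LeftModule 𝕜L 0ℓ 0ℓ → LeftModule k.ring 0ℓ 0ℓ
  overScalarsL = restrictScalars {R = k.ring} {S = 𝕜L} kL.scalar

  ι : (r : ℕ) → LeftModule.Carrierᴹ (IR½ r) → LeftModule.Carrierᴹ (IR (suc r))
  ι r w = Ind._⊗_ {IR½ r} (Ring.1# 𝕜G) w

module LinearAlgebra (k : CommutativeRing 0ℓ 0ℓ)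
                     (V : LeftModule (CommutativeRing.ring k) 0ℓ 0ℓ) where
  private
    module k = CommutativeRing k
  open LeftModule V

  combination : {I : Set} → (I → Carrierᴹ) → (I → k.Carrier) → List I → Carrierᴹ
  combination v c is = List.foldr (λ i x → c i *ₗ v i +ᴹ x) 0ᴹ is

  LinearlyIndependent : {I : Set} → (I → Carrierᴹ) → Set
  LinearlyIndependent {I} v = (is : List I) → Unique is → (c : I → k.Carrier) →
    combination v c is ≈ᴹ 0ᴹ → ∀ {i} → i ∈ is → c i k.≈ k.0#

  record IsBasisOf {I : Set} (S : Carrierᴹ → Set) (v : I → Carrierᴹ) : Set where
    field
      members     : ∀ i → S (v i)
      independent : LinearlyIndependent v
      spanning    : ∀ x → S x → Σ (List I) λ is → Σ (I → k.Carrier) λ c → x ≈ᴹ combination v c is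

  IsBasis : {I : Set} → (I → Carrierᴹ) → Set
  IsBasis = IsBasisOf (λ _ → ⊤)

  HasDimension : ℕ → Set
  HasDimension d = Σ (Fin d → Carrierᴹ) IsBasis

IsPrimePower : ℕ → Set
IsPrimePower q = Σ ℕ λ p → Σ ℕ λ e → Prime p × 1 ≤ e × q ≡ p ^ e

record FiniteField (q : ℕ) : Set₁ where
  infixl 6 _+_
  infixl 7 _*_
  infix  8 -_
  field
    Carrier : Set
    _+_ _*_ : Carrier → Carrier → Carrier
    -_      : Carrier → Carrier
    0# 1#   : Carrier
    isCommutativeRing : IsCommutativeRing _≡_ _+_ _*_ -_ 0# 1#
    0≢1         : 0# ≢ 1#
    invertible  : ∀ x → x ≢ 0# → ∃ λ y → x * y ≡ 1#
    enumeration : Fin q ↔ Carrier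

  commutativeRing : CommutativeRing 0ℓ 0ℓ
  commutativeRing = record { isCommutativeRing = isCommutativeRing }

  instance
    q-nonZero : NonZero q
    q-nonZero = Finₚ.nonZeroIndex (Inverse.from enumeration 0#)

    q∸1-nonZero : NonZero (q ∸ 1)
    q∸1-nonZero = two q (Inverse.from enumeration)
      (λ e → 0≢1 (≡.trans (≡.sym (Inverse.strictlyInverseˡ enumeration 0#))
        (≡.trans (≡.cong (Inverse.to enumeration) e) (Inverse.strictlyInverseˡ enumeration 1#))))
      where
      two : ∀ q (f : Carrier → Fin q) → f 0# ≢ f 1# → NonZero (q ∸ 1)
      two zero f _ with () ← f 0#
      two (suc zero) f ne = contradiction (fin1 (f 0#) (f 1#)) ne
        where
        fin1 : (i j : Fin 1) → i ≡ j
        fin1 zero zero = ≡.refl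
      two (suc (suc q)) f _ = _

  enumerateVec : ∀ l → Fin (q ^ l) ↔ Vec Carrier l
  enumerateVec zero = mk↔ₛ′ (λ _ → []) (λ _ → zero) (λ { [] → ≡.refl }) (λ { zero → ≡.refl })
  enumerateVec (suc l) =
    ↔-trans Finₚ.*↔× (↔-trans (enumeration ×-↔ enumerateVec l)
      (mk↔ₛ′ (λ (x , xs) → x ∷ xs) (λ { (x ∷ xs) → x , xs }) (λ { (x ∷ xs) → ≡.refl }) (λ { (x , xs) → ≡.refl })))

unitGroup : Monoid 0ℓ 0ℓ → Group 0ℓ 0ℓ
unitGroup M = record
  { Carrier = Σ (Carrier × Carrier) λ (x , y) → x ∙ y ≈ ε × y ∙ x ≈ ε
  ; _≈_ = λ ((x , _) , _) ((x′ , _) , _) → x ≈ x′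
  ; _∙_ = λ ((x , y) , p , q) ((x′ , y′) , p′ , q′) →
      (x ∙ x′ , y′ ∙ y) , cancel p p′ , cancel q′ q
  ; ε = (ε , ε) , identityˡ ε , identityˡ ε
  ; _⁻¹ = λ ((x , y) , p , q) → (y , x) , q , p
  ; isGroup = record
    { isMonoid = record
      { isSemigroup = record
        { isMagma = record
          { isEquivalence = record { refl = refl ; sym = sym ; trans = trans }
          ; ∙-cong = ∙-cong
          }
        ; assoc = λ ((x , _) , _) ((y , _) , _) ((z , _) , _) → assoc x y z
        }
      ; identity = (λ ((x , _) , _) → identityˡ x) , (λ ((x , _) , _) → identityʳ x)
      }
    ; inverse = (λ (_ , _ , q) → q) , (λ (_ , p , _) → p)
    ; ⁻¹-cong = λ {((x , y) , p , q)} {((x′ , y′) , p′ , q′)} e →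
        trans (sym (identityʳ y)) (trans (∙-congˡ (sym p′)) (trans (sym (assoc y x′ y′))
          (trans (∙-congʳ (trans (∙-congˡ (sym e)) q)) (identityˡ y′))))
    }
  }
  where
  open Monoid M
  cancel : ∀ {x y x′ y′} → x ∙ y ≈ ε → x′ ∙ y′ ≈ ε → (x ∙ x′) ∙ (y′ ∙ y) ≈ ε
  cancel {x} {y} {x′} {y′} p p′ = trans (assoc x x′ (y′ ∙ y))
    (trans (∙-congˡ (trans (sym (assoc x′ y′ y)) (trans (∙-congʳ p′) (identityˡ y)))) p)

module Matrices {q : ℕ} (F : FiniteField q) where
  private module F = FiniteField F
  open CommutativeRing F.commutativeRing
    using (+-identityˡ; +-identityʳ; +-comm; +-assoc; *-identityˡ; *-identityʳ; *-assoc; *-comm;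
           zeroˡ; zeroʳ; distribˡ; distribʳ; -‿inverseˡ; -‿inverseʳ; semiring; ring)
  open F using (0#; 1#; _+_; _*_; -_)
  open import Algebra.Properties.Semiring.Sum semiring
    using (sum; sum-cong-≗; sum-replicate-zero; ∑-comm; ∑-distrib-+; *-distribˡ-sum; *-distribʳ-sum)
  open ≡.≡-Reasoning

  Matrix : ℕ → Set
  Matrix n = Fin n → Fin n → F.Carrier

  infix 4 _≐_
  _≐_ : ∀ {n} → Matrix n → Matrix n → Set
  A ≐ B = ∀ i j → A i j ≡ B i j

  infixl 7 _⨯_
  _⨯_ : ∀ {n} → Matrix n → Matrix n → Matrix n
  (A ⨯ B) i j = sum (λ c → A i c * B c j)

  δ : ∀ {n} → Matrix n
  δ i j = if does (i Fin.≟ j) then 1# else 0#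

  δ-refl : ∀ {n} (i : Fin n) → δ i i ≡ 1#
  δ-refl i = ≡.cong (if_then 1# else 0#) (dec-true (i Fin.≟ i) ≡.refl)

  δ-≢ : ∀ {n} {i j : Fin n} → i ≢ j → δ i j ≡ 0#
  δ-≢ {i = i} {j} i≢j = ≡.cong (if_then 1# else 0#) (dec-false (i Fin.≟ j) i≢j)

  sum-zero : ∀ {n} (f : Fin n → F.Carrier) → (∀ c → f c ≡ 0#) → sum f ≡ 0#
  sum-zero {n} f e = ≡.trans (sum-cong-≗ e) (sum-replicate-zero n)

  sum-single : ∀ {n} (a : Fin n) (f : Fin n → F.Carrier) → (∀ c → c ≢ a → f c ≡ 0#) → sum f ≡ f a
  sum-single zero f e =
    ≡.trans (≡.cong (f zero +_) (sum-zero (f ∘ suc) (λ c → e (suc c) λ ()))) (+-identityʳ (f zero))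
  sum-single (suc a) f e = ≡.trans
    (≡.cong₂ _+_ (e zero λ ()) (sum-single a (f ∘ suc) λ c c≢a → e (suc c) (c≢a ∘ Finₚ.suc-injective)))
    (+-identityˡ (f (suc a)))

  ⨯-identityˡ : ∀ {n} (A : Matrix n) → δ ⨯ A ≐ A
  ⨯-identityˡ A i j = begin
    sum (λ c → δ i c * A c j)  ≡⟨ sum-single i _ (λ c c≢i →
                                    ≡.trans (≡.cong (_* A c j) (δ-≢ (c≢i ∘ ≡.sym))) (zeroˡ (A c j))) ⟩
    δ i i * A i j              ≡⟨ ≡.cong (_* A i j) (δ-refl i) ⟩
    1# * A i j                 ≡⟨ *-identityˡ (A i j) ⟩
    A i j                      ∎

  ⨯-identityʳ : ∀ {n} (A : Matrix n) → A ⨯ δ ≐ A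
  ⨯-identityʳ A i j = begin
    sum (λ c → A i c * δ c j)  ≡⟨ sum-single j _ (λ c c≢j →
                                    ≡.trans (≡.cong (A i c *_) (δ-≢ c≢j)) (zeroʳ (A i c))) ⟩
    A i j * δ j j              ≡⟨ ≡.cong (A i j *_) (δ-refl j) ⟩
    A i j * 1#                 ≡⟨ *-identityʳ (A i j) ⟩
    A i j                      ∎

  ⨯-assoc : ∀ {n} (A B C : Matrix n) → (A ⨯ B) ⨯ C ≐ A ⨯ (B ⨯ C)
  ⨯-assoc A B C i j = begin
    sum (λ c → sum (λ d → A i d * B d c) * C c j)
      ≡⟨ sum-cong-≗ (λ c → *-distribʳ-sum (C c j) (λ d → A i d * B d c)) ⟩
    sum (λ c → sum (λ d → A i d * B d c * C c j))
      ≡⟨ ∑-comm (λ c d → A i d * B d c * C c j) ⟩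
    sum (λ d → sum (λ c → A i d * B d c * C c j))
      ≡⟨ sum-cong-≗ (λ d → sum-cong-≗ (λ c → *-assoc (A i d) (B d c) (C c j))) ⟩
    sum (λ d → sum (λ c → A i d * (B d c * C c j)))
      ≡⟨ sum-cong-≗ (λ d → *-distribˡ-sum (A i d) (λ c → B d c * C c j)) ⟨
    sum (λ d → A i d * sum (λ c → B d c * C c j)) ∎

  matrixMonoid : ℕ → Monoid 0ℓ 0ℓ
  matrixMonoid n = record
    { Carrier = Matrix n
    ; _≈_ = _≐_
    ; _∙_ = _⨯_
    ; ε = δ
    ; isMonoid = record
      { isSemigroup = record
        { isMagma = record
          { isEquivalence = record
            { refl = λ _ _ → ≡.refl
            ; sym = λ e i j → ≡.sym (e i j)
            ; trans = λ e f i j → ≡.trans (e i j) (f i j)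
            }
          ; ∙-cong = λ e f i j → sum-cong-≗ (λ c → ≡.cong₂ _*_ (e i c) (f c j))
          }
        ; assoc = ⨯-assoc
        }
      ; identity = ⨯-identityˡ , ⨯-identityʳ
      }
    }

  GL : ℕ → Group 0ℓ 0ℓ
  GL n = unitGroup (matrixMonoid n)

  matrix : ∀ {n} → Group.Carrier (GL n) → Matrix n
  matrix ((A , _) , _) = A

  permutationMatrix : ∀ {n} → Permutation′ n → Group.Carrier (GL n)
  permutationMatrix σ = ((λ i j → δ i (σ ⟨$⟩ʳ j)) , (λ i j → δ i (σ ⟨$⟩ˡ j))) ,
    (λ i j → product (σ ⟨$⟩ʳ_) (σ ⟨$⟩ˡ_) (λ _ → Perm.inverseʳ σ) i j) ,
    (λ i j → product (σ ⟨$⟩ˡ_) (σ ⟨$⟩ʳ_) (λ _ → Perm.inverseˡ σ) i j)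
    where
    product : ∀ {n} (f g : Fin n → Fin n) → (∀ j → f (g j) ≡ j) →
              (λ i j → δ i (f j)) ⨯ (λ i j → δ i (g j)) ≐ δ
    product f g e i j = begin
      sum (λ c → δ i (f c) * δ c (g j))   ≡⟨ ⨯-identityʳ (λ i j → δ i (f j)) i (g j) ⟩
      δ i (f (g j))                       ≡⟨ ≡.cong (δ i) (e j) ⟩
      δ i j                               ∎

  elementary : ∀ {n} → Fin n → Fin n → F.Carrier → Matrix n
  elementary i j t a b = if does (a Fin.≟ i) ∧ does (b Fin.≟ j) then t else δ a b

  elementary-split : ∀ {n} {i j : Fin n} → i ≢ j → ∀ t a b →
                     elementary i j t a b ≡ δ a b + δ a i * (t * δ j b)
  elementary-split {i = i} {j} i≢j t a b with a Fin.≟ i | b Fin.≟ j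
  ... | yes ≡.refl | yes ≡.refl = ≡.sym (begin
    δ a b + 1# * (t * δ b b)  ≡⟨ ≡.cong₂ _+_ (δ-≢ i≢j) (*-identityˡ (t * δ b b)) ⟩
    0# + t * δ b b            ≡⟨ +-identityˡ (t * δ b b) ⟩
    t * δ b b                 ≡⟨ ≡.cong (t *_) (δ-refl b) ⟩
    t * 1#                    ≡⟨ *-identityʳ t ⟩
    t                         ∎)
  ... | yes ≡.refl | no b≢j = ≡.sym (begin
    δ a b + 1# * (t * δ j b)  ≡⟨ ≡.cong (δ a b +_) (*-identityˡ (t * δ j b)) ⟩
    δ a b + t * δ j b         ≡⟨ ≡.cong (λ x → δ a b + t * x) (δ-≢ (b≢j ∘ ≡.sym)) ⟩
    δ a b + t * 0#            ≡⟨ ≡.cong (δ a b +_) (zeroʳ t) ⟩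
    δ a b + 0#                ≡⟨ +-identityʳ (δ a b) ⟩
    δ a b                     ∎)
  ... | no _ | _ = ≡.sym (≡.trans (≡.cong (δ a b +_) (zeroˡ (t * δ j b))) (+-identityʳ (δ a b)))

  elementary-+ : ∀ {n} {i j : Fin n} → i ≢ j → ∀ s t → s + t ≡ 0# →
                 elementary i j s ⨯ elementary i j t ≐ δ
  elementary-+ {i = i} {j} i≢j s t s+t a b = begin
    sum (λ c → E s a c * E t c b)
      ≡⟨ sum-cong-≗ (λ c → ≡.trans (≡.cong (_* E t c b) (elementary-split i≢j s a c))
           (distribʳ (E t c b) (δ a c) (δ a i * (s * δ j c)))) ⟩
    sum (λ c → δ a c * E t c b + δ a i * (s * δ j c) * E t c b)
      ≡⟨ ∑-distrib-+ (λ c → δ a c * E t c b) (λ c → δ a i * (s * δ j c) * E t c b) ⟩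
    sum (λ c → δ a c * E t c b) + sum (λ c → δ a i * (s * δ j c) * E t c b)
      ≡⟨ ≡.cong₂ _+_ (⨯-identityˡ (E t) a b) (sum-cong-≗ (λ c → reassoc (δ a i) s (δ j c) (E t c b))) ⟩
    E t a b + sum (λ c → (δ a i * s) * (δ j c * E t c b))
      ≡⟨ ≡.cong (E t a b +_) (*-distribˡ-sum (δ a i * s) (λ c → δ j c * E t c b)) ⟨
    E t a b + (δ a i * s) * sum (λ c → δ j c * E t c b)
      ≡⟨ ≡.cong (λ x → E t a b + (δ a i * s) * x) (⨯-identityˡ (E t) j b) ⟩
    E t a b + (δ a i * s) * E t j b
      ≡⟨ ≡.cong₂ (λ x y → x + (δ a i * s) * y) (elementary-split i≢j t a b) row-j ⟩
    (δ a b + δ a i * (t * δ j b)) + (δ a i * s) * δ j b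
      ≡⟨ +-assoc (δ a b) _ _ ⟩
    δ a b + (δ a i * (t * δ j b) + (δ a i * s) * δ j b)
      ≡⟨ ≡.cong (λ x → δ a b + (x + (δ a i * s) * δ j b)) (*-assoc (δ a i) t (δ j b)) ⟨
    δ a b + ((δ a i * t) * δ j b + (δ a i * s) * δ j b)
      ≡⟨ ≡.cong (δ a b +_) (distribʳ (δ j b) (δ a i * t) (δ a i * s)) ⟨
    δ a b + (δ a i * t + δ a i * s) * δ j b
      ≡⟨ ≡.cong (λ x → δ a b + x * δ j b) (distribˡ (δ a i) t s) ⟨
    δ a b + (δ a i * (t + s)) * δ j b
      ≡⟨ ≡.cong (λ x → δ a b + (δ a i * x) * δ j b) (≡.trans (+-comm t s) s+t) ⟩
    δ a b + (δ a i * 0#) * δ j b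
      ≡⟨ ≡.cong (δ a b +_) (≡.trans (≡.cong (_* δ j b) (zeroʳ (δ a i))) (zeroˡ (δ j b))) ⟩
    δ a b + 0#
      ≡⟨ +-identityʳ (δ a b) ⟩
    δ a b ∎
    where
    E = elementary i j
    reassoc : ∀ w x y z → w * (x * y) * z ≡ (w * x) * (y * z)
    reassoc w x y z = ≡.trans (≡.cong (_* z) (≡.sym (*-assoc w x y))) (*-assoc (w * x) y z)
    row-j : E t j b ≡ δ j b
    row-j = begin
      E t j b                        ≡⟨ elementary-split i≢j t j b ⟩
      δ j b + δ j i * (t * δ j b)    ≡⟨ ≡.cong (λ x → δ j b + x * (t * δ j b)) (δ-≢ (i≢j ∘ ≡.sym)) ⟩
      δ j b + 0# * (t * δ j b)       ≡⟨ ≡.cong (δ j b +_) (zeroˡ (t * δ j b)) ⟩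
      δ j b + 0#                     ≡⟨ +-identityʳ (δ j b) ⟩
      δ j b                          ∎

  x : ∀ {n} (i j : Fin n) → i Fin.< j → F.Carrier → Group.Carrier (GL n)
  x i j i<j t = (elementary i j t , elementary i j (- t)) ,
    elementary-+ (Finₚ.<⇒≢ i<j) t (- t) (-‿inverseʳ t) ,
    elementary-+ (Finₚ.<⇒≢ i<j) (- t) t (-‿inverseˡ t)

  -- s i is the transposition matrix written s_{i+1} in 1-based indexing.
  s : ∀ {m} → Fin m → Group.Carrier (GL (suc m))
  s i = permutationMatrix (transpose (inject₁ i) (suc i))

  s⟨_⟩ : ∀ {m} → Fin m → F.Carrier → Group.Carrier (GL (suc m))
  s⟨_⟩ {m} i t = Group._∙_ (GL (suc m)) (x (inject₁ i) (suc i) (ℕₚ.≤-reflexive (≡.cong suc (Finₚ.toℕ-inject₁ i))) t) (s i)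

  module _ (m : ℕ) where
    private
      n = suc m
      module G = Group (GL n)

    IsBlockDiagonal : Matrix n → Set
    IsBlockDiagonal A = (∀ j → A zero (suc j) ≡ 0#) × (∀ i → A (suc i) zero ≡ 0#)

    IsTopRowUnipotent : Matrix n → Set
    IsTopRowUnipotent A = (∀ i → A i i ≡ 1#) × (∀ i j → i ≢ zero → i ≢ j → A i j ≡ 0#)

    corner : ∀ (A B : Matrix n) → (∀ c → A zero (suc c) * B (suc c) zero ≡ 0#) →
             (A ⨯ B) zero zero ≡ A zero zero * B zero zero
    corner A B e = ≡.trans (≡.cong (A zero zero * B zero zero +_) (sum-zero (λ c → A zero (suc c) * B (suc c) zero) e))
      (+-identityʳ (A zero zero * B zero zero))

    lower-row : ∀ {A} → IsTopRowUnipotent A → ∀ i j → A (suc i) j ≡ δ (suc i) j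
    lower-row {A} (d , o) i j with suc i Fin.≟ j
    ... | yes ≡.refl = d (suc i)
    ... | no i≢j = o (suc i) j (λ ()) i≢j

    mkUnipotent : ∀ A → A zero zero ≡ 1# → (∀ i j → A (suc i) j ≡ δ (suc i) j) → IsTopRowUnipotent A
    mkUnipotent A e f =
      (λ { zero → e ; (suc i) → ≡.trans (f i (suc i)) (δ-refl (suc i)) }) ,
      (λ { zero j i≢0 _ → contradiction ≡.refl i≢0 ; (suc i) j _ i≢j → ≡.trans (f i j) (δ-≢ i≢j) })

    δ-row-⨯ : ∀ (A B : Matrix n) i → (∀ c → A (suc i) c ≡ δ (suc i) c) → ∀ j → (A ⨯ B) (suc i) j ≡ B (suc i) j
    δ-row-⨯ A B i e j = ≡.trans (sum-cong-≗ (λ c → ≡.cong (_* B c j) (e c))) (⨯-identityˡ B (suc i) j)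

    zero-col : ∀ {A} → IsTopRowUnipotent A → ∀ c → A (suc c) zero ≡ 0#
    zero-col u c = lower-row u c zero

    *-zeroʳ : ∀ x {y} → y ≡ 0# → x * y ≡ 0#
    *-zeroʳ x e = ≡.trans (≡.cong (x *_) e) (zeroʳ x)

    *-zeroˡ : ∀ {x} y → x ≡ 0# → x * y ≡ 0#
    *-zeroˡ y e = ≡.trans (≡.cong (_* y) e) (zeroˡ y)

    block-inverse : ∀ A B → A ⨯ B ≐ δ → B ⨯ A ≐ δ → IsBlockDiagonal A → IsBlockDiagonal B
    block-inverse A B AB BA (r , c) = row , col
      where
      a b : F.Carrier
      a = A zero zero
      b = B zero zero
      ba : b * a ≡ 1#
      ba = ≡.trans (≡.sym (corner B A (λ i → *-zeroʳ (B zero (suc i)) (c i)))) (BA zero zero)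
      ab : a * b ≡ 1#
      ab = ≡.trans (*-comm a b) ba
      row : ∀ j → B zero (suc j) ≡ 0#
      row j = begin
        B zero (suc j)              ≡⟨ *-identityˡ _ ⟨
        1# * B zero (suc j)         ≡⟨ ≡.cong (_* B zero (suc j)) ba ⟨
        (b * a) * B zero (suc j)    ≡⟨ *-assoc b a (B zero (suc j)) ⟩
        b * (a * B zero (suc j))    ≡⟨ *-zeroʳ b (≡.trans (≡.sym (sum-single zero (λ d → A zero d * B d (suc j))
                                        (λ { zero ne → contradiction ≡.refl ne
                                           ; (suc d) _ → *-zeroˡ (B (suc d) (suc j)) (r d) })))
                                        (AB zero (suc j))) ⟩
        0# ∎
      col : ∀ i → B (suc i) zero ≡ 0#
      col i = begin
        B (suc i) zero              ≡⟨ *-identityʳ _ ⟨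
        B (suc i) zero * 1#         ≡⟨ ≡.cong (B (suc i) zero *_) ab ⟨
        B (suc i) zero * (a * b)    ≡⟨ *-assoc (B (suc i) zero) a b ⟨
        (B (suc i) zero * a) * b    ≡⟨ *-zeroˡ b (≡.trans (≡.sym (sum-single zero (λ d → B (suc i) d * A d zero)
                                        (λ { zero ne → contradiction ≡.refl ne
                                           ; (suc d) _ → *-zeroʳ (B (suc i) (suc d)) (c d) })))
                                        (BA (suc i) zero)) ⟩
        0# ∎

    L : Subgroup (GL n)
    L = record
      { Member = λ g → IsBlockDiagonal (matrix g)
      ; resp = λ e (r , c) → (λ j → ≡.trans (≡.sym (e zero (suc j))) (r j)) ,
                             (λ i → ≡.trans (≡.sym (e (suc i) zero)) (c i))
      ; ∙-closed = λ {g} {h} (r , c) (r′ , c′) →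
          (λ j → sum-zero (λ d → matrix g zero d * matrix h d (suc j)) (λ { zero → *-zeroʳ (matrix g zero zero) (r′ j)
                               ; (suc d) → *-zeroˡ (matrix h (suc d) (suc j)) (r d) })) ,
          (λ i → sum-zero (λ d → matrix g (suc i) d * matrix h d zero) (λ { zero → *-zeroˡ (matrix h zero zero) (c i)
                               ; (suc d) → *-zeroʳ (matrix g (suc i) (suc d)) (c′ d) }))
      ; ε-closed = (λ _ → ≡.refl) , (λ _ → ≡.refl)
      ; ⁻¹-closed = λ {((A , B) , AB , BA)} bd → block-inverse A B AB BA bd
      }

    U : Subgroup (GL n)
    U = record
      { Member = λ g → IsTopRowUnipotent (matrix g)
      ; resp = λ e (d , o) → (λ i → ≡.trans (≡.sym (e i i)) (d i)) ,
                             (λ i j p ne → ≡.trans (≡.sym (e i j)) (o i j p ne))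
      ; ∙-closed = λ {g} {h} u v → mkUnipotent (matrix g ⨯ matrix h)
          (≡.trans (corner (matrix g) (matrix h) (λ c → *-zeroʳ (matrix g zero (suc c)) (zero-col v c)))
            (≡.trans (≡.cong₂ _*_ (proj₁ u zero) (proj₁ v zero)) (*-identityˡ 1#)))
          (λ i j → ≡.trans (δ-row-⨯ (matrix g) (matrix h) i (lower-row u i) j) (lower-row v i j))
      ; ε-closed = mkUnipotent δ (δ-refl {n} zero) (λ _ _ → ≡.refl)
      ; ⁻¹-closed = λ {((A , B) , AB , BA)} u → unipotent-inverse A B AB u
      }
      where
      unipotent-inverse : ∀ A B → A ⨯ B ≐ δ → IsTopRowUnipotent A → IsTopRowUnipotent B
      unipotent-inverse A B AB u = mkUnipotent B b rows
        where
        rows : ∀ i j → B (suc i) j ≡ δ (suc i) j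
        rows i j = ≡.trans (≡.sym (δ-row-⨯ A B i (lower-row u i) j)) (AB (suc i) j)
        b : B zero zero ≡ 1#
        b = begin
          B zero zero                  ≡⟨ *-identityˡ (B zero zero) ⟨
          1# * B zero zero             ≡⟨ ≡.cong (_* B zero zero) (proj₁ u zero) ⟨
          A zero zero * B zero zero    ≡⟨ corner A B (λ c → *-zeroʳ (A zero (suc c)) (rows c zero)) ⟨
          (A ⨯ B) zero zero            ≡⟨ AB zero zero ⟩
          1# ∎

    unipotent : Vec F.Carrier m → Matrix n
    unipotent a zero zero = 1#
    unipotent a zero (suc j) = lookup a j
    unipotent a (suc i) j = δ (suc i) j

    unipotent-+ : ∀ a b → (∀ j → lookup a j + lookup b j ≡ 0#) → unipotent a ⨯ unipotent b ≐ δ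
    unipotent-+ a b e (suc i) j = δ-row-⨯ (unipotent a) (unipotent b) i (λ _ → ≡.refl) j
    unipotent-+ a b e zero zero =
      ≡.trans (corner (unipotent a) (unipotent b) (λ c → zeroʳ (lookup a c))) (*-identityˡ 1#)
    unipotent-+ a b e zero (suc j) = begin
      1# * lookup b j + sum (λ c → lookup a c * δ c j)
        ≡⟨ ≡.cong₂ _+_ (*-identityˡ (lookup b j)) (⨯-identityʳ (λ _ → lookup a) j j) ⟩
      lookup b j + lookup a j
        ≡⟨ ≡.trans (+-comm (lookup b j) (lookup a j)) (e j) ⟩
      0# ∎

    unipotentElement : Vec F.Carrier m → Group.Carrier (Subgroup.group U)
    unipotentElement a =
      ((unipotent a , unipotent (Vec.map -_ a)) ,
        unipotent-+ a (Vec.map -_ a) (λ j →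
          ≡.trans (≡.cong (lookup a j +_) (Vecₚ.lookup-map j -_ a)) (-‿inverseʳ (lookup a j))) ,
        unipotent-+ (Vec.map -_ a) a (λ j →
          ≡.trans (≡.cong (_+ lookup a j) (Vecₚ.lookup-map j -_ a)) (-‿inverseˡ (lookup a j)))) ,
      mkUnipotent (unipotent a) ≡.refl (λ _ _ → ≡.refl)

    unipotent-row : ∀ {A} → IsTopRowUnipotent A → unipotent (tabulate (λ j → A zero (suc j))) ≐ A
    unipotent-row u zero zero = ≡.sym (proj₁ u zero)
    unipotent-row {A} u zero (suc j) = Vecₚ.lookup∘tabulate (λ j → A zero (suc j)) j
    unipotent-row u (suc i) j = ≡.sym (lower-row u i j)

    enumerateU : Inverse (≡.setoid (Fin (q ^ m))) (Group.setoid (Subgroup.group U))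
    enumerateU = record
      { to = λ i → unipotentElement (to i)
      ; from = λ (g , _) → from (topRow (matrix g))
      ; to-cong = λ { ≡.refl _ _ → ≡.refl }
      ; from-cong = λ e → ≡.cong from (Vecₚ.tabulate-cong (λ j → e zero (suc j)))
      ; inverse = (λ {(g , u)} {i} e a b → ≡.trans
                     (≡.cong (λ v → unipotent v a b)
                       (≡.trans (≡.cong to e) (strictlyInverseˡ (topRow (matrix g)))))
                     (unipotent-row u a b))
                , (λ {i} {(g , u)} e → ≡.trans
                     (≡.cong from (≡.trans (Vecₚ.tabulate-cong (λ j → e zero (suc j)))
                                           (Vecₚ.tabulate∘lookup (to i))))
                     (strictlyInverseʳ i))
      }
      where
      open Inverse (F.enumerateVec m)
      topRow : Matrix n → Vec F.Carrier m
      topRow A = tabulate (λ j → A zero (suc j))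

    normalises : ∀ {l u : G.Carrier} → IsBlockDiagonal (matrix l) → IsTopRowUnipotent (matrix u) →
                 IsTopRowUnipotent (matrix (l G.∙ u G.∙ l G.⁻¹))
    normalises {l@((A , B) , AB , BA)} {u} bd@(r , c) un =
      mkUnipotent ((A ⨯ matrix u) ⨯ B) top rows
      where
      V = matrix u
      Au-row : ∀ i j → (A ⨯ V) (suc i) j ≡ A (suc i) j
      Au-row i j = ≡.trans
        (sum-cong-≗ {x = λ d → A (suc i) d * V d j} {y = λ d → A (suc i) d * δ d j}
          (λ { zero → ≡.trans (*-zeroˡ (V zero j) (c i)) (≡.sym (*-zeroˡ (δ zero j) (c i)))
                       ; (suc d) → ≡.cong (A (suc i) (suc d) *_) (lower-row un d j) }))
        (⨯-identityʳ A (suc i) j)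
      rows : ∀ i j → ((A ⨯ V) ⨯ B) (suc i) j ≡ δ (suc i) j
      rows i j = ≡.trans (sum-cong-≗ (λ d → ≡.cong (_* B d j) (Au-row i d))) (AB (suc i) j)
      Bcol : ∀ d → B (suc d) zero ≡ 0#
      Bcol = proj₂ (block-inverse A B AB BA bd)
      top : ((A ⨯ V) ⨯ B) zero zero ≡ 1#
      top = begin
        ((A ⨯ V) ⨯ B) zero zero           ≡⟨ corner (A ⨯ V) B (λ d → *-zeroʳ ((A ⨯ V) zero (suc d)) (Bcol d)) ⟩
        (A ⨯ V) zero zero * B zero zero   ≡⟨ ≡.cong (_* B zero zero) (corner A V (λ d → *-zeroʳ (A zero (suc d)) (zero-col un d))) ⟩
        (A zero zero * V zero zero) * B zero zero
          ≡⟨ ≡.cong (_* B zero zero) (≡.trans (≡.cong (A zero zero *_) (proj₁ un zero)) (*-identityʳ (A zero zero))) ⟩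
        A zero zero * B zero zero         ≡⟨ corner A B (λ d → *-zeroʳ (A zero (suc d)) (Bcol d)) ⟨
        (A ⨯ B) zero zero                 ≡⟨ AB zero zero ⟩
        1# ∎

    levi : LeviPair (GL n)
    levi = record
      { L = L
      ; U = U
      ; normalises = λ {l} {u} → normalises {l} {u}
      ; disjoint = λ { (r , c) u zero zero → proj₁ u zero
                     ; (r , c) u zero (suc j) → r j
                     ; (r , c) u (suc i) j → lower-row u i j }
      ; ∣U∣ = q ^ m
      ; enumerateU = enumerateU
      }

-- starHeights 0 k is the ∗-height k* of k: the first argument is the maximum of
-- k_i* + 1 over the earlier entries, and the initial value 0 gives k_1* = 0.
starHeights : ∀ {n r} → ℕ → Vec (Fin n) r → Vec ℕ r
starHeights h [] = []
starHeights h (k ∷ ks) = (toℕ k ⊓ h) ∷ starHeights (h ⊔ suc (toℕ k ⊓ h)) ks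

module Counting (q : ℕ) .{{_ : NonZero (q ∸ 1)}} where
  [_] : ℕ → ℕ
  [ i ] = (q ^ i ∸ 1) / (q ∸ 1)

  Stirling₂ : ℕ → ℕ → ℕ
  Stirling₂ zero    zero    = 1
  Stirling₂ zero    (suc ℓ) = 0
  Stirling₂ (suc r) zero    = 0
  Stirling₂ (suc r) (suc ℓ) = suc ℓ ℕ.* Stirling₂ r (suc ℓ) ℕ.+ Stirling₂ r ℓ

  d : ℕ → ℕ → ℕ
  d n zero    = 1
  d n (suc r) = ℕ-List.sum (applyUpTo (λ i → term (suc i)) n)
    where
    term : ℕ → ℕ
    term ℓ = Stirling₂ (suc r) ℓ ℕ.* ℕ-List.product (applyUpTo (λ i → [ n ∸ i ]) ℓ)

-- G = GL_n(F) for n = m + 1, with modules over k. An index i : Fin m or Fin n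
-- stands for the 1-based index toℕ i + 1, but an entry k of 𝒫 for toℕ k itself.
module IteratedIR (k : CommutativeRing 0ℓ 0ℓ)
  (recip : (j : ℕ) .{{_ : NonZero j}} → CommutativeRing.Carrier k)
  {q : ℕ} (F : FiniteField q) (m : ℕ) where

  private
    module F = FiniteField F
    n = suc m
  open Matrices F using (GL; levi; s⟨_⟩)
  open HarishChandra k recip (GL n) (levi m) public
  open kG using (FormalSum; gen; _⊛_; _·_)
  open import Algebra.Properties.CommutativeMonoid.Sum (Ring.+-commutativeMonoid kG.groupAlgebra)
    using (sum)

  Parameters : ∀ {r} → ℕ → Vec (Fin n) r → Set
  Parameters h k = All (λ (kⱼ , kⱼ*) → Vec F.Carrier (toℕ kⱼ ∸ kⱼ*)) (zip k (starHeights h k))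

  𝒫 : ℕ → Set
  𝒫 r = Σ (Vec (Fin n) r) (Parameters 0)

  -- s_{l+c}(a_c) ⋯ s_{l+1}(a_1) for a = (a_1 , … , a_c).
  descending : ∀ l {c} → Vec F.Carrier c → l ℕ.+ c ≤ m → FormalSum
  descending l [] _ = gen (Group.ε (GL n))
  descending l {suc c} (a ∷ as) l+c≤m =
    descending (suc l) as 1+l+c≤m ⊛ gen (s⟨ fromℕ< (ℕₚ.m+n≤o⇒m≤o (suc l) 1+l+c≤m) ⟩ a)
    where
    1+l+c≤m : suc l ℕ.+ c ≤ m
    1+l+c≤m = ≡.subst (_≤ m) (ℕₚ.+-suc l c) l+c≤m

  w : (k : Fin n) (k* : ℕ) → k* ≤ toℕ k → Vec F.Carrier (toℕ k ∸ k*) → FormalSum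
  w k k* k*≤k a =
    descending k* a (≡.subst (_≤ m) (≡.sym (ℕₚ.m+[n∸m]≡n k*≤k)) k≤m)
    ⊛ (recip (q ^ k*) {{ℕₚ.m^n≢0 q k*}}
       · sum (λ i → descending 0 (Inverse.to (F.enumerateVec k*) i) (ℕₚ.≤-trans k*≤k k≤m)))
    where
    k≤m : toℕ k ≤ m
    k≤m = Finₚ.toℕ≤pred[n] k

  vFrom : ∀ h {r} (k : Vec (Fin n) r) → Parameters h k → LeftModule.Carrierᴹ (IR r)
  vFrom h [] [] = CommutativeRing.1# k
  vFrom h {suc r} (k ∷ ks) (a ∷ as) =
    w k (toℕ k ⊓ h) (ℕₚ.m⊓n≤m (toℕ k) h) a ⊗[ IR r ] vFrom (h ⊔ suc (toℕ k ⊓ h)) ks as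

  v : ∀ {r} → 𝒫 r → LeftModule.Carrierᴹ (IR r)
  v (k , a) = vFrom 0 k a

  𝒫₀ : ℕ → Set
  𝒫₀ r = Σ (𝒫 (suc r)) λ (k , _) → toℕ (Vec.head k) ≡ 0

-- IR r is a permutation module. A coset of P in G is a line in V, spanned by a unique
-- column (c_1 , … , c_k , 1 , 0 , … , 0), and W(k , c) = s_k(c_k) ⋯ s_1(c_1) has this first
-- column, so every g is W(k , c) p with p ∈ P. Let U_h be the group of unitriangular
-- matrices trivial outside the first h rows (U_0 = 1, U_1 = U). Under U_h only the entries
-- c_i with i > k* = min(k , h) of a line matter, and the stabiliser of the line becomes,
-- modulo U, the group U_{h′} with h′ = max(h , k* + 1) acting on the remaining tensor
-- factors; h is thus the running maximum in the definition of the ∗-height. Recursively,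
-- ∗-heights started at h index the U_h-orbits of pure tensors. Hence functions of the index
-- give U_h-invariant functionals on IR r dual to the v_K (independence), and a U_h-invariant
-- linear map is determined by its values on the v_K (spanning): apply this to the identity
-- for h = 0, and to v ↦ e_U v for h = 1. Splitting off the first entry, the number N(h , r)
-- of indices satisfies N(h , r + 1) = h N(h , r) + [n - h] N(h + 1 , r), which telescopes
-- to the Stirling sum.

module Submission where

open import Defs
open import Level using (0ℓ)
open import Algebra.Bundles using (CommutativeMonoid; CommutativeRing; Group; Ring)
open import Algebra.Module.Bundles using (LeftModule)
import Algebra.Module.Construct.TensorUnit as TensorUnit
open import Algebra.Morphism.Bundles using (RingHomomorphism)
import Algebra.Properties.CommutativeMonoid.Sum as CommutativeMonoidSum
open import Data.Bool using (if_then_else_)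
open import Data.Fin as Fin using (Fin; zero; suc; toℕ; inject₁; fromℕ<; punchIn; punchOut)
open import Data.Fin.Permutation using (Permutation′; permutation; _⟨$⟩ʳ_; _⟨$⟩ˡ_; transpose)
import Data.Fin.Permutation as Perm
import Data.Fin.Properties as Finₚ
import Data.Integer as ℤ
import Data.Integer.Properties as ℤₚ
open import Data.List as List using (List; []; _∷_; applyUpTo)
open import Data.List.Membership.Propositional using (_∈_)
open import Data.List.Relation.Unary.All as Allᴸ using ()
open import Data.List.Relation.Unary.AllPairs using ([]; _∷_)
open import Data.List.Relation.Unary.Any using (here; there)
open import Data.List.Relation.Unary.Unique.Propositional using (Unique)
open import Data.Nat as ℕ using (ℕ; zero; suc; NonZero; _∸_; _⊓_; _⊔_; _^_; _≤_; _<_; z≤n; s≤s; z<s; s<s; s≤s⁻¹)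
open import Data.Nat.Divisibility using (_∣_; divides; quotient)
open import Data.Nat.DivMod using (m*n/n≡m)
import Data.Nat.ListAction as ℕ-List
import Data.Nat.Properties as ℕₚ
open import Data.Product using (Σ; ∃; _×_; _,_; proj₁; proj₂)
open import Data.Product.Function.Dependent.Propositional using (Σ-↔)
open import Data.Product.Function.NonDependent.Propositional using (_×-↔_)
open import Data.Rational as ℚ using (ℚ; 0ℚ; 1ℚ)
import Data.Rational.Properties as ℚₚ
import Data.Rational.Unnormalised as ℚᵘ
import Data.Rational.Unnormalised.Properties as ℚᵘₚ
open import Data.Sum using (_⊎_; inj₁; inj₂; [_,_]′)
open import Data.Sum.Function.Propositional using (_⊎-↔_)
open import Data.Unit using (⊤; tt)
open import Data.Vec as Vec using (Vec; []; _∷_; lookup; tabulate; zip; replicate; head)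
import Data.Vec.Properties as Vecₚ
open import Data.Vec.Relation.Unary.All using (All; []; _∷_)
open import Function.Base using (_∘_; id)
open import Function.Bundles using (Inverse; _↔_; mk↔ₛ′)
open import Function.Definitions using (Injective)
open import Function.Properties.Inverse using (↔-trans; ↔-refl)
open import Relation.Binary.Definitions using (DecidableEquality; tri<; tri≈; tri>)
open import Relation.Binary.PropositionalEquality as ≡ using (_≡_; _≢_)
open import Relation.Nullary using (Dec; yes; no; does; contradiction)
open import Relation.Nullary.Decidable using (map′; dec-true; dec-false)

open import Algebra.Properties.Semiring.Sum ℕₚ.+-*-semiring as ℕΣ
  using () renaming (sum to ℕ-sum)

-- The modules are term types modulo relations, so neither a dimension count nor a known basis is at
-- hand; everything goes through k-linear maps out of IR r into an arbitrary module N, built and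
-- compared by recursion on r. That the stabiliser of a line is U_{h′} modulo U enters as two
-- one-sided facts with different jobs. That u in U_h acts on the later factors through U_{h′} makes
-- the coordinate functionals invariant. That every element of U_{h′} arises in this way, up to a
-- factor in U that e_U absorbs, makes the restriction of an invariant map to one line invariant at
-- height h′, which is the recursion behind uniqueness. The means with 1/|U| and 1/q^{k*} are never
-- multiplied out: an invariant map is constant on the summands, so it takes the same value at the
-- mean and at any single term. Invariance of the coordinates serves spanning as well, since the
-- expansion in the v_K is then itself an invariant map and can be compared with the given one on
-- the v_K.

Fin-sum↔Σ : ∀ {n} (f : Fin n → ℕ) → Fin (ℕ-sum f) ↔ Σ (Fin n) (Fin ∘ f)
Fin-sum↔Σ {zero} f = mk↔ₛ′ (λ ()) (λ ()) (λ ()) (λ ())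
Fin-sum↔Σ {suc n} f = ↔-trans Finₚ.+↔⊎ (↔-trans (↔-refl ⊎-↔ Fin-sum↔Σ (f ∘ suc))
  (mk↔ₛ′ [ (λ i → zero , i) , (λ (k , i) → suc k , i) ]′
         (λ { (zero , i) → inj₁ i ; (suc k , i) → inj₂ (k , i) })
         (λ { (zero , i) → ≡.refl ; (suc k , i) → ≡.refl })
         (λ { (inj₁ i) → ≡.refl ; (inj₂ (k , i)) → ≡.refl })))

sum-applyUpTo : ∀ (f : ℕ → ℕ) n → ℕ-List.sum (applyUpTo f n) ≡ ℕ-sum {n} (f ∘ toℕ)
sum-applyUpTo f zero = ≡.refl
sum-applyUpTo f (suc n) = ≡.cong (f 0 ℕ.+_) (sum-applyUpTo (f ∘ suc) n)

sum-last : ∀ (f : ℕ → ℕ) n → ℕ-sum {suc n} (f ∘ toℕ) ≡ ℕ-sum {n} (f ∘ toℕ) ℕ.+ f n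
sum-last f zero = ℕₚ.+-identityʳ (f 0)
sum-last f (suc n) = ≡.trans (≡.cong (f 0 ℕ.+_) (sum-last (f ∘ suc) n))
  (≡.sym (ℕₚ.+-assoc (f 0) _ _))

product-∷ʳ : ∀ (f : ℕ → ℕ) l →
  ℕ-List.product (applyUpTo f (suc l)) ≡ ℕ-List.product (applyUpTo f l) ℕ.* f l
product-∷ʳ f zero = ℕₚ.*-comm (f 0) 1
product-∷ʳ f (suc l) = ≡.trans (≡.cong (f 0 ℕ.*_) (product-∷ʳ (f ∘ suc) l))
  (≡.sym (ℕₚ.*-assoc (f 0) _ (f (suc l))))

-- Counting the indices: from the recurrence in h and r to the Stirling sum.

module IndexCount (q : ℕ) .{{_ : NonZero q}} .{{_ : NonZero (q ∸ 1)}} (n : ℕ) where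
  open Counting q
  open ≡.≡-Reasoning
  open import Algebra.Properties.CommutativeSemigroup ℕₚ.*-commutativeSemigroup
    using (x∙yz≈y∙xz)

  private
    -- The 1 stays on the left because the induction multiplies the whole identity by q, which a
    -- truncated subtraction on the right would obstruct.
    geometric : ∀ n → ℕ-sum {n} (λ k → q ^ toℕ k) ℕ.* (q ∸ 1) ℕ.+ 1 ≡ q ^ n
    geometric zero = ≡.refl
    geometric (suc n) = begin
      (1 ℕ.+ ℕ-sum {n} (λ k → q ℕ.* q ^ toℕ k)) ℕ.* (q ∸ 1) ℕ.+ 1
        ≡⟨ ≡.cong (λ s → (1 ℕ.+ s) ℕ.* (q ∸ 1) ℕ.+ 1) (ℕΣ.*-distribˡ-sum q (λ k → q ^ toℕ {n} k)) ⟨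
      (1 ℕ.+ q ℕ.* s) ℕ.* (q ∸ 1) ℕ.+ 1
        ≡⟨ ≡.cong (ℕ._+ 1) (ℕₚ.*-distribʳ-+ (q ∸ 1) 1 (q ℕ.* s)) ⟩
      (1 ℕ.* (q ∸ 1) ℕ.+ q ℕ.* s ℕ.* (q ∸ 1)) ℕ.+ 1
        ≡⟨ ≡.cong (ℕ._+ 1) (≡.cong₂ ℕ._+_ (ℕₚ.*-identityˡ (q ∸ 1)) (ℕₚ.*-assoc q s (q ∸ 1))) ⟩
      ((q ∸ 1) ℕ.+ q ℕ.* (s ℕ.* (q ∸ 1))) ℕ.+ 1
        ≡⟨ ≡.cong (ℕ._+ 1) (ℕₚ.+-comm (q ∸ 1) _) ⟩
      (q ℕ.* (s ℕ.* (q ∸ 1)) ℕ.+ (q ∸ 1)) ℕ.+ 1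
        ≡⟨ ℕₚ.+-assoc _ (q ∸ 1) 1 ⟩
      q ℕ.* (s ℕ.* (q ∸ 1)) ℕ.+ ((q ∸ 1) ℕ.+ 1)
        ≡⟨ ≡.cong (q ℕ.* (s ℕ.* (q ∸ 1)) ℕ.+_) (≡.trans (ℕₚ.m∸n+n≡m (ℕ.>-nonZero⁻¹ q)) (≡.sym (ℕₚ.*-identityʳ q))) ⟩
      q ℕ.* (s ℕ.* (q ∸ 1)) ℕ.+ q ℕ.* 1
        ≡⟨ ℕₚ.*-distribˡ-+ q (s ℕ.* (q ∸ 1)) 1 ⟨
      q ℕ.* (s ℕ.* (q ∸ 1) ℕ.+ 1)
        ≡⟨ ≡.cong (q ℕ.*_) (geometric n) ⟩
      q ℕ.* q ^ n ∎
      where s = ℕ-sum {n} (λ k → q ^ toℕ k)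

  sum-powers : ∀ n → ℕ-sum {n} (λ k → q ^ toℕ k) ≡ [ n ]
  sum-powers n = begin
    s                                ≡⟨ m*n/n≡m s (q ∸ 1) ⟨
    (s ℕ.* (q ∸ 1)) ℕ./ (q ∸ 1)      ≡⟨ ≡.cong (ℕ._/ (q ∸ 1)) (ℕₚ.m+n∸n≡m (s ℕ.* (q ∸ 1)) 1) ⟨
    (s ℕ.* (q ∸ 1) ℕ.+ 1 ∸ 1) ℕ./ (q ∸ 1) ≡⟨ ≡.cong (λ t → (t ∸ 1) ℕ./ (q ∸ 1)) (geometric n) ⟩
    [ n ] ∎
    where s = ℕ-sum {n} (λ k → q ^ toℕ k)

  indexCount : ℕ → ℕ → ℕ
  indexCount h zero = 1
  indexCount h (suc r) = ℕ-sum {n} λ k →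
    q ^ (toℕ k ∸ toℕ k ⊓ h) ℕ.* indexCount (h ⊔ suc (toℕ k ⊓ h)) r

  private
    -- Induction on `h` shifts `f` by one, so the exponents `k ∸ h` start again at 0 once the
    -- constant block is used up, and what is left is a geometric sum.
    split-sum : ∀ {h n} (f : ℕ → ℕ) a b → h ≤ n → (∀ k → k < h → f k ≡ a) →
      (∀ k → h ≤ k → f k ≡ q ^ (k ∸ h) ℕ.* b) → ℕ-sum {n} (f ∘ toℕ) ≡ h ℕ.* a ℕ.+ [ n ∸ h ] ℕ.* b
    split-sum {zero} {n} f a b _ _ e = begin
      ℕ-sum {n} (f ∘ toℕ)                    ≡⟨ ℕΣ.sum-cong-≗ {n} (λ k → e (toℕ k) z≤n) ⟩
      ℕ-sum {n} (λ k → q ^ toℕ k ℕ.* b)      ≡⟨ ℕΣ.*-distribʳ-sum b (λ k → q ^ toℕ {n} k) ⟨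
      ℕ-sum {n} (λ k → q ^ toℕ k) ℕ.* b      ≡⟨ ≡.cong (ℕ._* b) (sum-powers n) ⟩
      [ n ] ℕ.* b ∎
    split-sum {suc h} {suc n} f a b h≤n e e′ = ≡.trans
      (≡.cong₂ ℕ._+_ (e 0 z<s) (split-sum (f ∘ suc) a b (s≤s⁻¹ h≤n)
        (λ k p → e (suc k) (s<s p)) (λ k p → e′ (suc k) (s≤s p))))
      (≡.sym (ℕₚ.+-assoc a _ _))

  -- An entry k < h has k* = k, hence no free parameter, and leaves the running maximum at h. An
  -- entry k ≥ h has k* = h, hence k - h free parameters, and raises the maximum to h + 1.
  indexCount-step : ∀ h r → h ≤ n →
    indexCount h (suc r) ≡ h ℕ.* indexCount h r ℕ.+ [ n ∸ h ] ℕ.* indexCount (suc h) r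
  indexCount-step h r h≤n = split-sum
    (λ k → q ^ (k ∸ k ⊓ h) ℕ.* indexCount (h ⊔ suc (k ⊓ h)) r) _ _ h≤n below above
    where
    below : ∀ k → k < h → q ^ (k ∸ k ⊓ h) ℕ.* indexCount (h ⊔ suc (k ⊓ h)) r ≡ indexCount h r
    below k k<h rewrite ℕₚ.m≤n⇒m⊓n≡m (ℕₚ.<⇒≤ k<h) | ℕₚ.n∸n≡0 k | ℕₚ.m≥n⇒m⊔n≡m k<h =
      ℕₚ.*-identityˡ _
    above : ∀ k → h ≤ k →
      q ^ (k ∸ k ⊓ h) ℕ.* indexCount (h ⊔ suc (k ⊓ h)) r ≡ q ^ (k ∸ h) ℕ.* indexCount (suc h) r
    above k h≤k rewrite ℕₚ.m≥n⇒m⊓n≡n h≤k | ℕₚ.m≤n⇒m⊔n≡n (ℕₚ.n≤1+n h) = ≡.refl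

  private
    falling : ℕ → ℕ
    falling ℓ = ℕ-List.product (applyUpTo (λ i → [ n ∸ i ]) ℓ)

    -- Interpolates between indexCount 0 (at r = 0) and d (at s = 0).
    mixed : ℕ → ℕ → ℕ
    mixed r s = ℕ-sum {suc n} λ ℓ → Stirling₂ r (toℕ ℓ) ℕ.* (falling (toℕ ℓ) ℕ.* indexCount (toℕ ℓ) s)

    -- The factor [n - ℓ] in the recurrence for `indexCount` is absorbed into the falling product of
    -- length ℓ + 1. Shifting ℓ in that half of the sum then produces the recurrence of the Stirling
    -- numbers.
    mixed-shift : ∀ r s → mixed r (suc s) ≡ mixed (suc r) s
    mixed-shift r s = begin
      mixed r (suc s)
        ≡⟨ ℕΣ.sum-cong-≗ {suc n} (λ ℓ → expand (toℕ ℓ) (s≤s⁻¹ (Finₚ.toℕ<n ℓ))) ⟩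
      ℕ-sum {suc n} (λ ℓ → toℕ ℓ ℕ.* S (toℕ ℓ) ℕ.* B (toℕ ℓ) ℕ.+ S (toℕ ℓ) ℕ.* B (suc (toℕ ℓ)))
        ≡⟨ ℕΣ.∑-distrib-+ {suc n} (λ ℓ → toℕ ℓ ℕ.* S (toℕ ℓ) ℕ.* B (toℕ ℓ))
             (λ ℓ → S (toℕ ℓ) ℕ.* B (suc (toℕ ℓ))) ⟩
      ℕ-sum {n} (λ ℓ → suc (toℕ ℓ) ℕ.* S (suc (toℕ ℓ)) ℕ.* B (suc (toℕ ℓ)))
        ℕ.+ ℕ-sum {suc n} (λ ℓ → S (toℕ ℓ) ℕ.* B (suc (toℕ ℓ)))
        ≡⟨ ≡.cong (ℕ-sum {n} (λ ℓ → suc (toℕ ℓ) ℕ.* S (suc (toℕ ℓ)) ℕ.* B (suc (toℕ ℓ))) ℕ.+_)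
             (≡.trans (sum-last (λ ℓ → S ℓ ℕ.* B (suc ℓ)) n)
               (≡.trans (≡.cong (ℕ-sum {n} (λ ℓ → S (toℕ ℓ) ℕ.* B (suc (toℕ ℓ))) ℕ.+_)
                 (≡.trans (≡.cong (S n ℕ.*_) B-top) (ℕₚ.*-zeroʳ (S n)))) (ℕₚ.+-identityʳ _))) ⟩
      ℕ-sum {n} (λ ℓ → suc (toℕ ℓ) ℕ.* S (suc (toℕ ℓ)) ℕ.* B (suc (toℕ ℓ)))
        ℕ.+ ℕ-sum {n} (λ ℓ → S (toℕ ℓ) ℕ.* B (suc (toℕ ℓ)))
        ≡⟨ ℕΣ.∑-distrib-+ {n} (λ ℓ → suc (toℕ ℓ) ℕ.* S (suc (toℕ ℓ)) ℕ.* B (suc (toℕ ℓ)))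
             (λ ℓ → S (toℕ ℓ) ℕ.* B (suc (toℕ ℓ))) ⟨
      ℕ-sum {n} (λ ℓ → suc (toℕ ℓ) ℕ.* S (suc (toℕ ℓ)) ℕ.* B (suc (toℕ ℓ)) ℕ.+ S (toℕ ℓ) ℕ.* B (suc (toℕ ℓ)))
        ≡⟨ ℕΣ.sum-cong-≗ {n} (λ ℓ → ≡.sym (ℕₚ.*-distribʳ-+ (B (suc (toℕ ℓ))) (suc (toℕ ℓ) ℕ.* S (suc (toℕ ℓ))) (S (toℕ ℓ)))) ⟩
      mixed (suc r) s ∎
      where
      S B : ℕ → ℕ
      S = Stirling₂ r
      B ℓ = falling ℓ ℕ.* indexCount ℓ s
      falling-suc : ∀ ℓ → falling (suc ℓ) ≡ falling ℓ ℕ.* [ n ∸ ℓ ]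
      falling-suc = product-∷ʳ (λ i → [ n ∸ i ])
      -- The shift creates a term ℓ = n + 1 outside the range of `mixed`; its falling product
      -- contains [0], which is 0 as an empty sum of powers.
      B-top : B (suc n) ≡ 0
      B-top = ≡.cong (ℕ._* indexCount (suc n) s) (≡.trans (falling-suc n)
        (≡.trans (≡.cong (λ t → falling n ℕ.* [ t ]) (ℕₚ.n∸n≡0 n))
          (≡.trans (≡.cong (falling n ℕ.*_) (≡.sym (sum-powers 0))) (ℕₚ.*-zeroʳ (falling n)))))
      expand : ∀ ℓ → ℓ ≤ n → S ℓ ℕ.* (falling ℓ ℕ.* indexCount ℓ (suc s))
                           ≡ ℓ ℕ.* S ℓ ℕ.* B ℓ ℕ.+ S ℓ ℕ.* B (suc ℓ)
      expand ℓ ℓ≤n = begin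
        S ℓ ℕ.* (f ℕ.* indexCount ℓ (suc s))
          ≡⟨ ≡.cong (λ t → S ℓ ℕ.* (f ℕ.* t)) (indexCount-step ℓ s ℓ≤n) ⟩
        S ℓ ℕ.* (f ℕ.* (ℓ ℕ.* i₀ ℕ.+ g ℕ.* i₁))
          ≡⟨ ≡.cong (S ℓ ℕ.*_) (ℕₚ.*-distribˡ-+ f (ℓ ℕ.* i₀) (g ℕ.* i₁)) ⟩
        S ℓ ℕ.* (f ℕ.* (ℓ ℕ.* i₀) ℕ.+ f ℕ.* (g ℕ.* i₁))
          ≡⟨ ≡.cong (S ℓ ℕ.*_) (≡.cong₂ ℕ._+_ (x∙yz≈y∙xz f ℓ i₀) (≡.sym (ℕₚ.*-assoc f g i₁))) ⟩
        S ℓ ℕ.* (ℓ ℕ.* B ℓ ℕ.+ f ℕ.* g ℕ.* i₁)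
          ≡⟨ ≡.cong (λ t → S ℓ ℕ.* (ℓ ℕ.* B ℓ ℕ.+ t ℕ.* i₁)) (falling-suc ℓ) ⟨
        S ℓ ℕ.* (ℓ ℕ.* B ℓ ℕ.+ B (suc ℓ))
          ≡⟨ ℕₚ.*-distribˡ-+ (S ℓ) (ℓ ℕ.* B ℓ) (B (suc ℓ)) ⟩
        S ℓ ℕ.* (ℓ ℕ.* B ℓ) ℕ.+ S ℓ ℕ.* B (suc ℓ)
          ≡⟨ ≡.cong (ℕ._+ S ℓ ℕ.* B (suc ℓ)) (≡.trans (x∙yz≈y∙xz (S ℓ) ℓ (B ℓ)) (≡.sym (ℕₚ.*-assoc ℓ (S ℓ) (B ℓ)))) ⟩
        ℓ ℕ.* S ℓ ℕ.* B ℓ ℕ.+ S ℓ ℕ.* B (suc ℓ) ∎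
        where
        f g i₀ i₁ : ℕ
        f = falling ℓ
        g = [ n ∸ ℓ ]
        i₀ = indexCount ℓ s
        i₁ = indexCount (suc ℓ) s

    mixed-0 : ∀ r s → mixed r s ≡ mixed (s ℕ.+ r) 0
    mixed-0 r zero = ≡.refl
    mixed-0 r (suc s) = ≡.trans (mixed-shift r s)
      (≡.trans (mixed-0 (suc r) s) (≡.cong (λ t → mixed t 0) (ℕₚ.+-suc s r)))

  indexCount-0 : ∀ r → indexCount 0 r ≡ d n r
  indexCount-0 zero = ≡.refl
  indexCount-0 (suc r) = begin
    indexCount 0 (suc r)
      ≡⟨ ≡.trans (ℕₚ.+-identityʳ _) (≡.trans (ℕₚ.*-identityˡ _) (ℕₚ.*-identityˡ _)) ⟨
    1 ℕ.* (1 ℕ.* indexCount 0 (suc r)) ℕ.+ 0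
      ≡⟨ ≡.cong (1 ℕ.* (1 ℕ.* indexCount 0 (suc r)) ℕ.+_) (ℕΣ.sum-replicate-zero n) ⟨
    mixed 0 (suc r)
      ≡⟨ mixed-0 0 (suc r) ⟩
    mixed (suc r ℕ.+ 0) 0
      ≡⟨ ≡.cong (λ t → mixed t 0) (ℕₚ.+-identityʳ (suc r)) ⟩
    mixed (suc r) 0
      -- The term ℓ = 0 vanishes by definition of `Stirling₂ (suc r) zero`, which leaves the range 1
      -- to n of `d`.
      ≡⟨ ℕΣ.sum-cong-≗ {n} (λ ℓ → ≡.cong (Stirling₂ (suc r) (suc (toℕ ℓ)) ℕ.*_) (ℕₚ.*-identityʳ (falling (suc (toℕ ℓ))))) ⟩
    ℕ-sum {n} (λ ℓ → Stirling₂ (suc r) (suc (toℕ ℓ)) ℕ.* falling (suc (toℕ ℓ)))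
      ≡⟨ sum-applyUpTo (λ ℓ → Stirling₂ (suc r) (suc ℓ) ℕ.* falling (suc ℓ)) n ⟨
    d n (suc r) ∎

  -- At h = 0 every first entry leads to height 1, so the recurrence has only the summand with the
  -- factor [n]; this is the source of the divisibility in part (b).
  indexCount-1 : ∀ r → d n (suc r) ≡ indexCount 1 r ℕ.* [ n ]
  indexCount-1 r = ≡.trans (≡.sym (indexCount-0 (suc r)))
    (≡.trans (indexCount-step 0 r z≤n) (ℕₚ.*-comm [ n ] (indexCount 1 r)))

↔⇒≟ : ∀ {N} {I : Set} → Fin N ↔ I → DecidableEquality I
↔⇒≟ enum x y = map′
  (λ e → ≡.trans (≡.sym (strictlyInverseˡ x)) (≡.trans (≡.cong to e) (strictlyInverseˡ y)))
  (≡.cong from) (from x Fin.≟ from y)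
  where open Inverse enum

nextHeight : ∀ {n} → ℕ → Fin n → ℕ
nextHeight h κ = h ⊔ suc (toℕ κ ⊓ h)

-- Lines of V, their normal forms, and the part of a line that U_h leaves alone.

module Lines {q : ℕ} (F : FiniteField q) where
  open CommutativeRing (FiniteField.commutativeRing F)
    using (_*_; 0#; 1#; *-identityˡ; *-identityʳ; *-assoc; *-comm; zeroˡ; semiring)
  open import Algebra.Properties.Semiring.Sum semiring using (sum)
  open Matrices F
  open ≡.≡-Reasoning
  private module F = FiniteField F

  *-cancelʳ : ∀ {x y} z → z ≢ 0# → x * z ≡ y * z → x ≡ y
  *-cancelʳ {x} {y} z z≢0 e with F.invertible z z≢0
  ... | z⁻¹ , zz⁻¹ = ≡.trans (≡.sym (go x)) (≡.trans (≡.cong (_* z⁻¹) e) (go y))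
    where
    go : ∀ x → x * z * z⁻¹ ≡ x
    go x = ≡.trans (*-assoc x z z⁻¹) (≡.trans (≡.cong (x *_) zz⁻¹) (*-identityʳ x))

  δ-sum : ∀ {n} (i : Fin n) (f : Fin n → F.Carrier) → sum (λ c → δ i c * f c) ≡ f i
  δ-sum i f = ⨯-identityˡ (λ c _ → f c) i i

  δ-punchIn : ∀ {n} k (i j : Fin n) → δ (punchIn k i) (punchIn k j) ≡ δ i j
  δ-punchIn zero i j = ≡.refl
  δ-punchIn (suc k) zero zero = ≡.refl
  δ-punchIn (suc k) zero (suc j) = ≡.refl
  δ-punchIn (suc k) (suc i) zero = ≡.refl
  δ-punchIn (suc k) (suc i) (suc j) = δ-punchIn k i j

  -- `wMatrix k f` sends basis vector j + 1 to number `punchIn k j`, so computing its rows means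
  -- separating row k from the rows `punchIn k i`.
  data Position {n} (k : Fin (suc n)) : Fin (suc n) → Set where
    here  : Position k k
    there : ∀ j → Position k (punchIn k j)

  position : ∀ {n} (k i : Fin (suc n)) → Position k i
  position k i with k Fin.≟ i
  ... | yes ≡.refl = here
  ... | no k≢i = ≡.subst (Position k) (Finₚ.punchIn-punchOut k≢i) (there (punchOut k≢i))

  punchIn-< : ∀ {n} k (j : Fin n) → toℕ j < toℕ k → toℕ (punchIn k j) ≡ toℕ j
  punchIn-< (suc k) zero _ = ≡.refl
  punchIn-< (suc k) (suc j) p = ≡.cong suc (punchIn-< k j (s≤s⁻¹ p))

  punchIn-≥ : ∀ {n} k (j : Fin n) → toℕ k ≤ toℕ j → toℕ (punchIn k j) ≡ suc (toℕ j)
  punchIn-≥ zero j _ = ≡.refl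
  punchIn-≥ (suc k) (suc j) p = ≡.cong suc (punchIn-≥ k j (s≤s⁻¹ p))

  j≤punchIn : ∀ {n} k (j : Fin n) → toℕ j ≤ toℕ (punchIn k j)
  j≤punchIn zero j = ℕₚ.n≤1+n (toℕ j)
  j≤punchIn (suc k) zero = z≤n
  j≤punchIn (suc k) (suc j) = s≤s (j≤punchIn k j)

  punchIn≤suc : ∀ {n} k (j : Fin n) → toℕ (punchIn k j) ≤ suc (toℕ j)
  punchIn≤suc zero j = ℕₚ.≤-refl
  punchIn≤suc (suc k) zero = z≤n
  punchIn≤suc (suc k) (suc j) = s≤s (punchIn≤suc k j)

  k<punchIn : ∀ {n} k (j : Fin n) → toℕ k ≤ toℕ (punchIn k j) → toℕ k < toℕ (punchIn k j)
  k<punchIn k j p = ℕₚ.≤∧≢⇒< p (λ e → Finₚ.punchInᵢ≢i k j (≡.sym (Finₚ.toℕ-injective e)))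

  -- Entries come from a function on all of `Fin n`, not from a vector of length k, so that one `f`
  -- serves every k: along a product of the s_i(t) only k advances.
  cut : ∀ {n} → Fin n → (Fin n → F.Carrier) → Fin n → F.Carrier
  cut zero    f zero    = 1#
  cut zero    f (suc i) = 0#
  cut (suc k) f zero    = f zero
  cut (suc k) f (suc i) = cut k (f ∘ suc) i

  cut-at : ∀ {n} (k : Fin n) f → cut k f k ≡ 1#
  cut-at zero f = ≡.refl
  cut-at (suc k) f = cut-at k (f ∘ suc)

  cut-above : ∀ {n} (k : Fin n) f i → toℕ k < toℕ i → cut k f i ≡ 0#
  cut-above zero f (suc i) _ = ≡.refl
  cut-above (suc k) f (suc i) p = cut-above k (f ∘ suc) i (s≤s⁻¹ p)

  cut-below : ∀ {n} (k : Fin n) f i → toℕ i < toℕ k → cut k f i ≡ f i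
  cut-below (suc k) f zero _ = ≡.refl
  cut-below (suc k) f (suc i) p = cut-below k (f ∘ suc) i (s≤s⁻¹ p)

  Line : ℕ → Set
  Line n = Σ (Fin n) λ k → Vec F.Carrier (toℕ k)

  column : ∀ {n} → Line n → Fin n → F.Carrier
  column (zero  , [])    zero    = 1#
  column (zero  , [])    (suc i) = 0#
  column (suc k , a ∷ c) zero    = a
  column (suc k , a ∷ c) (suc i) = column (k , c) i

  cut-column : ∀ {n} (ℓ : Line n) i → cut (proj₁ ℓ) (column ℓ) i ≡ column ℓ i
  cut-column (zero , []) zero = ≡.refl
  cut-column (zero , []) (suc i) = ≡.refl
  cut-column (suc k , a ∷ c) zero = ≡.refl
  cut-column (suc k , a ∷ c) (suc i) = cut-column (k , c) i

  column-at : ∀ {n} (ℓ : Line n) → column ℓ (proj₁ ℓ) ≡ 1#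
  column-at ℓ@(k , _) = ≡.trans (≡.sym (cut-column ℓ k)) (cut-at k (column ℓ))

  column-above : ∀ {n} (ℓ : Line n) i → toℕ (proj₁ ℓ) < toℕ i → column ℓ i ≡ 0#
  column-above ℓ@(k , _) i p = ≡.trans (≡.sym (cut-column ℓ i)) (cut-above k (column ℓ) i p)

  column-injective : ∀ {n} (k : Fin n) c c′ → (∀ i → column (k , c) i ≡ column (k , c′) i) → c ≡ c′
  column-injective zero [] [] e = ≡.refl
  column-injective (suc k) (a ∷ c) (a′ ∷ c′) e =
    ≡.cong₂ _∷_ (e zero) (column-injective k c c′ (λ i → e (suc i)))

  -- The invariants of a line under U_h. Dropping `k ⊓ h` entries gives exactly the type of the
  -- parameters a of an index.
  upper : ∀ h {k} → Vec F.Carrier k → Vec F.Carrier (k ∸ k ⊓ h)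
  upper zero {zero} c = c
  upper zero {suc k} c = c
  upper (suc h) [] = []
  upper (suc h) (a ∷ c) = upper h c

  -- Here b stands for the summation variables of the mean in w, and a for its fixed parameters.
  join : ∀ h {k} → Vec F.Carrier (k ⊓ h) → Vec F.Carrier (k ∸ k ⊓ h) → Vec F.Carrier k
  join h {zero} b a = []
  join zero {suc k} b a = a
  join (suc h) {suc k} (x ∷ b) a = x ∷ join h b a

  upper-join : ∀ h {k} (b : Vec F.Carrier (k ⊓ h)) a → upper h (join h b a) ≡ a
  upper-join zero {zero} b [] = ≡.refl
  upper-join (suc h) {zero} b [] = ≡.refl
  upper-join zero {suc k} b a = ≡.refl
  upper-join (suc h) {suc k} (x ∷ b) a = upper-join h b a

  lookup-join-below : ∀ {n} h (k : Fin n) b a (i : Fin (toℕ k ⊓ h)) (j : Fin n) → toℕ j ≡ toℕ i →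
    column (k , join h b a) j ≡ lookup b i
  lookup-join-below (suc h) (suc k) (x ∷ b) a zero zero _ = ≡.refl
  lookup-join-below (suc h) (suc k) (x ∷ b) a (suc i) (suc j) e =
    lookup-join-below h k b a i j (ℕₚ.suc-injective e)

  lookup-column : ∀ {n} (k : Fin n) c (i : Fin (toℕ k)) (j : Fin n) → toℕ j ≡ toℕ i →
    column (k , c) j ≡ lookup c i
  lookup-column (suc k) (x ∷ c) zero zero _ = ≡.refl
  lookup-column (suc k) (x ∷ c) (suc i) (suc j) e = lookup-column k c i j (ℕₚ.suc-injective e)

  lookup-join-above : ∀ {n} h (k : Fin n) b a (i : Fin (toℕ k ∸ toℕ k ⊓ h)) (j : Fin n) →
    toℕ j ≡ toℕ k ⊓ h ℕ.+ toℕ i → column (k , join h b a) j ≡ lookup a i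
  lookup-join-above zero (suc k) b a i j e = lookup-column (suc k) a i j e
  lookup-join-above (suc h) (suc k) (x ∷ b) a i (suc j) e =
    lookup-join-above h k b a i j (ℕₚ.suc-injective e)

  upper-cong : ∀ {n} h (k : Fin n) c c′ →
    (∀ i → h ≤ toℕ i → column (k , c) i ≡ column (k , c′) i) → upper h c ≡ upper h c′
  upper-cong zero k@zero c c′ e = column-injective k c c′ (λ i → e i z≤n)
  upper-cong zero k@(suc _) c c′ e = column-injective k c c′ (λ i → e i z≤n)
  upper-cong (suc h) zero [] [] e = ≡.refl
  upper-cong (suc h) (suc k) (a ∷ c) (a′ ∷ c′) e = upper-cong h k c c′ (λ i p → e (suc i) (s≤s p))

  column-upper : ∀ {n} h (k : Fin n) c c′ → upper h c ≡ upper h c′ →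
    ∀ i → toℕ k ⊓ h ≤ toℕ i → column (k , c) i ≡ column (k , c′) i
  column-upper zero zero c c′ e i p = ≡.cong (λ c → column (zero , c) i) e
  column-upper zero (suc k) c c′ e i p = ≡.cong (λ c → column (suc k , c) i) e
  column-upper (suc h) zero [] [] e i p = ≡.refl
  column-upper (suc h) (suc k) (a ∷ c) (a′ ∷ c′) e (suc i) p = column-upper h k c c′ e i (s≤s⁻¹ p)

  record Spans {n} (v : Fin n → F.Carrier) (ℓ : Line n) : Set where
    constructor spans
    field
      scale   : F.Carrier
      scale≢0 : scale ≢ 0#
      scaled  : ∀ i → v i ≡ column ℓ i * scale

  -- The tail is settled before the head, so the entry scaled to 1 is the last nonzero one.
  normalise : ∀ {n} (v : Fin n → F.Carrier) → (∀ i → v i ≡ 0#) ⊎ Σ (Line n) (Spans v)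
  normalise {zero} v = inj₁ (λ ())
  normalise {suc n} v with normalise (v ∘ suc)
  ... | inj₂ ((k , c) , spans s s≢0 e) with F.invertible s s≢0
  ...   | s⁻¹ , ss⁻¹ = inj₂ ((suc k , v zero * s⁻¹ ∷ c) , spans s s≢0 λ
          { zero → ≡.sym (≡.trans (*-assoc (v zero) s⁻¹ s)
                     (≡.trans (≡.cong (v zero *_) (≡.trans (*-comm s⁻¹ s) ss⁻¹)) (*-identityʳ (v zero))))
          ; (suc i) → e i })
  normalise {suc n} v | inj₁ e with ↔⇒≟ F.enumeration (v zero) 0#
  ...   | yes v₀≡0 = inj₁ (λ { zero → v₀≡0 ; (suc i) → e i })
  ...   | no v₀≢0 = inj₂ ((zero , []) , spans (v zero) v₀≢0 λ
          { zero → ≡.sym (*-identityˡ (v zero)) ; (suc i) → ≡.trans (e i) (≡.sym (zeroˡ (v zero))) })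

  -- The last nonzero entry sits at k and equals the scale, so the entries from k on determine both.
  -- Agreement is asked only there because a unitriangular matrix may change the earlier entries.
  spans-agree : ∀ {n} {v v′ : Fin n → F.Carrier} {ℓ ℓ′} (s : Spans v ℓ) (s′ : Spans v′ ℓ′) →
    (∀ i → toℕ (proj₁ ℓ) ≤ toℕ i → v i ≡ v′ i) →
    proj₁ ℓ ≡ proj₁ ℓ′ × Spans.scale s ≡ Spans.scale s′
  spans-agree {v = v} {v′} {ℓ@(k , c)} {ℓ′@(k′ , c′)} (spans s s≢0 e) (spans s′ s′≢0 e′) agree
    with ℕₚ.<-cmp (toℕ k) (toℕ k′)
  ... | tri≈ _ k≡k′ _ = Finₚ.toℕ-injective k≡k′ , (begin
      s                   ≡⟨ lead e ⟨
      v k                 ≡⟨ agree k ℕₚ.≤-refl ⟩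
      v′ k                ≡⟨ ≡.cong v′ (Finₚ.toℕ-injective k≡k′) ⟩
      v′ k′               ≡⟨ lead e′ ⟩
      s′ ∎)
    where
    lead : ∀ {v : Fin _ → F.Carrier} {ℓ s} → (∀ i → v i ≡ column ℓ i * s) → v (proj₁ ℓ) ≡ s
    lead {ℓ = ℓ} {s} e = ≡.trans (e (proj₁ ℓ)) (≡.trans (≡.cong (_* s) (column-at ℓ)) (*-identityˡ s))
  ... | tri< k<k′ _ _ = contradiction (begin
      s′                  ≡⟨ *-identityˡ s′ ⟨
      1# * s′             ≡⟨ ≡.cong (_* s′) (column-at ℓ′) ⟨
      column ℓ′ k′ * s′   ≡⟨ e′ k′ ⟨
      v′ k′               ≡⟨ agree k′ (ℕₚ.<⇒≤ k<k′) ⟨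
      v k′                ≡⟨ e k′ ⟩
      column ℓ k′ * s     ≡⟨ ≡.cong (_* s) (column-above ℓ k′ k<k′) ⟩
      0# * s              ≡⟨ zeroˡ s ⟩
      0# ∎) s′≢0
  ... | tri> _ _ k′<k = contradiction (begin
      s                   ≡⟨ *-identityˡ s ⟨
      1# * s              ≡⟨ ≡.cong (_* s) (column-at ℓ) ⟨
      column ℓ k * s      ≡⟨ e k ⟨
      v k                 ≡⟨ agree k ℕₚ.≤-refl ⟩
      v′ k                ≡⟨ e′ k ⟩
      column ℓ′ k * s′    ≡⟨ ≡.cong (_* s′) (column-above ℓ′ k k′<k) ⟩
      0# * s′             ≡⟨ zeroˡ s′ ⟩
      0# ∎) s≢0

  spans-unique : ∀ {n} {v v′ : Fin n → F.Carrier} {ℓ ℓ′} → (∀ i → v i ≡ v′ i) →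
    Spans v ℓ → Spans v′ ℓ′ → ℓ ≡ ℓ′
  spans-unique {v = v} {v′} {k , c} {k′ , c′} e s s′ with spans-agree s s′ (λ i _ → e i)
  ... | ≡.refl , ≡.refl = ≡.cong (k ,_) (column-injective k c c′ (λ i →
    *-cancelʳ (Spans.scale s) (Spans.scale≢0 s)
      (≡.trans (≡.sym (Spans.scaled s i)) (≡.trans (e i) (Spans.scaled s′ i)))))

  Parameters : ∀ {n r} → ℕ → Vec (Fin n) r → Set
  Parameters h κs = All (λ (κ , κ*) → Vec F.Carrier (toℕ κ ∸ κ*)) (zip κs (starHeights h κs))

  Index : ℕ → ℕ → ℕ → Set
  Index n h r = Σ (Vec (Fin n) r) (Parameters h)

  cons : ∀ {n h r} κ → Vec F.Carrier (toℕ κ ∸ toℕ κ ⊓ h) → Index n (nextHeight h κ) r → Index n h (suc r)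
  cons κ a (κs , as) = κ ∷ κs , a ∷ as

-- Coset representatives of P in GL_n, and how U_h acts on cosets.

module Elements {q : ℕ} (F : FiniteField q) (m : ℕ) where
  open CommutativeRing (FiniteField.commutativeRing F)
    using (_+_; _*_; -_; 0#; 1#; +-identityˡ; +-identityʳ; +-comm; +-assoc; *-identityˡ; *-identityʳ;
           *-assoc; *-comm; zeroˡ; zeroʳ; distribʳ; -‿inverseˡ; -‿inverseʳ; semiring; ring)
  open import Algebra.Properties.Semiring.Sum semiring
    using (sum; sum-cong-≗; *-distribˡ-sum; *-distribʳ-sum; ∑-distrib-+)
  open import Algebra.Properties.Ring ring using (-‿distribˡ-*; -‿distribʳ-*; -0#≈0#)
  open Matrices F hiding (x; s)
  open Lines F
  open LeviPair (levi m) using (module P; module L; module U)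
  open ≡.≡-Reasoning
  private
    module F = FiniteField F
    n = suc m
    module G = Group (GL n)

  -- The closed form of s_k(c_k) ⋯ s_1(c_1), with its inverse: the product cycles the first k + 1
  -- coordinates and carries the c_i in its first column.
  wMatrix wInverse : Fin n → (Fin n → F.Carrier) → Matrix n
  wMatrix k f i zero    = cut k f i
  wMatrix k f i (suc j) = δ i (punchIn k j)
  wInverse k f zero    j = δ k j
  wInverse k f (suc i) j = δ (punchIn k i) j + - (cut k f (punchIn k i) * δ k j)

  cancel-neg : ∀ x y → x + (y + - x) ≡ y
  cancel-neg x y = ≡.trans (+-comm x (y + - x)) (≡.trans (+-assoc y (- x) x)
    (≡.trans (≡.cong (y +_) (-‿inverseˡ x)) (+-identityʳ y)))

  sub-zero : ∀ {x} y → x ≡ 0# → y + - x ≡ y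
  sub-zero y ≡.refl = ≡.trans (≡.cong (y +_) -0#≈0#) (+-identityʳ y)

  wMatrix-at : ∀ k f A j → (wMatrix k f ⨯ A) k j ≡ A zero j
  wMatrix-at k f A j = begin
    cut k f k * A zero j + sum (λ c → δ k (punchIn k c) * A (suc c) j)
      ≡⟨ ≡.cong₂ _+_ (≡.trans (≡.cong (_* A zero j) (cut-at k f)) (*-identityˡ _))
           (sum-zero _ λ c → *-zeroˡ m (A (suc c) j) (δ-≢ (Finₚ.punchInᵢ≢i k c ∘ ≡.sym))) ⟩
    A zero j + 0#  ≡⟨ +-identityʳ (A zero j) ⟩
    A zero j       ∎

  wMatrix-punchIn : ∀ k f A i j →
    (wMatrix k f ⨯ A) (punchIn k i) j ≡ cut k f (punchIn k i) * A zero j + A (suc i) j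
  wMatrix-punchIn k f A i j = ≡.cong (cut k f (punchIn k i) * A zero j +_) (begin
    sum (λ c → δ (punchIn k i) (punchIn k c) * A (suc c) j)
      ≡⟨ sum-cong-≗ (λ c → ≡.cong (_* A (suc c) j) (δ-punchIn k i c)) ⟩
    sum (λ c → δ i c * A (suc c) j)
      ≡⟨ δ-sum i (λ c → A (suc c) j) ⟩
    A (suc i) j ∎)

  wInverse-zero : ∀ k f A j → (wInverse k f ⨯ A) zero j ≡ A k j
  wInverse-zero k f A j = δ-sum k (λ c → A c j)

  wInverse-suc : ∀ k f A i j →
    (wInverse k f ⨯ A) (suc i) j ≡ A (punchIn k i) j + - (cut k f (punchIn k i) * A k j)
  wInverse-suc k f A i j = begin
    sum (λ c → (δ p c + - (x * δ k c)) * A c j)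
      ≡⟨ sum-cong-≗ (λ c → ≡.trans (distribʳ (A c j) (δ p c) (- (x * δ k c)))
           (≡.cong (δ p c * A c j +_) (move c))) ⟩
    sum (λ c → δ p c * A c j + (- x) * (δ k c * A c j))
      ≡⟨ ∑-distrib-+ (λ c → δ p c * A c j) (λ c → (- x) * (δ k c * A c j)) ⟩
    sum (λ c → δ p c * A c j) + sum (λ c → (- x) * (δ k c * A c j))
      ≡⟨ ≡.cong₂ _+_ (δ-sum p (λ c → A c j)) (≡.trans
           (≡.sym (*-distribˡ-sum (- x) (λ c → δ k c * A c j))) (≡.cong ((- x) *_) (δ-sum k (λ c → A c j)))) ⟩
    A p j + (- x) * A k j
      ≡⟨ ≡.cong (A p j +_) (-‿distribˡ-* x (A k j)) ⟨
    A p j + - (x * A k j) ∎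
    where
    p = punchIn k i
    x = cut k f p
    move : ∀ c → - (x * δ k c) * A c j ≡ (- x) * (δ k c * A c j)
    move c = ≡.trans (≡.cong (_* A c j) (-‿distribˡ-* x (δ k c))) (*-assoc (- x) (δ k c) (A c j))

  wMatrix⨯wInverse : ∀ k f → wMatrix k f ⨯ wInverse k f ≐ δ
  wMatrix⨯wInverse k f i j with position k i
  ... | here = wMatrix-at k f (wInverse k f) j
  ... | there i = ≡.trans (wMatrix-punchIn k f (wInverse k f) i j)
    (cancel-neg (cut k f (punchIn k i) * δ k j) (δ (punchIn k i) j))

  wInverse⨯wMatrix : ∀ k f → wInverse k f ⨯ wMatrix k f ≐ δ
  wInverse⨯wMatrix k f zero zero = ≡.trans (wInverse-zero k f (wMatrix k f) zero) (cut-at k f)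
  wInverse⨯wMatrix k f zero (suc j) = ≡.trans (wInverse-zero k f (wMatrix k f) (suc j))
    (δ-≢ (Finₚ.punchInᵢ≢i k j ∘ ≡.sym))
  wInverse⨯wMatrix k f (suc i) zero = ≡.trans (wInverse-suc k f (wMatrix k f) i zero)
    (≡.trans (≡.cong (λ t → x + - t) (≡.trans (≡.cong (x *_) (cut-at k f)) (*-identityʳ x))) (-‿inverseʳ x))
    where x = cut k f (punchIn k i)
  wInverse⨯wMatrix k f (suc i) (suc j) = ≡.trans (wInverse-suc k f (wMatrix k f) i (suc j))
    (≡.trans (sub-zero _ (*-zeroʳ m (cut k f (punchIn k i)) (δ-≢ (Finₚ.punchInᵢ≢i k j ∘ ≡.sym))))
      (δ-punchIn k i j))

  wElement : Fin n → (Fin n → F.Carrier) → G.Carrier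
  wElement k f = (wMatrix k f , wInverse k f) , wMatrix⨯wInverse k f , wInverse⨯wMatrix k f

  W : Line n → G.Carrier
  W ℓ = wElement (proj₁ ℓ) (column ℓ)

  -- The fixators of ⟨e_1⟩ ⊂ ⋯ ⊂ ⟨e_1 , … , e_h⟩ ⊂ V acting trivially on the graded pieces.
  Unitriangular : ℕ → Matrix n → Set
  Unitriangular h A = ∀ i j → h ≤ toℕ i ⊎ toℕ j ≤ toℕ i → A i j ≡ δ i j

  U⇒Unitriangular : ∀ {h} → 1 ≤ h → ∀ {u} → U.Member u → Unitriangular h (matrix u)
  U⇒Unitriangular 1≤h un zero zero _ = proj₁ un zero
  U⇒Unitriangular 1≤h un zero (suc j) (inj₁ h≤0) = contradiction (ℕₚ.≤-trans 1≤h h≤0) λ ()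
  U⇒Unitriangular 1≤h un zero (suc j) (inj₂ ())
  U⇒Unitriangular 1≤h un (suc i) j _ = lower-row m un i j

  Unitriangular-zero : ∀ {u : G.Carrier} → Unitriangular 0 (matrix u) → u G.≈ G.ε
  Unitriangular-zero un i j = un i j (inj₁ z≤n)

  Unitriangular-one : ∀ {u : G.Carrier} → Unitriangular 1 (matrix u) → U.Member u
  Unitriangular-one {u} un = mkUnipotent m (matrix u) (un zero zero (inj₂ z≤n))
    (λ i j → un (suc i) j (inj₁ (s≤s z≤n)))

  -- P is defined by factorisations l u. A matrix that preserves the line of e_1 has one because a
  -- right factor from U clears its top row.
  toP : ∀ g → (∀ i → matrix g (suc i) zero ≡ 0#) → P.Member g
  toP g@((A , B) , AB , BA) col = (g G.∙ u G.⁻¹ , u) , (row , col′) , proj₂ (unipotentElement m a) , split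
    where
    a : Vec F.Carrier m
    -- `B zero zero` is the inverse of `A zero zero`, as the first column of A vanishes below the
    -- corner; this makes `u` the factor that clears the top row.
    a = tabulate (λ j → B zero zero * A zero (suc j))
    u = proj₁ (unipotentElement m a)
    split : g G.≈ (g G.∙ u G.⁻¹) G.∙ u
    split = G.sym {(g G.∙ u G.⁻¹) G.∙ u} {g} (Gₚ.//-rightDividesˡ u g)
      where import Algebra.Properties.Group (GL n) as Gₚ
    AB₀₀ : A zero zero * B zero zero ≡ 1#
    AB₀₀ = ≡.trans (*-comm (A zero zero) (B zero zero))
      (≡.trans (≡.sym (corner m B A (λ c → *-zeroʳ m (B zero (suc c)) (col c)))) (BA zero zero))
    row : ∀ j → (A ⨯ unipotent m (Vec.map -_ a)) zero (suc j) ≡ 0#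
    row j = begin
      A zero zero * lookup (Vec.map -_ a) j + sum (λ c → A zero (suc c) * δ c j)
        ≡⟨ ≡.cong₂ _+_ (≡.cong (A zero zero *_) (≡.trans (Vecₚ.lookup-map j -_ a)
             (≡.cong -_ (Vecₚ.lookup∘tabulate _ j)))) (⨯-identityʳ (λ _ c → A zero (suc c)) j j) ⟩
      A zero zero * - (B zero zero * A zero (suc j)) + A zero (suc j)
        ≡⟨ ≡.cong (_+ A zero (suc j)) (-‿distribʳ-* (A zero zero) _) ⟨
      - (A zero zero * (B zero zero * A zero (suc j))) + A zero (suc j)
        ≡⟨ ≡.cong (λ t → - t + A zero (suc j)) (≡.trans (≡.sym (*-assoc _ _ _))
             (≡.trans (≡.cong (_* A zero (suc j)) AB₀₀) (*-identityˡ _))) ⟩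
      - A zero (suc j) + A zero (suc j)
        ≡⟨ -‿inverseˡ (A zero (suc j)) ⟩
      0# ∎
    col′ : ∀ i → (A ⨯ unipotent m (Vec.map -_ a)) (suc i) zero ≡ 0#
    col′ i = ≡.trans (≡.cong₂ _+_ (*-zeroˡ m 1# (col i)) (sum-zero _ (λ c → zeroʳ (A (suc i) (suc c)))))
      (+-identityʳ 0#)

  P-column : ∀ {g} → P.Member g → ∀ i → matrix g (suc i) zero ≡ 0#
  P-column {g} ((l , u) , (r , c) , un , g≈lu) i = begin
    matrix g (suc i) zero
      ≡⟨ g≈lu (suc i) zero ⟩
    matrix l (suc i) zero * matrix u zero zero + sum (λ d → matrix l (suc i) (suc d) * matrix u (suc d) zero)
      ≡⟨ ≡.cong₂ _+_ (*-zeroˡ m _ (c i)) (sum-zero _ (λ d → *-zeroʳ m (matrix l (suc i) (suc d)) (zero-col m un d))) ⟩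
    0# + 0#
      ≡⟨ +-identityʳ 0# ⟩
    0# ∎

  unitriangular⇒P : ∀ {h} (u : G.Carrier) → Unitriangular h (matrix u) → P.Member u
  unitriangular⇒P u un = toP u (λ i → un (suc i) zero (inj₂ z≤n))

  firstColumn : G.Carrier → Fin n → F.Carrier
  firstColumn g i = matrix g i zero

  opaque
    lineData : ∀ g → Σ (Line n) (Spans (firstColumn g))
    lineData g@((A , B) , AB , BA) with normalise (firstColumn g)
    ... | inj₂ s = s
    -- A zero first column would make the corner entry of B A vanish.
    ... | inj₁ e = contradiction (≡.trans (≡.sym (sum-zero _ (λ c → *-zeroʳ m (B zero c) (e c)))) (BA zero zero)) F.0≢1

  line : G.Carrier → Line n
  line g = proj₁ (lineData g)

  line-cong : ∀ g h → g G.≈ h → line g ≡ line h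
  line-cong g h e = spans-unique (λ i → e i zero) (proj₂ (lineData g)) (proj₂ (lineData h))

  P-corner : ∀ p → P.Member p → matrix p zero zero ≢ 0#
  P-corner p@((A , B) , AB , BA) p∈P e = F.0≢1 (begin
    0#                            ≡⟨ *-zeroʳ m (B zero zero) e ⟨
    B zero zero * A zero zero     ≡⟨ corner m B A (λ c → *-zeroʳ m (B zero (suc c)) (P-column {p} p∈P c)) ⟨
    (B ⨯ A) zero zero             ≡⟨ BA zero zero ⟩
    1# ∎)

  -- The first column of p is a nonzero multiple of e_1, so the first column of g p is the same
  -- multiple of that of g.
  line-P : ∀ g p → P.Member p → line (g G.∙ p) ≡ line g
  line-P g p p∈P = spans-unique (λ i → ≡.refl) (proj₂ (lineData (g G.∙ p)))
    (let spans s s≢0 e = proj₂ (lineData g) in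
     spans (s * matrix p zero zero)
       (λ e₀ → s≢0 (*-cancelʳ (matrix p zero zero) (P-corner p p∈P) (≡.trans e₀ (≡.sym (zeroˡ _)))))
       (λ i → begin
         (matrix g ⨯ matrix p) i zero
           ≡⟨ ≡.trans (≡.cong (matrix g i zero * matrix p zero zero +_)
                (sum-zero _ (λ c → *-zeroʳ m (matrix g i (suc c)) (P-column {p} p∈P c)))) (+-identityʳ _) ⟩
         matrix g i zero * matrix p zero zero
           ≡⟨ ≡.cong (_* matrix p zero zero) (e i) ⟩
         column (line g) i * s * matrix p zero zero
           ≡⟨ *-assoc _ s _ ⟩
         column (line g) i * (s * matrix p zero zero) ∎))

  line-W : ∀ ℓ → line (W ℓ) ≡ ℓ
  line-W ℓ = spans-unique (λ i → ≡.refl) (proj₂ (lineData (W ℓ)))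
    (spans 1# (F.0≢1 ∘ ≡.sym) (λ i → ≡.trans (cut-column ℓ i) (≡.sym (*-identityʳ _))))

  cofactor : G.Carrier → G.Carrier
  cofactor g = W (line g) G.⁻¹ G.∙ g

  -- The first columns of g and of W (line g) are proportional, so W⁻¹ takes that of g to a multiple
  -- of e_1.
  cofactor∈P : ∀ g → P.Member (cofactor g)
  cofactor∈P g = toP (cofactor g) λ i → let p = punchIn k i in begin
    (wInverse k (column ℓ) ⨯ matrix g) (suc i) zero
      ≡⟨ wInverse-suc k (column ℓ) (matrix g) i zero ⟩
    matrix g p zero + - (cut k (column ℓ) p * matrix g k zero)
      ≡⟨ ≡.cong₂ (λ x y → x + - y) (e p) (≡.cong₂ _*_ (cut-column ℓ p) (≡.trans (e k)
           (≡.trans (≡.cong (_* s) (column-at ℓ)) (*-identityˡ s)))) ⟩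
    column ℓ p * s + - (column ℓ p * s)
      ≡⟨ -‿inverseʳ (column ℓ p * s) ⟩
    0# ∎
    where
    ℓ = line g
    k = proj₁ ℓ
    open Spans (proj₂ (lineData g)) renaming (scale to s; scaled to e)

  -- The product differs from the identity only in column k, by the differences of the two columns,
  -- and these vanish from `k ⊓ h` on. It follows that U_h is transitive on the lines with given
  -- `upper h`.
  transfer-unitriangular : ∀ h k f f′ → (∀ i → toℕ k ⊓ h ≤ toℕ i → cut k f i ≡ cut k f′ i) →
    Unitriangular h (wMatrix k f′ ⨯ wInverse k f)
  transfer-unitriangular h k f f′ agree i j h≤i∨j≤i with position k i
  ... | here = wMatrix-at k f′ (wInverse k f) j
  ... | there i = ≡.trans (wMatrix-punchIn k f′ (wInverse k f) i j) (shift (j Fin.≟ k) h≤i∨j≤i)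
    where
    p = punchIn k i
    shift : _ → h ≤ toℕ p ⊎ toℕ j ≤ toℕ p → cut k f′ p * δ k j + (δ p j + - (cut k f p * δ k j)) ≡ δ p j
    shift (no j≢k) _ = ≡.trans
      (≡.cong₂ _+_ (*-zeroʳ m (cut k f′ p) e) (sub-zero (δ p j) (*-zeroʳ m (cut k f p) e)))
      (+-identityˡ (δ p j))
      where
      e : δ k j ≡ 0#
      e = δ-≢ (j≢k ∘ ≡.sym)
    shift (yes ≡.refl) h≤p∨k≤p = ≡.trans
      (≡.cong (λ t → t * δ k k + (δ p k + - (cut k f p * δ k k))) (≡.sym (agree p
        ([ ℕₚ.≤-trans (ℕₚ.m⊓n≤n (toℕ k) h) , ℕₚ.≤-trans (ℕₚ.m⊓n≤m (toℕ k) h) ]′ h≤p∨k≤p))))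
      (cancel-neg (cut k f p * δ k k) (δ p k))

  levi-corner : ∀ {u l u₀} → matrix u zero zero ≡ 1# → (∀ j → matrix l zero (suc j) ≡ 0#) →
    U.Member u₀ → u G.≈ l G.∙ u₀ → matrix l zero zero ≡ 1#
  levi-corner {u} {l} {u₀} u₀₀ r un₀ u≈lu₀ = begin
    matrix l zero zero                         ≡⟨ *-identityʳ _ ⟨
    matrix l zero zero * 1#                    ≡⟨ ≡.cong (matrix l zero zero *_) (proj₁ un₀ zero) ⟨
    matrix l zero zero * matrix u₀ zero zero   ≡⟨ corner m (matrix l) (matrix u₀) (λ c → *-zeroˡ m (matrix u₀ (suc c) zero) (r c)) ⟨
    matrix (l G.∙ u₀) zero zero                ≡⟨ u≈lu₀ zero zero ⟨
    matrix u zero zero                         ≡⟨ u₀₀ ⟩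
    1# ∎

  -- The half of the stabiliser statement that serves spanning: modulo U, every u in U_{h′} comes
  -- from an element of U_h that fixes ℓ. The Levi part l is conjugated instead of u because W would
  -- carry the top row of u to row k, where U_h need not allow it.
  conjugate-unitriangular : ∀ h ℓ → let k = proj₁ ℓ in ∀ u l u₀ →
    Unitriangular (nextHeight h k) (matrix u) → L.Member l → U.Member u₀ → u G.≈ l G.∙ u₀ →
    Unitriangular h (matrix (W ℓ G.∙ (l G.∙ W ℓ G.⁻¹)))
  conjugate-unitriangular h ℓ@(k , _) u l u₀ un (r , c) un₀ u≈lu₀ i j h≤i∨j≤i with position k i
  ... | here = ≡.trans (wMatrix-at k (column ℓ) B j) (≡.trans
      (≡.cong₂ _+_ (≡.cong (_* δ k j) (levi-corner {u} {l} {u₀} (un zero zero (inj₂ z≤n)) r un₀ u≈lu₀))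
        (sum-zero _ (λ d → *-zeroˡ m (wInverse k (column ℓ) (suc d) j) (r d))))
      (≡.trans (+-identityʳ _) (*-identityˡ (δ k j))))
    where
    B = matrix (l G.∙ W ℓ G.⁻¹)
  ... | there i = ≡.trans (wMatrix-punchIn k (column ℓ) B i j)
      (≡.trans (≡.cong₂ (λ x y → cut k (column ℓ) p * x + y) first
        (≡.trans (≡.cong (_+ sum (λ d → matrix l (suc i) (suc d) * V d)) (*-zeroˡ m (δ k j) (c i))) (+-identityˡ _)))
      (finish h≤i∨j≤i))
    where
    p = punchIn k i
    x = cut k (column ℓ) p
    B = matrix (l G.∙ W ℓ G.⁻¹)
    V : Fin m → F.Carrier
    V d = wInverse k (column ℓ) (suc d) j
    first : B zero j ≡ δ k j
    first = ≡.trans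
      (≡.cong₂ _+_ (≡.cong (_* δ k j) (levi-corner {u} {l} {u₀} (un zero zero (inj₂ z≤n)) r un₀ u≈lu₀))
        (sum-zero _ (λ d → *-zeroˡ m (V d) (r d))))
      (≡.trans (+-identityʳ _) (*-identityˡ (δ k j)))
    block : ∀ d → matrix l (suc i) (suc d) ≡ matrix u (suc i) (suc d)
    block d = ≡.sym (begin
      matrix u (suc i) (suc d)                   ≡⟨ u≈lu₀ (suc i) (suc d) ⟩
      matrix l (suc i) zero * matrix u₀ zero (suc d) + sum (λ e → matrix l (suc i) (suc e) * matrix u₀ (suc e) (suc d))
        ≡⟨ ≡.cong₂ _+_ (*-zeroˡ m _ (c i)) (sum-cong-≗ (λ e → ≡.cong (matrix l (suc i) (suc e) *_) (lower-row m un₀ e (suc d)))) ⟩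
      0# + sum (λ e → matrix l (suc i) (suc e) * δ e d)
        ≡⟨ +-identityˡ _ ⟩
      sum (λ e → matrix l (suc i) (suc e) * δ e d)
        ≡⟨ ⨯-identityʳ (λ _ e → matrix l (suc i) (suc e)) d d ⟩
      matrix l (suc i) (suc d) ∎)
    finish : h ≤ toℕ p ⊎ toℕ j ≤ toℕ p → x * δ k j + sum (λ d → matrix l (suc i) (suc d) * V d) ≡ δ p j
    -- From h ≤ p follows h′ ≤ i + 1, so row i + 1 of u, and with it row i + 1 of l, is that of the
    -- identity. What remains is row p of W W⁻¹.
    finish (inj₁ h≤p) = ≡.trans (≡.cong (x * δ k j +_) (≡.trans
        (sum-cong-≗ (λ d → ≡.cong (_* V d) (≡.trans (block d) (un (suc i) (suc d) (inj₁ (h′≤ h≤p))))))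
        (δ-sum i V))) (cancel-neg (x * δ k j) (δ p j))
      where
      h′≤ : h ≤ toℕ p → nextHeight h k ≤ suc (toℕ i)
      h′≤ h≤p = ℕₚ.⊔-lub (ℕₚ.≤-trans h≤p (punchIn≤suc k i)) (s≤s (k⊓h≤i (ℕₚ.≤-total (toℕ k) (toℕ i))))
        where
        k⊓h≤i : _ → toℕ k ⊓ h ≤ toℕ i
        k⊓h≤i (inj₁ k≤i) = ℕₚ.≤-trans (ℕₚ.m⊓n≤m (toℕ k) h) k≤i
        k⊓h≤i (inj₂ i≤k) with ℕₚ.m≤n⇒m<n∨m≡n i≤k
        ... | inj₁ i<k = ℕₚ.≤-trans (ℕₚ.m⊓n≤n (toℕ k) h) (≡.subst (h ≤_) (punchIn-< k i i<k) h≤p)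
        ... | inj₂ i≡k = ℕₚ.≤-trans (ℕₚ.m⊓n≤m (toℕ k) h) (ℕₚ.≤-reflexive (≡.sym i≡k))
    finish (inj₂ j≤p) with position k j
    -- In column k the bound forces k < p, where the column of ℓ vanishes. Terms with d ≥ i vanish
    -- by their second factor, those with d < i because u is upper triangular.
    ... | here = ≡.trans (≡.cong₂ _+_ (*-zeroˡ m (δ k k) (zero-at p (k<punchIn k i j≤p))) (sum-zero _ term))
                   (≡.trans (+-identityʳ 0#) (≡.sym (δ-≢ (Finₚ.punchInᵢ≢i k i))))
      where
      zero-at : ∀ p → toℕ k < toℕ p → cut k (column ℓ) p ≡ 0#
      zero-at p = cut-above k (column ℓ) p
      V-zero : ∀ d → toℕ k < toℕ (punchIn k d) → wInverse k (column ℓ) (suc d) k ≡ 0#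
      V-zero d q = ≡.trans (sub-zero _ (*-zeroˡ m (δ k k) (zero-at (punchIn k d) q))) (δ-≢ (Finₚ.punchInᵢ≢i k d))
      term : ∀ d → matrix l (suc i) (suc d) * wInverse k (column ℓ) (suc d) k ≡ 0#
      term d with toℕ i ℕ.≤? toℕ d
      ... | yes i≤d = *-zeroʳ m (matrix l (suc i) (suc d)) (V-zero d
              (ℕₚ.<-≤-trans (k<punchIn k i j≤p) (Finₚ.punchIn-mono-≤ k i d i≤d)))
      ... | no i≰d = *-zeroˡ m (wInverse k (column ℓ) (suc d) k) (≡.trans (block d) (≡.trans
              (un (suc i) (suc d) (inj₂ (s≤s (ℕₚ.≰⇒≥ i≰d)))) (δ-≢ {i = i} {d} (λ { ≡.refl → i≰d ℕₚ.≤-refl }))))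
    ... | there j = begin
      x * δ k (punchIn k j) + sum (λ d → matrix l (suc i) (suc d) * wInverse k (column ℓ) (suc d) (punchIn k j))
        ≡⟨ ≡.cong₂ _+_ (*-zeroʳ m x k≢p) (sum-cong-≗ (λ d → ≡.cong (matrix l (suc i) (suc d) *_)
             (≡.trans (sub-zero _ (*-zeroʳ m (cut k (column ℓ) (punchIn k d)) k≢p)) (δ-punchIn k d j)))) ⟩
      0# + sum (λ d → matrix l (suc i) (suc d) * δ d j)
        ≡⟨ ≡.trans (+-identityˡ _) (⨯-identityʳ (λ _ d → matrix l (suc i) (suc d)) j j) ⟩
      matrix l (suc i) (suc j)
        ≡⟨ block j ⟩
      matrix u (suc i) (suc j)
        ≡⟨ un (suc i) (suc j) (inj₂ (s≤s (Finₚ.punchIn-cancel-≤ k j i j≤p))) ⟩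
      δ i j
        ≡⟨ δ-punchIn k i j ⟨
      δ (punchIn k i) (punchIn k j) ∎
      where
      k≢p : δ k (punchIn k j) ≡ 0#
      k≢p = δ-≢ (Finₚ.punchInᵢ≢i k j ∘ ≡.sym)

  -- The half of the stabiliser statement that serves independence, for V = u, A = u W(ℓ) and f the
  -- column of the moved line. W⁻¹ subtracts x times row k of V from row p; either p > k and x = 0,
  -- or row k of V is trivial in the column concerned.
  fixed-line-unitriangular : ∀ h k f (V A : Matrix n) → Unitriangular h V →
    (∀ i → A i zero ≡ cut k f i) → (∀ i j → A i (suc j) ≡ V i (punchIn k j)) →
    Unitriangular (nextHeight h k) (wInverse k f ⨯ A)
  fixed-line-unitriangular h k f V A un A-zero A-suc zero zero _ =
    ≡.trans (wInverse-zero k f A zero) (≡.trans (A-zero k) (cut-at k f))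
  fixed-line-unitriangular h k f V A un A-zero A-suc zero (suc j) (inj₁ h′≤0) =
    contradiction (ℕₚ.≤-trans (ℕₚ.m≤n⊔m h (suc (toℕ k ⊓ h))) h′≤0) λ ()
  fixed-line-unitriangular h k f V A un A-zero A-suc zero (suc j) (inj₂ ())
  fixed-line-unitriangular h k f V A un A-zero A-suc (suc i) zero _ = begin
    (wInverse k f ⨯ A) (suc i) zero      ≡⟨ wInverse-suc k f A i zero ⟩
    A p zero + - (x * A k zero)          ≡⟨ ≡.cong₂ (λ y z → y + - (x * z)) (A-zero p) (≡.trans (A-zero k) (cut-at k f)) ⟩
    x + - (x * 1#)                       ≡⟨ ≡.cong (λ t → x + - t) (*-identityʳ x) ⟩
    x + - x                              ≡⟨ -‿inverseʳ x ⟩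
    0# ∎
    where
    p = punchIn k i
    x = cut k f p
  fixed-line-unitriangular h k f V A un A-zero A-suc (suc i) (suc j) h′≤i∨j≤i = begin
    (wInverse k f ⨯ A) (suc i) (suc j)   ≡⟨ wInverse-suc k f A i (suc j) ⟩
    A p (suc j) + - (x * A k (suc j))    ≡⟨ ≡.cong₂ (λ y z → y + - (x * z)) (≡.trans (A-suc p j) (proj₁ (entries h′≤i∨j≤i))) (A-suc k j) ⟩
    δ p p′ + - (x * V k p′)              ≡⟨ sub-zero (δ p p′) (proj₂ (entries h′≤i∨j≤i)) ⟩
    δ p p′                               ≡⟨ δ-punchIn k i j ⟩
    δ i j ∎
    where
    p p′ : Fin n
    p = punchIn k i
    p′ = punchIn k j
    x : F.Carrier
    x = cut k f p
    off : h ≤ toℕ k ⊎ toℕ p′ ≤ toℕ k → x * V k p′ ≡ 0#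
    off b = *-zeroʳ m x (≡.trans (un k p′ b) (δ-≢ (Finₚ.punchInᵢ≢i k j ∘ ≡.sym)))
    above : toℕ k < toℕ p → x * V k p′ ≡ 0#
    above k<p = *-zeroˡ m (V k p′) (cut-above k f p k<p)
    entries : nextHeight h k ≤ suc (toℕ i) ⊎ suc (toℕ j) ≤ suc (toℕ i) →
      V p p′ ≡ δ p p′ × x * V k p′ ≡ 0#
    entries (inj₂ j≤i) = un p p′ (inj₂ p′≤p) , rest (toℕ p ℕ.≤? toℕ k)
      where
      p′≤p : toℕ p′ ≤ toℕ p
      p′≤p = Finₚ.punchIn-mono-≤ k j i (s≤s⁻¹ j≤i)
      rest : Dec (toℕ p ≤ toℕ k) → x * V k p′ ≡ 0#
      rest (yes p≤k) = off (inj₂ (ℕₚ.≤-trans p′≤p p≤k))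
      rest (no p≰k) = above (ℕₚ.≰⇒> p≰k)
    -- If h ≤ k then h′ = h + 1, so h ≤ i ≤ p, and rows p and k of V are both trivial. If k < h then
    -- h′ = h, so p = i + 1 lies beyond k and x = 0.
    entries (inj₁ h′≤i) with h ℕ.≤? toℕ k
    ... | yes h≤k = un p p′ (inj₁ (ℕₚ.≤-trans h≤i (j≤punchIn k i))) , off (inj₁ h≤k)
      where
      h≤i : h ≤ toℕ i
      h≤i = s≤s⁻¹ (ℕₚ.≤-trans (s≤s (ℕₚ.≤-reflexive (≡.sym (ℕₚ.m≥n⇒m⊓n≡n h≤k))))
        (ℕₚ.≤-trans (ℕₚ.m≤n⊔m h (suc (toℕ k ⊓ h))) h′≤i))
    ... | no h≰k = un p p′ (inj₁ (≡.subst (h ≤_) (≡.sym p≡) h≤si))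
                 , above (≡.subst (toℕ k <_) (≡.sym p≡) (s≤s k≤i))
      where
      h≤si : h ≤ suc (toℕ i)
      h≤si = ℕₚ.≤-trans (ℕₚ.m≤m⊔n h (suc (toℕ k ⊓ h))) h′≤i
      k≤i : toℕ k ≤ toℕ i
      k≤i = s≤s⁻¹ (ℕₚ.≤-trans (ℕₚ.≰⇒> h≰k) h≤si)
      p≡ : toℕ p ≡ suc (toℕ i)
      p≡ = punchIn-≥ k i k≤i

  module Translate (h : ℕ) (u g : G.Carrier) (un : Unitriangular h (matrix u)) where
    private
      ℓ ℓ′ : Line n
      ℓ = line g
      ℓ′ = line (u G.∙ g)
      k = proj₁ ℓ
      sp = proj₂ (lineData g)
      sp′ = proj₂ (lineData (u G.∙ g))
      open Spans sp renaming (scale to s)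

      uc : Fin n → F.Carrier
      uc i = sum (λ d → matrix u i d * column ℓ d)

      ug : ∀ i → matrix (u G.∙ g) i zero ≡ uc i * s
      ug i = ≡.trans (sum-cong-≗ (λ d → ≡.trans (≡.cong (matrix u i d *_) (scaled d))
        (≡.sym (*-assoc _ _ s)))) (≡.sym (*-distribʳ-sum s (λ d → matrix u i d * column ℓ d)))

      -- The column of ℓ is zero beyond k. For i ≥ k only the entries of row i up to the diagonal
      -- therefore count, and there u agrees with the identity.
      uc-fixed : ∀ i → h ≤ toℕ i ⊎ toℕ k ≤ toℕ i → uc i ≡ column ℓ i
      uc-fixed i h≤i∨k≤i = ≡.trans (sum-cong-≗ (λ d → term d h≤i∨k≤i)) (δ-sum i (column ℓ))
        where
        term : ∀ d → h ≤ toℕ i ⊎ toℕ k ≤ toℕ i → matrix u i d * column ℓ d ≡ δ i d * column ℓ d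
        term d (inj₁ h≤i) = ≡.cong (_* column ℓ d) (un i d (inj₁ h≤i))
        term d (inj₂ k≤i) with toℕ d ℕ.≤? toℕ i
        ... | yes d≤i = ≡.cong (_* column ℓ d) (un i d (inj₂ d≤i))
        ... | no d≰i = ≡.trans (*-zeroʳ m (matrix u i d) e) (≡.sym (*-zeroʳ m (δ i d) e))
          where
          e : column ℓ d ≡ 0#
          e = column-above ℓ d (ℕₚ.≤-<-trans k≤i (ℕₚ.≰⇒> d≰i))

      agree : k ≡ proj₁ ℓ′ × s ≡ Spans.scale sp′
      agree = spans-agree sp sp′ (λ i k≤i → ≡.trans (scaled i)
        (≡.trans (≡.cong (_* s) (≡.sym (uc-fixed i (inj₂ k≤i)))) (≡.sym (ug i))))

      column′ : ∀ i → column ℓ′ i ≡ uc i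
      column′ i = *-cancelʳ s scale≢0 (≡.trans (≡.cong (column ℓ′ i *_) (proj₂ agree))
        (≡.trans (≡.sym (Spans.scaled sp′ i)) (ug i)))

    -- The parameters of the line of u g, transported to length k: `upper h` of two lines can be
    -- compared only over the same k.
    moved : Vec F.Carrier (toℕ k)
    moved = ≡.subst (Vec F.Carrier ∘ toℕ) (≡.sym (proj₁ agree)) (proj₂ ℓ′)

    line-moved : ℓ′ ≡ (k , moved)
    line-moved = go ℓ′ (proj₁ agree)
      where
      go : ∀ (ℓ′ : Line n) (e : k ≡ proj₁ ℓ′) →
        ℓ′ ≡ (k , ≡.subst (Vec F.Carrier ∘ toℕ) (≡.sym e) (proj₂ ℓ′))
      go _ ≡.refl = ≡.refl

    private
      column-moved : ∀ i → column (k , moved) i ≡ uc i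
      column-moved i = ≡.trans (≡.cong (λ ℓ → column ℓ i) (≡.sym line-moved)) (column′ i)

    upper-moved : upper h moved ≡ upper h (proj₂ ℓ)
    upper-moved = upper-cong h k moved (proj₂ ℓ) (λ i h≤i →
      ≡.trans (column-moved i) (uc-fixed i (inj₁ h≤i)))

    stabiliser : G.Carrier
    stabiliser = W (k , moved) G.⁻¹ G.∙ (u G.∙ W ℓ)

    private
      uW-zero : ∀ i → matrix (u G.∙ W ℓ) i zero ≡ uc i
      uW-zero i = sum-cong-≗ (λ d → ≡.cong (matrix u i d *_) (cut-column ℓ d))

      uW-suc : ∀ i j → matrix (u G.∙ W ℓ) i (suc j) ≡ matrix u i (punchIn k j)
      uW-suc i j = ⨯-identityʳ (matrix u) i (punchIn k j)

      c′ : Fin n → F.Carrier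
      c′ = cut k (column (k , moved))

      uc≡c′ : ∀ i → uc i ≡ c′ i
      uc≡c′ i = ≡.trans (≡.sym (column-moved i)) (≡.sym (cut-column (k , moved) i))

    stabiliser-unitriangular : Unitriangular (nextHeight h k) (matrix stabiliser)
    stabiliser-unitriangular = fixed-line-unitriangular h k (column (k , moved)) (matrix u) (matrix (u G.∙ W ℓ)) un
      (λ i → ≡.trans (uW-zero i) (uc≡c′ i)) uW-suc

transpose-left : ∀ {n} (i j : Fin n) → transpose i j ⟨$⟩ʳ i ≡ j
transpose-left i j rewrite dec-true (i Fin.≟ i) ≡.refl = ≡.refl

transpose-right : ∀ {n} (i j : Fin n) → transpose i j ⟨$⟩ʳ j ≡ i
transpose-right i j with j Fin.≟ i
... | yes j≡i = j≡i
... | no _ rewrite dec-true (j Fin.≟ j) ≡.refl = ≡.refl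

transpose-other : ∀ {n} (i j : Fin n) {k} → k ≢ i → k ≢ j → transpose i j ⟨$⟩ʳ k ≡ k
transpose-other i j {k} k≢i k≢j rewrite dec-false (k Fin.≟ i) k≢i | dec-false (k Fin.≟ j) k≢j = ≡.refl

-- One factor s_i(t) applied to a coset representative.

module Steps {q : ℕ} (F : FiniteField q) (m : ℕ) where
  open CommutativeRing (FiniteField.commutativeRing F)
    using (_+_; _*_; 0#; 1#; +-identityˡ; +-identityʳ; *-identityˡ; *-identityʳ;
           *-assoc; zeroˡ; distribʳ; semiring)
  open import Algebra.Properties.Semiring.Sum semiring
    using (sum; sum-cong-≗; *-distribˡ-sum; ∑-distrib-+)
  open Matrices F
  open Lines F
  open Elements F m
  open ≡.≡-Reasoning
  private
    module F = FiniteField F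
    n = suc m
    module G = Group (GL n)

  elementary-⨯ : ∀ {i j : Fin n} → i ≢ j → ∀ t B a b →
    (elementary i j t ⨯ B) a b ≡ B a b + δ a i * (t * B j b)
  elementary-⨯ {i} {j} i≢j t B a b = begin
    sum (λ c → elementary i j t a c * B c b)
      ≡⟨ sum-cong-≗ (λ c → ≡.trans (≡.cong (_* B c b) (elementary-split i≢j t a c))
           (≡.trans (distribʳ (B c b) (δ a c) _) (≡.cong (δ a c * B c b +_)
             (≡.trans (*-assoc (δ a i) _ (B c b)) (≡.cong (δ a i *_) (*-assoc t (δ j c) (B c b))))))) ⟩
    sum (λ c → δ a c * B c b + δ a i * (t * (δ j c * B c b)))
      ≡⟨ ∑-distrib-+ (λ c → δ a c * B c b) (λ c → δ a i * (t * (δ j c * B c b))) ⟩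
    sum (λ c → δ a c * B c b) + sum (λ c → δ a i * (t * (δ j c * B c b)))
      ≡⟨ ≡.cong₂ _+_ (δ-sum a (λ c → B c b))
           (≡.trans (≡.sym (*-distribˡ-sum (δ a i) (λ c → t * (δ j c * B c b))))
             (≡.cong (δ a i *_) (≡.trans (≡.sym (*-distribˡ-sum t (λ c → δ j c * B c b)))
               (≡.cong (t *_) (δ-sum j (λ c → B c b)))))) ⟩
    B a b + δ a i * (t * B j b) ∎

  δ-permute : ∀ (σ : Perm.Permutation′ n) i j → δ i (σ ⟨$⟩ʳ j) ≡ δ (σ ⟨$⟩ˡ i) j
  δ-permute σ i j with σ ⟨$⟩ˡ i Fin.≟ j
  ... | yes ≡.refl = ≡.trans (≡.cong (δ i) (Perm.inverseʳ σ)) (δ-refl i)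
  ... | no ne = δ-≢ {i = i} {σ ⟨$⟩ʳ j} (λ { ≡.refl → ne (Perm.inverseˡ σ) })

  permutation-⨯ : ∀ (σ : Perm.Permutation′ n) B a b →
    ((λ i j → δ i (σ ⟨$⟩ʳ j)) ⨯ B) a b ≡ B (σ ⟨$⟩ˡ a) b
  permutation-⨯ σ B a b = ≡.trans (sum-cong-≗ (λ c → ≡.cong (_* B c b) (δ-permute σ a c)))
    (δ-sum (σ ⟨$⟩ˡ a) (λ c → B c b))

  module _ (i : Fin m) where
    private
      a b : Fin n
      a = inject₁ i
      b = suc i
      toℕ-a : toℕ a ≡ toℕ i
      toℕ-a = Finₚ.toℕ-inject₁ i
      a≢b : a ≢ b
      a≢b e = ℕₚ.1+n≢n (≡.sym (≡.trans (≡.sym toℕ-a) (≡.cong toℕ e)))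
      σ = transpose a b

    -- As a and b are neighbours, exchanging them turns the increasing list of the indices other
    -- than a into that of the indices other than b.
    punchIn-transpose : ∀ j → punchIn b j ≡ σ ⟨$⟩ʳ punchIn a j
    punchIn-transpose j with ℕₚ.<-cmp (toℕ j) (toℕ i)
    ... | tri< j<i _ _ = Finₚ.toℕ-injective (begin
        toℕ (punchIn b j)             ≡⟨ punchIn-< b j (ℕₚ.m<n⇒m<1+n j<i) ⟩
        toℕ j                         ≡⟨ a-case ⟨
        toℕ (punchIn a j)             ≡⟨ ≡.cong toℕ (transpose-other a b (Finₚ.punchInᵢ≢i a j) (λ e →
                                           ℕₚ.<⇒≢ (ℕₚ.m<n⇒m<1+n j<i) (≡.trans (≡.sym a-case) (≡.cong toℕ e)))) ⟨
        toℕ (σ ⟨$⟩ʳ punchIn a j) ∎)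
      where
      a-case = punchIn-< a j (≡.subst (toℕ j <_) (≡.sym toℕ-a) j<i)
    ... | tri≈ _ j≡i _ = begin
        punchIn b j             ≡⟨ Finₚ.toℕ-injective (≡.trans (punchIn-< b j (s≤s (ℕₚ.≤-reflexive j≡i)))
                                     (≡.trans j≡i (≡.sym toℕ-a))) ⟩
        a                       ≡⟨ transpose-right a b ⟨
        σ ⟨$⟩ʳ b                ≡⟨ ≡.cong (σ ⟨$⟩ʳ_) (Finₚ.toℕ-injective (≡.trans
                                     (punchIn-≥ a j (ℕₚ.≤-reflexive (≡.trans toℕ-a (≡.sym j≡i)))) (≡.cong suc j≡i))) ⟨
        σ ⟨$⟩ʳ punchIn a j ∎
    ... | tri> _ _ i<j = Finₚ.toℕ-injective (begin
        toℕ (punchIn b j)             ≡⟨ punchIn-≥ b j i<j ⟩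
        suc (toℕ j)                   ≡⟨ a-case ⟨
        toℕ (punchIn a j)             ≡⟨ ≡.cong toℕ (transpose-other a b (Finₚ.punchInᵢ≢i a j) (λ e →
                                           ℕₚ.<⇒≢ i<j (ℕₚ.suc-injective (≡.trans (≡.cong toℕ (≡.sym e)) a-case)))) ⟨
        toℕ (σ ⟨$⟩ʳ punchIn a j) ∎)
      where
      a-case = punchIn-≥ a j (≡.subst (_≤ toℕ j) (≡.sym toℕ-a) (ℕₚ.<⇒≤ i<j))

    -- s_i carries the leading 1 of the first column from row a to row b and leaves 0 in row a; the
    -- row operation then adds t times row b to row a. In the other columns that row b is zero,
    -- being row a of `wMatrix a f`, so only the first column gains an entry.
    s-wMatrix : ∀ t f → f a ≡ t → matrix (s⟨ i ⟩ t) ⨯ wMatrix a f ≐ wMatrix b f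
    s-wMatrix t f fa r j = ≡.trans (⨯-assoc (elementary a b t) S A r j)
      (≡.trans (elementary-⨯ a≢b t (S ⨯ A) r j)
      (≡.trans (≡.cong₂ (λ x y → x + δ r a * (t * y)) (permutation-⨯ σ A r j)
         (≡.trans (permutation-⨯ σ A b j) (≡.cong (λ c → A c j) (transpose-left b a))))
      (entry j)))
      where
      A S : Matrix n
      A = wMatrix a f
      S = λ i j → δ i (σ ⟨$⟩ʳ j)
      r-case : Dec (r ≡ a) → Dec (r ≡ b) → cut a f (σ ⟨$⟩ˡ r) + δ r a * t ≡ cut b f r
      r-case (yes ≡.refl) _ = begin
        cut a f (σ ⟨$⟩ˡ a) + δ a a * t  ≡⟨ ≡.cong₂ (λ x y → cut a f x + y * t) (transpose-right b a) (δ-refl a) ⟩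
        cut a f b + 1# * t              ≡⟨ ≡.cong₂ _+_ (cut-above a f b (s≤s (ℕₚ.≤-reflexive toℕ-a))) (*-identityˡ t) ⟩
        0# + t                          ≡⟨ +-identityˡ t ⟩
        t                               ≡⟨ fa ⟨
        f a                             ≡⟨ cut-below b f a (s≤s (ℕₚ.≤-reflexive toℕ-a)) ⟨
        cut b f a ∎
      r-case (no _) (yes ≡.refl) = begin
        cut a f (σ ⟨$⟩ˡ b) + δ b a * t  ≡⟨ ≡.cong₂ (λ x y → cut a f x + y * t) (transpose-left b a) (δ-≢ (a≢b ∘ ≡.sym)) ⟩
        cut a f a + 0# * t              ≡⟨ ≡.cong₂ _+_ (cut-at a f) (zeroˡ t) ⟩
        1# + 0#                         ≡⟨ +-identityʳ 1# ⟩
        1#                              ≡⟨ cut-at b f ⟨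
        cut b f b ∎
      r-case (no r≢a) (no r≢b) = begin
        cut a f (σ ⟨$⟩ˡ r) + δ r a * t  ≡⟨ ≡.cong₂ (λ x y → cut a f x + y * t) (transpose-other b a r≢b r≢a) (δ-≢ r≢a) ⟩
        cut a f r + 0# * t              ≡⟨ ≡.trans (≡.cong (cut a f r +_) (zeroˡ t)) (+-identityʳ _) ⟩
        cut a f r                       ≡⟨ away (ℕₚ.<-cmp (toℕ r) (toℕ i)) ⟩
        cut b f r ∎
        where
        away : _ → cut a f r ≡ cut b f r
        away (tri< r<i _ _) = ≡.trans (cut-below a f r (≡.subst (toℕ r <_) (≡.sym toℕ-a) r<i))
          (≡.sym (cut-below b f r (ℕₚ.m<n⇒m<1+n r<i)))
        away (tri≈ _ r≡i _) = contradiction (Finₚ.toℕ-injective (≡.trans r≡i (≡.sym toℕ-a))) r≢a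
        away (tri> _ _ i<r) = ≡.trans (cut-above a f r (≡.subst (_< toℕ r) (≡.sym toℕ-a) i<r))
          (≡.sym (cut-above b f r (ℕₚ.≤∧≢⇒< i<r (λ e → r≢b (Finₚ.toℕ-injective (≡.sym e))))))
      entry : ∀ j → A (σ ⟨$⟩ˡ r) j + δ r a * (t * A a j) ≡ wMatrix b f r j
      entry zero = ≡.trans (≡.cong (λ x → cut a f (σ ⟨$⟩ˡ r) + δ r a * x)
          (≡.trans (≡.cong (t *_) (cut-at a f)) (*-identityʳ t)))
        (r-case (r Fin.≟ a) (r Fin.≟ b))
      entry (suc j) = begin
        δ (σ ⟨$⟩ˡ r) (punchIn a j) + δ r a * (t * δ a (punchIn a j))
          ≡⟨ ≡.cong₂ _+_ (≡.sym (δ-permute σ r (punchIn a j)))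
               (*-zeroʳ m (δ r a) (*-zeroʳ m t (δ-≢ (Finₚ.punchInᵢ≢i a j ∘ ≡.sym)))) ⟩
        δ r (σ ⟨$⟩ʳ punchIn a j) + 0#
          ≡⟨ ≡.trans (+-identityʳ _) (≡.cong (δ r) (≡.sym (punchIn-transpose j))) ⟩
        δ r (punchIn b j) ∎

  wMatrix-zero : ∀ f → wMatrix zero f ≐ δ
  wMatrix-zero f zero zero = ≡.refl
  wMatrix-zero f (suc i) zero = ≡.refl
  wMatrix-zero f i (suc j) = ≡.refl

-- The element w as a mean of coset representatives.

module Expansion (k : CommutativeRing 0ℓ 0ℓ)
  (recip : (j : ℕ) .{{_ : NonZero j}} → CommutativeRing.Carrier k)
  {q : ℕ} (F : FiniteField q) (m : ℕ) (G : Group 0ℓ 0ℓ)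
  (step : Fin m → FiniteField.Carrier F → Group.Carrier G)
  (descending : ∀ l {c} → Vec (FiniteField.Carrier F) c → l ℕ.+ c ≤ m → GroupAlgebra.FormalSum k G)
  (V : Fin (suc m) → (Fin (suc m) → FiniteField.Carrier F) → Group.Carrier G) where
  open Lines F
  private
    module kG = GroupAlgebra k G
    module F = FiniteField F
    module k = CommutativeRing k
    n = suc m
    module G = Group G
  open kG using (FormalSum; gen; _⊛_; _·_; _≋_; gen-cong; ·-cong; refl; sym; trans)
  open Ring kG.groupAlgebra using (reflexive)
  open import Algebra.Properties.CommutativeMonoid.Sum (Ring.+-commutativeMonoid kG.groupAlgebra)
    using (sum; sum-cong-≋)

  ⊛-sum : ∀ x {N} (y : Fin N → FormalSum) → x ⊛ sum y ≋ sum (λ i → x ⊛ y i)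
  ⊛-sum x {zero} y = kG.⊛-zeroʳ x
  ⊛-sum x {suc N} y = trans (kG.⊛-distribˡ x (y zero) (sum (y ∘ suc))) (kG.⊕-cong refl (⊛-sum x (y ∘ suc)))

  module _
    (descending-[] : ∀ l l+0≤m → descending l [] l+0≤m ≡ gen G.ε)
    (descending-∷ : ∀ l {c} a (as : Vec F.Carrier c) l+c≤m → descending l (a ∷ as) l+c≤m
      ≋ descending (suc l) as (≡.subst (_≤ m) (ℕₚ.+-suc l c) l+c≤m)
        ⊛ gen (step (fromℕ< (ℕₚ.m+n≤o⇒m≤o (suc l) (≡.subst (_≤ m) (ℕₚ.+-suc l c) l+c≤m))) a))
    (V-zero : ∀ f → V zero f G.≈ G.ε)
    (V-suc : ∀ i f t → f (inject₁ i) ≡ t → step i t G.∙ V (inject₁ i) f G.≈ V (suc i) f)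
    where

    -- The head of `a` belongs to the rightmost factor, so it acts first: each factor raises κ by
    -- one, while `f` stays fixed and supplies the entry that the factor inserts.
    descending-V : ∀ l {c} (a : Vec F.Carrier c) l+c≤m f (κ κ′ : Fin n) → toℕ κ ≡ l → toℕ κ′ ≡ l ℕ.+ c →
      (∀ i j → toℕ j ≡ l ℕ.+ toℕ i → f j ≡ lookup a i) →
      descending l a l+c≤m ⊛ gen (V κ f) ≋ gen (V κ′ f)
    descending-V l [] l≤m f κ κ′ κ≡l κ′≡l _
      with ≡.refl ← Finₚ.toℕ-injective (≡.trans κ≡l (≡.sym (≡.trans κ′≡l (ℕₚ.+-identityʳ l))))
      = trans (kG.⊛-cong {y = gen (V κ f)} (reflexive (descending-[] l l≤m)) refl) (kG.⊛-identityˡ (gen (V κ f)))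
    descending-V l {suc c} (a ∷ as) l+c≤m f κ κ′ κ≡l κ′≡ e
      = trans (kG.⊛-cong {y = gen (V κ f)} (descending-∷ l a as l+c≤m) refl) (trans
      (kG.⊛-assoc D (gen (step i a)) (gen (V κ f)))
      (trans (kG.⊛-cong {D} refl (gen-cong advance))
        (descending-V (suc l) as 1+l+c≤m f (suc i) κ′ (≡.cong suc toℕ-i) (≡.trans κ′≡ (ℕₚ.+-suc l c))
          (λ i j p → e (suc i) j (≡.trans p (≡.sym (ℕₚ.+-suc l (toℕ i))))))))
      where
      1+l+c≤m : suc l ℕ.+ c ≤ m
      1+l+c≤m = ≡.subst (_≤ m) (ℕₚ.+-suc l c) l+c≤m
      D : FormalSum
      D = descending (suc l) as 1+l+c≤m
      i : Fin m
      i = fromℕ< (ℕₚ.m+n≤o⇒m≤o (suc l) 1+l+c≤m)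
      toℕ-i : toℕ i ≡ l
      toℕ-i = Finₚ.toℕ-fromℕ< (ℕₚ.m+n≤o⇒m≤o (suc l) 1+l+c≤m)
      κ≡i : κ ≡ inject₁ i
      κ≡i = Finₚ.toℕ-injective (≡.trans κ≡l (≡.trans (≡.sym toℕ-i) (≡.sym (Finₚ.toℕ-inject₁ i))))
      advance : step i a G.∙ V κ f G.≈ V (suc i) f
      advance = ≡.subst (λ κ → step i a G.∙ V κ f G.≈ V (suc i) f) (≡.sym κ≡i)
        (V-suc i f a (e zero (inject₁ i) (≡.trans (Finₚ.toℕ-inject₁ i) (≡.trans toℕ-i (≡.sym (ℕₚ.+-identityʳ l))))))

    -- The inner product climbs from V zero, the identity, to V κ*, and the outer one continues to V
    -- κ. A single column, with b before position κ* and a from there to κ, serves both stages.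
    w-expansion : ∀ h (κ : Fin n) (κ*≤κ : toℕ κ ⊓ h ≤ toℕ κ) a p p′ →
      descending (toℕ κ ⊓ h) a p ⊛ (recip (q ^ (toℕ κ ⊓ h)) {{ℕₚ.m^n≢0 q (toℕ κ ⊓ h)}}
        · sum (λ i → descending 0 (Inverse.to (F.enumerateVec (toℕ κ ⊓ h)) i) p′))
      ≋ recip (q ^ (toℕ κ ⊓ h)) {{ℕₚ.m^n≢0 q (toℕ κ ⊓ h)}}
        · sum (λ i → gen (V κ (column (κ , join h (Inverse.to (F.enumerateVec (toℕ κ ⊓ h)) i) a))))
    w-expansion h κ κ*≤κ a p p′ = trans (kG.⊛-· r x (sum y))
      (·-cong k.refl (trans (⊛-sum x y) (sum-cong-≋ term)))
      where
      κ* = toℕ κ ⊓ h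
      r = recip (q ^ κ*) {{ℕₚ.m^n≢0 q κ*}}
      κ≤m = Finₚ.toℕ≤pred[n] κ
      x = descending κ* a p
      b : Fin (q ^ κ*) → Vec F.Carrier κ*
      b = Inverse.to (F.enumerateVec κ*)
      y : Fin (q ^ κ*) → FormalSum
      y i = descending 0 (b i) p′
      term : ∀ i → x ⊛ y i ≋ gen (V κ (column (κ , join h (b i) a)))
      term i = trans (kG.⊛-cong {x} refl (trans (sym (kG.⊛-identityʳ (y i)))
          (trans (kG.⊛-cong {y i} refl (gen-cong (G.sym (V-zero f))))
            (descending-V 0 (b i) p′ f zero κ*′ ≡.refl toℕ-κ*′
              (λ i′ j e → lookup-join-below h κ (b i) a i′ j e)))))
        (descending-V κ* a p f κ*′ κ toℕ-κ*′ (≡.sym (ℕₚ.m+[n∸m]≡n κ*≤κ))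
          (λ i′ j e → lookup-join-above h κ (b i) a i′ j e))
        where
        f = column (κ , join h (b i) a)
        κ*<n : κ* < n
        κ*<n = s≤s (ℕₚ.≤-trans κ*≤κ κ≤m)
        κ*′ : Fin n
        κ*′ = fromℕ< κ*<n
        toℕ-κ*′ : toℕ κ*′ ≡ κ*
        toℕ-κ*′ = Finₚ.toℕ-fromℕ< κ*<n

module ConcreteExpansion (k : CommutativeRing 0ℓ 0ℓ)
  (recip : (j : ℕ) .{{_ : NonZero j}} → CommutativeRing.Carrier k)
  {q : ℕ} (F : FiniteField q) (m : ℕ) where
  open IteratedIR k recip F m
  open Matrices F using (GL; s⟨_⟩)
  open Lines F
  open Elements F m
  open Steps F m
  open kG using (gen; _·_; _≋_)
  private
    module F = FiniteField F
    n = suc m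
    module G = Group (GL n)
    open import Algebra.Properties.CommutativeMonoid.Sum (Ring.+-commutativeMonoid kG.groupAlgebra)
      using (sum)
    open kG.LinearExtension kG.freeModule using (extend-≗)
    module E = Expansion k recip F m (GL n) s⟨_⟩ descending wElement

  private
    descending-[] : ∀ l l≤m → descending l [] l≤m ≡ gen G.ε
    descending-[] _ _ = ≡.refl

    s-wElement : ∀ i f t → f (inject₁ i) ≡ t → s⟨ i ⟩ t G.∙ wElement (inject₁ i) f G.≈ wElement (suc i) f
    s-wElement i f t = s-wMatrix i t f

    wElement-zero : ∀ f → wElement zero f G.≈ G.ε
    wElement-zero = wMatrix-zero

  w-average : ∀ h (κ : Fin n) (κ*≤κ : toℕ κ ⊓ h ≤ toℕ κ) a →
    w κ (toℕ κ ⊓ h) κ*≤κ a ≋ recip (q ^ (toℕ κ ⊓ h)) {{ℕₚ.m^n≢0 q (toℕ κ ⊓ h)}}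
      · sum (λ i → gen (wElement κ (column (κ , join h (Inverse.to (F.enumerateVec (toℕ κ ⊓ h)) i) a))))
  w-average h κ κ*≤κ a = E.w-expansion descending-[]
    -- Both sides are convertible; going through the matrix entries avoids a conversion check
    -- on the invertibility proofs that does not finish in reasonable time.
    (λ l {c} a as l+c≤m → extend-≗ (λ g → kG.gen-cong (λ i j → ≡.refl))
      (descending (suc l) as (≡.subst (_≤ m) (ℕₚ.+-suc l c) l+c≤m)))
    wElement-zero s-wElement h κ κ*≤κ a
    (≡.subst (_≤ m) (≡.sym (ℕₚ.m+[n∸m]≡n κ*≤κ)) (Finₚ.toℕ≤pred[n] κ))
    (ℕₚ.≤-trans κ*≤κ (Finₚ.toℕ≤pred[n] κ))

-- Linear maps, dual families and bases.

record LinearMap {R : Ring 0ℓ 0ℓ} (M N : LeftModule R 0ℓ 0ℓ) : Set where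
  private
    module R = Ring R
    module M = LeftModule M
    module N = LeftModule N
  field
    ⟦_⟧     : M.Carrierᴹ → N.Carrierᴹ
    ⟦⟧-cong : ∀ {x y} → x M.≈ᴹ y → ⟦ x ⟧ N.≈ᴹ ⟦ y ⟧
    +-homo  : ∀ x y → ⟦ x M.+ᴹ y ⟧ N.≈ᴹ ⟦ x ⟧ N.+ᴹ ⟦ y ⟧
    *-homo  : ∀ r x → ⟦ r M.*ₗ x ⟧ N.≈ᴹ r N.*ₗ ⟦ x ⟧

  open import Algebra.Module.Properties.LeftModule N using (inverseˡ-uniqueᴹ)
  open import Algebra.Properties.CommutativeMonoid.Sum M.+ᴹ-commutativeMonoid using () renaming (sum to sumM)
  open import Algebra.Properties.CommutativeMonoid.Sum N.+ᴹ-commutativeMonoid using () renaming (sum to sumN)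

  0-homo : ⟦ M.0ᴹ ⟧ N.≈ᴹ N.0ᴹ
  0-homo = N.≈ᴹ-trans (⟦⟧-cong (M.≈ᴹ-sym (M.*ₗ-zeroˡ M.0ᴹ)))
    (N.≈ᴹ-trans (*-homo R.0# M.0ᴹ) (N.*ₗ-zeroˡ ⟦ M.0ᴹ ⟧))

  -‿homo : ∀ x → ⟦ M.-ᴹ x ⟧ N.≈ᴹ N.-ᴹ ⟦ x ⟧
  -‿homo x = inverseˡ-uniqueᴹ ⟦ M.-ᴹ x ⟧ ⟦ x ⟧ (N.≈ᴹ-trans (N.≈ᴹ-sym (+-homo (M.-ᴹ x) x))
    (N.≈ᴹ-trans (⟦⟧-cong (M.-ᴹ‿inverseˡ x)) 0-homo))

  sum-homo : ∀ {n} (f : Fin n → M.Carrierᴹ) → ⟦ sumM f ⟧ N.≈ᴹ sumN (λ i → ⟦ f i ⟧)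
  sum-homo {zero} f = 0-homo
  sum-homo {suc n} f = N.≈ᴹ-trans (+-homo (f zero) (sumM (f ∘ suc))) (N.+ᴹ-congˡ (sum-homo (f ∘ suc)))

open LinearMap

infixr 9 _∘ₗ_
_∘ₗ_ : ∀ {R : Ring 0ℓ 0ℓ} {L M N : LeftModule R 0ℓ 0ℓ} → LinearMap M N → LinearMap L M → LinearMap L N
_∘ₗ_ {N = N} φ ψ = record
  { ⟦_⟧ = λ x → ⟦ φ ⟧ (⟦ ψ ⟧ x)
  ; ⟦⟧-cong = λ e → ⟦⟧-cong φ (⟦⟧-cong ψ e)
  ; +-homo = λ x y → ≈ᴹ-trans (⟦⟧-cong φ (+-homo ψ x y)) (+-homo φ (⟦ ψ ⟧ x) (⟦ ψ ⟧ y))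
  ; *-homo = λ r x → ≈ᴹ-trans (⟦⟧-cong φ (*-homo ψ r x)) (*-homo φ r (⟦ ψ ⟧ x))
  }
  where open LeftModule N

idₗ : ∀ {R : Ring 0ℓ 0ℓ} (M : LeftModule R 0ℓ 0ℓ) → LinearMap M M
idₗ M = record { ⟦_⟧ = id ; ⟦⟧-cong = id ; +-homo = λ _ _ → ≈ᴹ-refl ; *-homo = λ _ _ → ≈ᴹ-refl }
  where open LeftModule M

0ₗ : ∀ {R : Ring 0ℓ 0ℓ} (M N : LeftModule R 0ℓ 0ℓ) → LinearMap M N
0ₗ M N = record
  { ⟦_⟧ = λ _ → 0ᴹ ; ⟦⟧-cong = λ _ → ≈ᴹ-refl
  ; +-homo = λ _ _ → ≈ᴹ-sym (+ᴹ-identityˡ 0ᴹ) ; *-homo = λ r _ → ≈ᴹ-sym (*ₗ-zeroʳ r) }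
  where open LeftModule N

module Bases (k : CommutativeRing 0ℓ 0ℓ) where
  private
    module k = CommutativeRing k

  scalars : LeftModule k.ring 0ℓ 0ℓ
  scalars = TensorUnit.leftModule {R = k.ring}

  Functional : LeftModule k.ring 0ℓ 0ℓ → Set
  Functional V = LinearMap V scalars

  module _ {V : LeftModule k.ring 0ℓ 0ℓ} where
    open LeftModule V
    open LinearAlgebra k V
    open import Algebra.Properties.CommutativeMonoid.Sum +ᴹ-commutativeMonoid using (sum)

    expansion : ∀ {W : LeftModule k.ring 0ℓ 0ℓ} {N} → (Fin N → Functional W) → (Fin N → Carrierᴹ) → LinearMap W V
    expansion {W} {N} φ y = record
      { ⟦_⟧ = λ x → sum (λ i → ⟦ φ i ⟧ x *ₗ y i)
      ; ⟦⟧-cong = λ e → sum-cong-≋ (λ i → *ₗ-congʳ (⟦⟧-cong (φ i) e))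
      ; +-homo = λ x x′ → ≈ᴹ-trans (sum-cong-≋ (λ i → ≈ᴹ-trans (*ₗ-congʳ (+-homo (φ i) x x′))
          (*ₗ-distribʳ (y i) _ _))) (∑-distrib-+ (λ i → ⟦ φ i ⟧ x *ₗ y i) (λ i → ⟦ φ i ⟧ x′ *ₗ y i))
      ; *-homo = λ r x → ≈ᴹ-trans (sum-cong-≋ (λ i → ≈ᴹ-trans (*ₗ-congʳ (*-homo (φ i) r x)) (*ₗ-assoc r _ (y i))))
          (scale r (λ i → ⟦ φ i ⟧ x *ₗ y i))
      }
      where
      open import Algebra.Properties.CommutativeMonoid.Sum +ᴹ-commutativeMonoid using (sum-cong-≋; ∑-distrib-+)
      scale : ∀ r {n} (f : Fin n → Carrierᴹ) → sum (λ i → r *ₗ f i) ≈ᴹ r *ₗ sum f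
      scale r {zero} f = ≈ᴹ-sym (*ₗ-zeroʳ r)
      scale r {suc n} f = ≈ᴹ-trans (+ᴹ-congˡ (scale r (f ∘ suc))) (≈ᴹ-sym (*ₗ-distribˡ r (f zero) (sum (f ∘ suc))))

    sum-single : ∀ {n} (f : Fin n → Carrierᴹ) j → (∀ i → i ≢ j → f i ≈ᴹ 0ᴹ) → sum f ≈ᴹ f j
    sum-single f zero e = ≈ᴹ-trans (+ᴹ-congˡ (zeros (f ∘ suc) (λ i → e (suc i) λ ()))) (+ᴹ-identityʳ (f zero))
      where
      zeros : ∀ {n} (f : Fin n → Carrierᴹ) → (∀ i → f i ≈ᴹ 0ᴹ) → sum f ≈ᴹ 0ᴹ
      zeros {zero} f e = ≈ᴹ-refl
      zeros {suc n} f e = ≈ᴹ-trans (+ᴹ-cong (e zero) (zeros (f ∘ suc) (e ∘ suc))) (+ᴹ-identityˡ 0ᴹ)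
    sum-single f (suc j) e = ≈ᴹ-trans (+ᴹ-cong (e zero λ ()) (sum-single (f ∘ suc) j
      (λ i i≢j → e (suc i) (λ { ≡.refl → i≢j ≡.refl })))) (+ᴹ-identityˡ (f (suc j)))

    module _ {I : Set} (v : I → Carrierᴹ) (τ : I → Functional V)
      (dual : ∀ i → ⟦ τ i ⟧ (v i) k.≈ k.1#) (dual-≢ : ∀ i j → i ≢ j → ⟦ τ i ⟧ (v j) k.≈ k.0#) where

      private
        head-zero : ∀ i j x c → i ≢ j → ⟦ τ i ⟧ (c *ₗ v j +ᴹ x) k.≈ ⟦ τ i ⟧ x
        head-zero i j x c i≢j = k.trans (+-homo (τ i) (c *ₗ v j) x) (k.trans (k.+-congʳ
          (k.trans (*-homo (τ i) c (v j)) (k.trans (k.*-congˡ (dual-≢ i j i≢j)) (k.zeroʳ c)))) (k.+-identityˡ _))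

        coordinate-∉ : ∀ c i is → Allᴸ.All (i ≢_) is → ⟦ τ i ⟧ (combination v c is) k.≈ k.0#
        coordinate-∉ c i [] _ = 0-homo (τ i)
        coordinate-∉ c i (j ∷ is) (i≢j Allᴸ.∷ i∉is) =
          k.trans (head-zero i j (combination v c is) (c j) i≢j) (coordinate-∉ c i is i∉is)

        coordinate : ∀ c {i is} → Unique is → i ∈ is → ⟦ τ i ⟧ (combination v c is) k.≈ c i
        coordinate c {i} {_ ∷ is} (i∉is ∷ u) (here ≡.refl) = k.trans (+-homo (τ i) (c i *ₗ v i) (combination v c is))
          (k.trans (k.+-cong (k.trans (*-homo (τ i) (c i) (v i)) (k.trans (k.*-congˡ (dual i)) (k.*-identityʳ (c i))))
            (coordinate-∉ c i is i∉is)) (k.+-identityʳ (c i)))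
        coordinate c {i} {j ∷ is} (j∉is ∷ u) (there i∈is) =
          k.trans (head-zero i j (combination v c is) (c j) (λ { ≡.refl → Allᴸ.lookup j∉is i∈is ≡.refl }))
            (coordinate c u i∈is)

      independent-dual : LinearlyIndependent v
      independent-dual is u c e {i} i∈is = k.trans (k.sym (coordinate c u i∈is))
        (k.trans (⟦⟧-cong (τ i) e) (0-homo (τ i)))

      module _ {N} (enum : Fin N ↔ I) (S : Carrierᴹ → Set) where
        open Inverse enum using (to)

        private
          combination-tabulate : ∀ c {n} (t : Fin n → I) →
            sum (λ j → c (t j) *ₗ v (t j)) ≈ᴹ combination v c (List.tabulate t)
          combination-tabulate c {zero} t = ≈ᴹ-refl
          combination-tabulate c {suc n} t = +ᴹ-congˡ (combination-tabulate c (t ∘ suc))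

        dual-basis : (∀ i → S (v i)) →
          (∀ x → S x → Σ (I → k.Carrier) λ c → x ≈ᴹ sum (λ j → c (to j) *ₗ v (to j))) →
          IsBasisOf S v
        dual-basis members spanning = record
          { members = members
          ; independent = independent-dual
          ; spanning = λ x s → let c , e = spanning x s in
              List.tabulate to , c , ≈ᴹ-trans e (combination-tabulate c to)
          }

    dual-basis-Fin : ∀ {I : Set} (v : I → Carrierᴹ) (τ : I → Functional V) →
      (∀ i → ⟦ τ i ⟧ (v i) k.≈ k.1#) → (∀ i j → i ≢ j → ⟦ τ i ⟧ (v j) k.≈ k.0#) →
      ∀ {N} (enum : Fin N ↔ I) (S : Carrierᴹ → Set) → (∀ i → S (v i)) →
      (∀ x → S x → Σ (I → k.Carrier) λ c → x ≈ᴹ sum (λ j → c (Inverse.to enum j) *ₗ v (Inverse.to enum j))) →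
      IsBasisOf S (v ∘ Inverse.to enum)
    dual-basis-Fin v τ dual dual-≢ enum S members spanning =
      dual-basis (v ∘ to) (τ ∘ to) (dual ∘ to) (λ i j i≢j → dual-≢ (to i) (to j) (i≢j ∘ injective enum)) ↔-refl S
        (members ∘ to) (λ x s → let c , e = spanning x s in c ∘ to , e)
      where
      open Inverse enum using (to)
      injective : ∀ {A B : Set} (f : A ↔ B) {x y} → Inverse.to f x ≡ Inverse.to f y → x ≡ y
      injective f e = ≡.trans (≡.sym (strictlyInverseʳ _)) (≡.trans (≡.cong from e) (strictlyInverseʳ _))
        where open Inverse f using (from; strictlyInverseʳ)

-- Group modules over k, and linear maps at means.

module GroupAction (k : CommutativeRing 0ℓ 0ℓ)
  (recip : (j : ℕ) .{{_ : NonZero j}} → CommutativeRing.Carrier k)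
  (G : Group 0ℓ 0ℓ) where
  private
    module k = CommutativeRing k
    module G = Group G
    module kG = GroupAlgebra k G
  open kG using (gen; _⊛_; _⊕_; 𝟎; _·_; _≋_; FormalSum)
  open import Algebra.Properties.CommutativeMonoid.Sum (Ring.+-commutativeMonoid kG.groupAlgebra) using (sum)
  open import Algebra.Properties.Monoid.Mult k.+-monoid using () renaming (_×_ to _×ℕ_)

  restrict : LeftModule kG.groupAlgebra 0ℓ 0ℓ → LeftModule k.ring 0ℓ 0ℓ
  restrict = restrictScalars {R = k.ring} {S = kG.groupAlgebra} kG.scalar

  scalar-⊛ : ∀ r a → (r · gen G.ε) ⊛ a ≋ r · a
  scalar-⊛ r a = kG.·-cong k.refl (kG.⊛-identityˡ a)

  ⊛-scalar : ∀ r a → a ⊛ (r · gen G.ε) ≋ r · a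
  ⊛-scalar r a = kG.trans (kG.⊛-· r a (gen G.ε)) (kG.·-cong k.refl (kG.⊛-identityʳ a))

  scalar-central : ∀ r a → (r · gen G.ε) ⊛ a ≋ a ⊛ (r · gen G.ε)
  scalar-central r a = kG.trans (scalar-⊛ r a) (kG.sym (⊛-scalar r a))

  orbit : ∀ M → LeftModule.Carrierᴹ M → LinearMap kG.freeModule (restrict M)
  orbit M x = record
    { ⟦_⟧ = λ a → a *ₗ x
    ; ⟦⟧-cong = *ₗ-congʳ
    ; +-homo = λ a b → *ₗ-distribʳ x a b
    ; *-homo = λ r a → ≈ᴹ-trans (*ₗ-congʳ (kG.sym (scalar-⊛ r a))) (*ₗ-assoc (r · gen G.ε) a x)
    }
    where open LeftModule M

  act : ∀ M → FormalSum → LinearMap (restrict M) (restrict M)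
  act M a = record
    { ⟦_⟧ = λ x → a *ₗ x
    ; ⟦⟧-cong = *ₗ-congˡ
    ; +-homo = *ₗ-distribˡ a
    ; *-homo = λ r x → ≈ᴹ-trans (≈ᴹ-sym (*ₗ-assoc a (r · gen G.ε) x))
        (≈ᴹ-trans (*ₗ-congʳ (kG.sym (scalar-central r a))) (*ₗ-assoc (r · gen G.ε) a x))
    }
    where open LeftModule M

  module _ {N : LeftModule k.ring 0ℓ 0ℓ} where
    open LeftModule N

    gen-ext : (φ ψ : LinearMap kG.freeModule N) → (∀ g → ⟦ φ ⟧ (gen g) ≈ᴹ ⟦ ψ ⟧ (gen g)) → ∀ a → ⟦ φ ⟧ a ≈ᴹ ⟦ ψ ⟧ a
    gen-ext φ ψ e (gen g) = e g
    gen-ext φ ψ e (a ⊕ b) = ≈ᴹ-trans (+-homo φ a b)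
      (≈ᴹ-trans (+ᴹ-cong (gen-ext φ ψ e a) (gen-ext φ ψ e b)) (≈ᴹ-sym (+-homo ψ a b)))
    gen-ext φ ψ e 𝟎 = ≈ᴹ-trans (0-homo φ) (≈ᴹ-sym (0-homo ψ))
    gen-ext φ ψ e (r · a) = ≈ᴹ-trans (*-homo φ r a)
      (≈ᴹ-trans (*ₗ-congˡ (gen-ext φ ψ e a)) (≈ᴹ-sym (*-homo ψ r a)))

    -- Both e_U and the mean inside w are evaluated through this lemma, with φ an orbit map or a
    -- tensor map followed by an invariant map.
    average-constant : (φ : LinearMap kG.freeModule N) (y : Carrierᴹ) (n : ℕ) .{{_ : NonZero n}} →
      recip n k.* (n ×ℕ k.1#) k.≈ k.1# → (g : Fin n → G.Carrier) →
      (∀ i → ⟦ φ ⟧ (gen (g i)) ≈ᴹ y) → ⟦ φ ⟧ (recip n · sum (λ i → gen (g i))) ≈ᴹ y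
    average-constant φ y n inv g e = ≈ᴹ-trans (*-homo φ (recip n) _) (≈ᴹ-trans (*ₗ-congˡ (constant n g e))
      (≈ᴹ-trans (≈ᴹ-sym (*ₗ-assoc (recip n) (n ×ℕ k.1#) y)) (≈ᴹ-trans (*ₗ-congʳ inv) (*ₗ-identityˡ y))))
      where
      constant : ∀ n (g : Fin n → G.Carrier) → (∀ i → ⟦ φ ⟧ (gen (g i)) ≈ᴹ y) →
        ⟦ φ ⟧ (sum (λ i → gen (g i))) ≈ᴹ (n ×ℕ k.1#) *ₗ y
      constant zero g e = ≈ᴹ-trans (0-homo φ) (≈ᴹ-sym (*ₗ-zeroˡ y))
      constant (suc n) g e = ≈ᴹ-trans (+-homo φ (gen (g zero)) _)
        (≈ᴹ-trans (+ᴹ-cong (≈ᴹ-trans (e zero) (≈ᴹ-sym (*ₗ-identityˡ y))) (constant n (g ∘ suc) (e ∘ suc)))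
          (≈ᴹ-sym (*ₗ-distribʳ y k.1# (n ×ℕ k.1#))))

-- The cosets G/P are the lines of V, and W ℓ represents the coset of ℓ.
record Cells {q} (F : FiniteField q) (m : ℕ) (G : Group 0ℓ 0ℓ) (levi : LeviPair G) : Set₁ where
  open Lines F
  open Group G
  open LeviPair levi using (module L; module U; module P)
  field
    W             : Line (suc m) → Carrier
    line          : Carrier → Line (suc m)
    Unitriangular : ℕ → Carrier → Set
    W-zero        : W (zero , []) ≈ ε
    line-cong     : ∀ {g h} → g ≈ h → line g ≡ line h
    line-P        : ∀ g {p} → P.Member p → line (g ∙ p) ≡ line g
    line-W        : ∀ ℓ → line (W ℓ) ≡ ℓ
    cofactor∈P    : ∀ g → P.Member (W (line g) ⁻¹ ∙ g)
    unitriangular-zero : ∀ {u} → Unitriangular 0 u → u ≈ ε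
    unitriangular-one  : ∀ {u} → Unitriangular 1 u → U.Member u
    U⇒unitriangular    : ∀ {h u} → 1 ≤ h → U.Member u → Unitriangular h u
    unitriangular⇒P    : ∀ {h u} → Unitriangular h u → P.Member u
    transfer      : ∀ h κ c c′ → upper h c ≡ upper h c′ → Unitriangular h (W (κ , c′) ∙ W (κ , c) ⁻¹)
    conjugate     : ∀ h ℓ {u l u₀} → Unitriangular (nextHeight h (proj₁ ℓ)) u → L.Member l → U.Member u₀ →
                    u ≈ l ∙ u₀ → Unitriangular h (W ℓ ∙ (l ∙ W ℓ ⁻¹))
    move          : ∀ h {u} → Unitriangular h u → ∀ g → let κ , c = line g in
                    Σ (Vec (FiniteField.Carrier F) (toℕ κ)) λ c′ → line (u ∙ g) ≡ (κ , c′) × upper h c′ ≡ upper h c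
                      × Unitriangular (nextHeight h κ) (W (κ , c′) ⁻¹ ∙ (u ∙ W (κ , c)))

-- Linear maps out of the induced module, and the invariant coordinates.

module Reduction (k : CommutativeRing 0ℓ 0ℓ)
  (recip : (j : ℕ) .{{_ : NonZero j}} → CommutativeRing.Carrier k)
  {q : ℕ} (F : FiniteField q) (m : ℕ) (G : Group 0ℓ 0ℓ) (levi : LeviPair G)
  (cells : Cells F m G levi) where

  open Lines F
  open HarishChandra k recip G levi
  open LeviPair levi
  open Cells cells
  open Bases k
  open GroupAction k recip G
  private
    module k = CommutativeRing k
    module G = Group G
    module F = FiniteField F
    n = suc m
    𝕜G = kG.groupAlgebra
    module kL = GroupAlgebra k L.group
    module kP = GroupAlgebra k P.group
  open kG using (gen; _⊛_; _⊕_; 𝟎; _·_; _≋_; FormalSum; translate; gen-cong)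
  open import Algebra.Properties.CommutativeMonoid.Sum (Ring.+-commutativeMonoid kG.groupAlgebra)
    using (sum; sum-cong-≋; sum-permute)
  open import Algebra.Properties.Group G using (\\-leftDividesˡ; \\-leftDividesʳ; //-rightDividesˡ; //-rightDividesʳ)

  private
    element : Fin ∣U∣ → G.Carrier
    element i = proj₁ (Inverse.to enumerateU i)

    module _ (f f⁻¹ : G.Carrier → G.Carrier)
      (f-closed : ∀ {u} → U.Member u → U.Member (f u)) (f⁻¹-closed : ∀ {u} → U.Member u → U.Member (f⁻¹ u))
      (f-cong : ∀ {u v} → u G.≈ v → f u G.≈ f v) (f⁻¹-cong : ∀ {u v} → u G.≈ v → f⁻¹ u G.≈ f⁻¹ v)
      (ff⁻¹ : ∀ u → f (f⁻¹ u) G.≈ u) (f⁻¹f : ∀ u → f⁻¹ (f u) G.≈ u) where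

      open Inverse enumerateU using (to; from; strictlyInverseˡ) renaming (inverseʳ to from-inverse)

      private
        f′ f⁻¹′ : Group.Carrier U.group → Group.Carrier U.group
        f′ (u , p) = f u , f-closed p
        f⁻¹′ (u , p) = f⁻¹ u , f⁻¹-closed p

        π : Permutation′ ∣U∣
        π = permutation (λ i → from (f′ (to i))) (λ i → from (f⁻¹′ (to i)))
          (λ i → from-inverse {i} (G.trans (f-cong (strictlyInverseˡ (f⁻¹′ (to i)))) (ff⁻¹ (element i))))
          (λ i → from-inverse {i} (G.trans (f⁻¹-cong (strictlyInverseˡ (f′ (to i)))) (f⁻¹f (element i))))

      sum-reindex : sum (λ i → gen (f (element i))) ≋ sum (λ i → gen (element i))
      sum-reindex = kG.trans (sum-cong-≋ (λ i → gen-cong (G.sym (strictlyInverseˡ (f′ (to i))))))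
        (kG.sym (sum-permute (λ i → gen (element i)) π))

  gen-e_U : ∀ {u} → U.Member u → gen u ⊛ e_U ≋ e_U
  gen-e_U {u} p = kG.·-cong k.refl (kG.trans (translate-sum u element)
    (sum-reindex (u G.∙_) (u G.⁻¹ G.∙_) (U.∙-closed p) (U.∙-closed (U.⁻¹-closed p))
      G.∙-congˡ G.∙-congˡ (\\-leftDividesˡ u) (\\-leftDividesʳ u)))

  e_U-gen : ∀ {u} → U.Member u → e_U ⊛ gen u ≋ e_U
  e_U-gen {u} p = kG.·-cong k.refl (kG.trans (sum-⊛ u element)
    (sum-reindex (G._∙ u) (G._∙ u G.⁻¹) (λ q → U.∙-closed q p) (λ q → U.∙-closed q (U.⁻¹-closed p))
      G.∙-congʳ G.∙-congʳ (//-rightDividesˡ u) (//-rightDividesʳ u)))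

  module _ (M : LeftModule 𝕜G 0ℓ 0ℓ) where
    open LeftModule M

    gen-fixed : ∀ {u} → U.Member u → ∀ y → gen u *ₗ (e_U *ₗ y) ≈ᴹ e_U *ₗ y
    gen-fixed {u} p y = ≈ᴹ-trans (≈ᴹ-sym (*ₗ-assoc (gen u) e_U y)) (*ₗ-congʳ (gen-e_U p))

    e_U-fixed : ∀ {u} → U.Member u → ∀ y → e_U *ₗ (gen u *ₗ y) ≈ᴹ e_U *ₗ y
    e_U-fixed {u} p y = ≈ᴹ-trans (≈ᴹ-sym (*ₗ-assoc e_U (gen u) y)) (*ₗ-congʳ (e_U-gen p))

    gen-∙ : ∀ g h y → gen (g G.∙ h) *ₗ y ≈ᴹ gen g *ₗ (gen h *ₗ y)
    gen-∙ g h y = *ₗ-assoc (gen g) (gen h) y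

    -- Reconciles the inflated action, which goes through l, with the action of x on M: u fixes
    -- every e_U y.
    P-fixed : ∀ {x l u} → U.Member u → x G.≈ l G.∙ u → ∀ w → (∃ λ y → w ≈ᴹ e_U *ₗ y) →
      gen x *ₗ w ≈ᴹ gen l *ₗ w
    P-fixed {x} {l} {u} pu x≈lu w (y , e) = ≈ᴹ-trans (*ₗ-cong (gen-cong x≈lu) e)
      (≈ᴹ-trans (gen-∙ l u (e_U *ₗ y)) (*ₗ-congˡ (≈ᴹ-trans (gen-fixed pu y) (≈ᴹ-sym e))))

    project : LinearMap (overScalars M) (overScalarsL (Resf M))
    project = record
      { ⟦_⟧ = λ y → e_U *ₗ y , y , ≈ᴹ-refl
      ; ⟦⟧-cong = *ₗ-congˡ
      ; +-homo = *ₗ-distribˡ e_U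
      ; *-homo = *-homo (act M e_U)
      }

    private
      module R = LeftModule (Resf M)
      open Ind (Resf M) using (_⊗_; ⊗-cong; ⊗-distribʳ; ⊗-distribˡ; ⊗-balanced) renaming (_≋_ to _≈⊗_)
      module T = LeftModule (Indf (Resf M))

    scalar-⊗ : ∀ a r w → (a ⊛ (r · gen G.ε)) ⊗ w ≈⊗ a ⊗ ((r kL.· kL.gen (Group.ε L.group)) R.*ₗ w)
    scalar-⊗ a r w = ⊗-balanced a (r kP.· kP.gen (Group.ε P.group)) w

    tensor : ∀ a → LinearMap (overScalarsL (Resf M)) (overScalars (Indf (Resf M)))
    tensor a = record
      { ⟦_⟧ = λ w → a ⊗ w
      ; ⟦⟧-cong = λ e → ⊗-cong kG.refl e
      ; +-homo = ⊗-distribˡ a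
      ; *-homo = λ r w → T.≈ᴹ-trans (T.≈ᴹ-sym (scalar-⊗ a r w))
          (⊗-cong (kG.sym (scalar-central r a)) (R.≈ᴹ-refl {w}))
      }

    tensorˡ : ∀ w → LinearMap kG.freeModule (overScalars (Indf (Resf M)))
    tensorˡ w = record
      { ⟦_⟧ = λ a → a ⊗ w
      ; ⟦⟧-cong = λ e → ⊗-cong e (R.≈ᴹ-refl {w})
      ; +-homo = λ a b → ⊗-distribʳ a b w
      ; *-homo = λ r a → ⊗-cong (kG.sym (scalar-⊛ r a)) (R.≈ᴹ-refl {w})
      }

    module _ {N : LeftModule k.ring 0ℓ 0ℓ} where
      private
        module M = LeftModule M
        module N = LeftModule N
        open kG.LinearExtension N using (extend; extend-cong; extend-≗)

      extend-+ : ∀ f f′ a → extend (λ g → f g N.+ᴹ f′ g) a N.≈ᴹ extend f a N.+ᴹ extend f′ a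
      extend-+ f f′ (gen g) = N.≈ᴹ-refl
      extend-+ f f′ (a ⊕ b) = N.≈ᴹ-trans (N.+ᴹ-cong (extend-+ f f′ a) (extend-+ f f′ b))
        (interchange (extend f a) (extend f′ a) (extend f b) (extend f′ b))
        where
        open import Algebra.Properties.CommutativeSemigroup
          (CommutativeMonoid.commutativeSemigroup N.+ᴹ-commutativeMonoid) using (interchange)
      extend-+ f f′ 𝟎 = N.≈ᴹ-sym (N.+ᴹ-identityˡ N.0ᴹ)
      extend-+ f f′ (r · a) = N.≈ᴹ-trans (N.*ₗ-congˡ (extend-+ f f′ a)) (N.*ₗ-distribˡ r (extend f a) (extend f′ a))

      -- g ⊗ w ↦ θ_ℓ(p w) for g = W ℓ p with p ∈ P: the cosets of P are indexed by lines.
      module _ (θ : Line n → LinearMap (overScalars M) N) where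
        private
          value : M.Carrierᴹ → G.Carrier → N.Carrierᴹ
          value w g = ⟦ θ (line g) ⟧ (gen (W (line g) G.⁻¹ G.∙ g) M.*ₗ w)

          value-at : ∀ w g {ℓ} → line g ≡ ℓ → value w g N.≈ᴹ ⟦ θ ℓ ⟧ (gen (W ℓ G.⁻¹ G.∙ g) M.*ₗ w)
          value-at w g ≡.refl = N.≈ᴹ-refl

          value-congʳ : ∀ w {g h} → g G.≈ h → value w g N.≈ᴹ value w h
          value-congʳ w {g} {h} e = N.≈ᴹ-trans (value-at w g (line-cong e))
            (⟦⟧-cong (θ (line h)) (M.*ₗ-congʳ (gen-cong (G.∙-congˡ e))))

          value-cong : ∀ {w w′} → w M.≈ᴹ w′ → ∀ g → value w g N.≈ᴹ value w′ g
          value-cong e g = ⟦⟧-cong (θ (line g)) (M.*ₗ-congˡ e)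

          value-linear : ∀ g → LinearMap (overScalars M) N
          value-linear g = θ (line g) ∘ₗ act M (gen (W (line g) G.⁻¹ G.∙ g))

          -- g and g x lie in one coset, so the same θ applies, and the cofactor of g is merely
          -- multiplied by x, which acts on w as its Levi part.
          balanced-P : ∀ (w : R.Carrierᴹ) g (p : Group.Carrier P.group) →
            value (proj₁ w) (g G.∙ proj₁ p) N.≈ᴹ value (gen (proj₁ (proj₁ (proj₂ p))) M.*ₗ proj₁ w) g
          balanced-P (w , e) g p@(x , (l , u) , pl , pu , x≈lu) =
            N.≈ᴹ-trans (value-at w (g G.∙ x) (line-P g (proj₂ p)))
              (⟦⟧-cong (θ (line g)) (M.≈ᴹ-trans (M.*ₗ-congʳ (gen-cong (G.sym (G.assoc _ g x))))
                (M.≈ᴹ-trans (gen-∙ _ x w) (M.*ₗ-congˡ (P-fixed pu x≈lu w e)))))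

          P→G : kP.FormalSum → FormalSum
          P→G = RH.⟦_⟧
            where module RH = RingHomomorphism (mapAlgebra k {P.group} {G} P.inclusion)

          P→L′ : kP.FormalSum → kL.FormalSum
          P→L′ = RH.⟦_⟧
            where module RH = RingHomomorphism (mapAlgebra k {P.group} {L.group} P→L)

          balanced-gen : ∀ (w : R.Carrierᴹ) g r →
            extend (value (proj₁ w)) (translate g (P→G r)) N.≈ᴹ value (proj₁ (P→L′ r R.*ₗ w)) g
          balanced-gen w g (kP.gen p) = balanced-P w g p
          balanced-gen w g (r kP.⊕ s) = N.≈ᴹ-trans (N.+ᴹ-cong (balanced-gen w g r) (balanced-gen w g s))
            (N.≈ᴹ-sym (N.≈ᴹ-trans (value-cong (M.*ₗ-distribʳ (proj₁ w) (L→G.⟦ P→L′ r ⟧) (L→G.⟦ P→L′ s ⟧)) g)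
              (+-homo (value-linear g) (L→G.⟦ P→L′ r ⟧ M.*ₗ proj₁ w) (L→G.⟦ P→L′ s ⟧ M.*ₗ proj₁ w))))
            where module L→G = RingHomomorphism L→G
          balanced-gen w g kP.𝟎 = N.≈ᴹ-sym (N.≈ᴹ-trans (value-cong (M.*ₗ-zeroˡ (proj₁ w)) g) (0-homo (value-linear g)))
          balanced-gen w g (t kP.· r) = N.≈ᴹ-trans (N.*ₗ-congˡ (balanced-gen w g r))
            (N.≈ᴹ-sym (*-homo (value-linear g ∘ₗ orbit M (proj₁ w)) t (L→G.⟦ P→L′ r ⟧)))
            where module L→G = RingHomomorphism L→G

          balanced : ∀ (w : R.Carrierᴹ) a r →
            extend (value (proj₁ w)) (a ⊛ P→G r) N.≈ᴹ extend (value (proj₁ (P→L′ r R.*ₗ w))) a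
          balanced w (gen g) r = balanced-gen w g r
          balanced w (a ⊕ b) r = N.+ᴹ-cong (balanced w a r) (balanced w b r)
          balanced w 𝟎 r = N.≈ᴹ-refl
          balanced w (t · a) r = N.*ₗ-congˡ (balanced w a r)

          map : T.Carrierᴹ → N.Carrierᴹ
          map (a Ind.⊗ (w , _)) = extend (value w) a
          map (x Ind.⊕ y) = map x N.+ᴹ map y
          map Ind.𝟎 = N.0ᴹ
          map (Ind.⊖ x) = N.-ᴹ map x

          map-cong : ∀ {x y} → x T.≈ᴹ y → map x N.≈ᴹ map y
          map-cong Ind.refl = N.≈ᴹ-refl
          map-cong (Ind.sym e) = N.≈ᴹ-sym (map-cong e)
          map-cong (Ind.trans e f) = N.≈ᴹ-trans (map-cong e) (map-cong f)
          map-cong (Ind.⊕-cong e f) = N.+ᴹ-cong (map-cong e) (map-cong f)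
          map-cong (Ind.⊖-cong e) = N.-ᴹ‿cong (map-cong e)
          map-cong (Ind.⊕-assoc x y z) = N.+ᴹ-assoc (map x) (map y) (map z)
          map-cong (Ind.⊕-comm x y) = N.+ᴹ-comm (map x) (map y)
          map-cong (Ind.⊕-identityˡ x) = N.+ᴹ-identityˡ (map x)
          map-cong (Ind.⊖-inverseˡ x) = N.-ᴹ‿inverseˡ (map x)
          map-cong (Ind.⊗-cong {m′ = a′} {n = w , _} {w′ , _} e f) = N.≈ᴹ-trans (extend-cong (value w) (value-congʳ w) e)
            (extend-≗ (value-cong f) a′)
          map-cong (Ind.⊗-distribʳ a b w) = N.≈ᴹ-refl
          map-cong (Ind.⊗-distribˡ a (w , _) (w′ , _)) =
            N.≈ᴹ-trans (extend-≗ (λ g → +-homo (value-linear g) w w′) a) (extend-+ (value w) (value w′) a)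
          map-cong (Ind.⊗-balanced a r w) = balanced w a r

          map-scale : ∀ r x → map ((r · gen G.ε) T.*ₗ x) N.≈ᴹ r N.*ₗ map x
          map-scale r (a Ind.⊗ (w , _)) = N.*ₗ-congˡ (extend-cong (value w) (value-congʳ w) (kG.⊛-identityˡ a))
          map-scale r (x Ind.⊕ y) = N.≈ᴹ-trans (N.+ᴹ-cong (map-scale r x) (map-scale r y))
            (N.≈ᴹ-sym (N.*ₗ-distribˡ r (map x) (map y)))
          map-scale r Ind.𝟎 = N.≈ᴹ-sym (N.*ₗ-zeroʳ r)
          map-scale r (Ind.⊖ x) = N.≈ᴹ-trans (N.-ᴹ‿cong (map-scale r x)) (N.≈ᴹ-sym (neg-scale (map x)))
            where
            open import Algebra.Module.Properties.LeftModule N using (inverseˡ-uniqueᴹ)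
            neg-scale : ∀ y → r N.*ₗ (N.-ᴹ y) N.≈ᴹ N.-ᴹ (r N.*ₗ y)
            neg-scale y = inverseˡ-uniqueᴹ _ _ (N.≈ᴹ-trans (N.≈ᴹ-sym (N.*ₗ-distribˡ r (N.-ᴹ y) y))
              (N.≈ᴹ-trans (N.*ₗ-congˡ (N.-ᴹ‿inverseˡ y)) (N.*ₗ-zeroʳ r)))

        -- As a k-module the tensor product is the direct sum of the copies W ℓ ⊗ e_U M over all
        -- lines ℓ, so a family of maps, one for each line, extends to it.
        lift : LinearMap (overScalars (Indf (Resf M))) N
        lift = record
          { ⟦_⟧ = map
          ; ⟦⟧-cong = map-cong
          ; +-homo = λ _ _ → N.≈ᴹ-refl
          ; *-homo = map-scale
          }

        lift-gen : ∀ g w {ℓ} → line g ≡ ℓ →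
          ⟦ lift ⟧ (gen g ⊗ w) N.≈ᴹ ⟦ θ ℓ ⟧ (gen (W ℓ G.⁻¹ G.∙ g) M.*ₗ proj₁ w)
        lift-gen g (w , _) = value-at w g

      tensor-ext : (φ ψ : LinearMap (overScalars (Indf (Resf M))) N) →
        (∀ g w → ⟦ φ ⟧ (gen g ⊗ w) N.≈ᴹ ⟦ ψ ⟧ (gen g ⊗ w)) → ∀ x → ⟦ φ ⟧ x N.≈ᴹ ⟦ ψ ⟧ x
      tensor-ext φ ψ e (a Ind.⊗ w) = gen-ext (φ ∘ₗ tensorˡ w) (ψ ∘ₗ tensorˡ w) (λ g → e g w) a
      tensor-ext φ ψ e (x Ind.⊕ y) = N.≈ᴹ-trans (+-homo φ x y)
        (N.≈ᴹ-trans (N.+ᴹ-cong (tensor-ext φ ψ e x) (tensor-ext φ ψ e y)) (N.≈ᴹ-sym (+-homo ψ x y)))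
      tensor-ext φ ψ e Ind.𝟎 = N.≈ᴹ-trans (0-homo φ) (N.≈ᴹ-sym (0-homo ψ))
      tensor-ext φ ψ e (Ind.⊖ x) = N.≈ᴹ-trans (-‿homo φ x)
        (N.≈ᴹ-trans (N.-ᴹ‿cong (tensor-ext φ ψ e x)) (N.≈ᴹ-sym (-‿homo ψ x)))

      Invariant : ℕ → LinearMap (overScalars M) N → Set
      Invariant h φ = ∀ {u} → Unitriangular h u → ∀ x → ⟦ φ ⟧ (gen u M.*ₗ x) N.≈ᴹ ⟦ φ ⟧ x

  -- Sends g_1 ⊗ ⋯ ⊗ g_r ⊗ 1 to the value of f at the index of its orbit under the
  -- unitriangular subgroup of height h.
  coordinate : ∀ r h → (Index n h r → k.Carrier) → Functional (overScalars (IR r))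
  coordinateAt : ∀ r h → (Index n h (suc r) → k.Carrier) → Line n → Functional (overScalars (IR r))
  coordinateAt r h f (κ , c) = coordinate r (nextHeight h κ) (f ∘ cons κ (upper h c))
  coordinate zero h f = record
    { ⟦_⟧ = λ x → x k.* f ([] , [])
    ; ⟦⟧-cong = k.*-congʳ
    ; +-homo = λ x y → k.distribʳ (f ([] , [])) x y
    ; *-homo = λ r x → k.trans (k.*-congʳ (k.*-congʳ (k.*-identityʳ r))) (k.*-assoc r x (f ([] , [])))
    }
  coordinate (suc r) h f = lift (IR r) (coordinateAt r h f)

  -- u keeps the upper part of the line, so the remaining coordinate is formed from the same
  -- function. On its argument u acts through an element of the group at the next height, which the
  -- induction hypothesis absorbs.
  coordinate-invariant : ∀ r h f → Invariant (IR r) h (coordinate r h f)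
  coordinate-invariant zero h f {u} un x = k.*-congʳ (k.*-identityˡ x)
  coordinate-invariant (suc r) h f {u} un = tensor-ext (IR r) (coordinate (suc r) h f ∘ₗ act (IR (suc r)) (gen u)) (coordinate (suc r) h f)
    λ g (w , e) → let
        κ , c = line g
        c′ , line≡ , upper≡ , un′ = move h un g
        stab = W (κ , c′) G.⁻¹ G.∙ (u G.∙ W (κ , c))
        p = W (κ , c) G.⁻¹ G.∙ g
        regroup : W (κ , c′) G.⁻¹ G.∙ (u G.∙ g) G.≈ stab G.∙ p
        regroup = G.sym (G.trans (G.assoc _ _ p) (G.∙-congˡ (G.trans (G.assoc u _ p) (G.∙-congˡ (\\-leftDividesˡ (W (κ , c)) g)))))
        rest a = coordinate r (nextHeight h κ) (f ∘ cons κ a)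
      in k.trans (lift-gen (IR r) {scalars} (coordinateAt r h f) (u G.∙ g) (w , e) line≡)
        (k.trans (⟦⟧-cong (rest (upper h c′)) (≈ᴹ-trans (IR r) (*ₗ-congʳ (IR r) (gen-cong regroup)) (gen-∙ (IR r) stab p w)))
        (k.trans (coordinate-invariant r (nextHeight h κ) _ un′ (_*ₗ_ (IR r) (gen p) w))
        (k.reflexive (≡.cong (λ a → ⟦ rest a ⟧ (_*ₗ_ (IR r) (gen p) w)) upper≡))))
    where open LeftModule

-- Straightening of invariant maps, and the bases that follow.

module Straightening (k : CommutativeRing 0ℓ 0ℓ)
  (recip : (j : ℕ) .{{_ : NonZero j}} → CommutativeRing.Carrier k)
  {q : ℕ} (F : FiniteField q) (m : ℕ) (G : Group 0ℓ 0ℓ) (levi : LeviPair G)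
  (cells : Cells F m G levi) where

  open Lines F
  open HarishChandra k recip G levi
  open LeviPair levi
  open Cells cells
  open Bases k
  open GroupAction k recip G
  open Reduction k recip F m G levi cells
  open IndexCount q {{FiniteField.q-nonZero F}} {{FiniteField.q∸1-nonZero F}} (suc m)
  private
    module k = CommutativeRing k
    module G = Group G
    module F = FiniteField F
    n = suc m
    module kL = GroupAlgebra k L.group
    module kP = GroupAlgebra k P.group
  open kG using (gen; _·_; _≋_; FormalSum; gen-cong)
  open import Algebra.Properties.CommutativeMonoid.Sum (Ring.+-commutativeMonoid kG.groupAlgebra) using (sum)
  open import Algebra.Properties.Monoid.Mult k.+-monoid using () renaming (_×_ to _×ℕ_)
  open import Algebra.Properties.Group G using (\\-leftDividesˡ; //-rightDividesˡ)

  enumerateIndex : ∀ h r → Fin (indexCount h r) ↔ Index n h r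
  enumerateIndex h zero = mk↔ₛ′ (λ _ → [] , []) (λ _ → zero) (λ { ([] , []) → ≡.refl }) (λ { zero → ≡.refl })
  enumerateIndex h (suc r) = ↔-trans
    (Fin-sum↔Σ (λ κ → q ^ (toℕ κ ∸ toℕ κ ⊓ h) ℕ.* indexCount (nextHeight h κ) r))
    (↔-trans (Σ-↔ ↔-refl (λ {κ} → ↔-trans Finₚ.*↔×
        (F.enumerateVec (toℕ κ ∸ toℕ κ ⊓ h) ×-↔ enumerateIndex (nextHeight h κ) r)))
      (mk↔ₛ′ (λ (κ , a , K) → cons κ a K)
             (λ { (κ ∷ κs , a ∷ as) → κ , a , κs , as })
             (λ { (κ ∷ κs , a ∷ as) → ≡.refl })
             (λ { (κ , a , κs , as) → ≡.refl })))

  indicator : ∀ {h r} → Index n h r → Index n h r → k.Carrier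
  indicator {h} {r} K K′ = if does (↔⇒≟ (enumerateIndex h r) K K′) then k.1# else k.0#

  indicator-refl : ∀ {h r} (K : Index n h r) → indicator K K k.≈ k.1#
  indicator-refl {h} {r} K = k.reflexive (≡.cong (if_then k.1# else k.0#) (dec-true (↔⇒≟ (enumerateIndex h r) K K) ≡.refl))

  indicator-≢ : ∀ {h r} {K K′ : Index n h r} → K ≢ K′ → indicator K K′ k.≈ k.0#
  indicator-≢ {h} {r} {K} {K′} ne =
    k.reflexive (≡.cong (if_then k.1# else k.0#) (dec-false (↔⇒≟ (enumerateIndex h r) K K′) ne))

  pure : ∀ M a → LinearMap (overScalars M) (overScalars (Indf (Resf M)))
  pure M a = tensor M a ∘ₗ project M

  forget : ∀ M → LinearMap (overScalarsL (Resf M)) (overScalars M)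
  forget M = record
    { ⟦_⟧ = proj₁
    ; ⟦⟧-cong = id
    ; +-homo = λ _ _ → ≈ᴹ-refl
    ; *-homo = λ _ _ → ≈ᴹ-refl
    }
    where open LeftModule M

  module _ (M : LeftModule kG.groupAlgebra 0ℓ 0ℓ) where
    open LeftModule M
    private
      module R = LeftModule (Resf M)
      module T = LeftModule (Indf (Resf M))
    open Ind (Resf M) using (_⊗_; ⊗-cong; ⊗-balanced)

    project-L : ∀ {l} → L.Member l → ∀ y → e_U *ₗ (gen l *ₗ y) ≈ᴹ gen l *ₗ (e_U *ₗ y)
    project-L {l} pl y = ≈ᴹ-trans (≈ᴹ-sym (*ₗ-assoc e_U (gen l) y))
      (≈ᴹ-trans (*ₗ-congʳ (kG.sym (l-e_U pl))) (*ₗ-assoc (gen l) e_U y))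

    -- The Levi part of x crosses the tensor sign and stays inside e_U M because it commutes with
    -- e_U.
    collect : ∀ g x → (p : P.Member x) → ∀ w → ∃ λ y → gen (g G.∙ x) ⊗ w T.≈ᴹ gen g ⊗[ M ] y
    collect g x p@((l , u) , pl , pu , x≈lu) w@(w₀ , y , e) = gen l *ₗ y , T.≈ᴹ-trans
      (⊗-balanced (gen g) (kP.gen (x , p)) w)
      (⊗-cong kG.refl (≈ᴹ-trans (*ₗ-congˡ e) (≈ᴹ-sym (project-L pl y))))

    pure-L : ∀ g {l} → L.Member l → ∀ y → gen g ⊗[ M ] (gen l *ₗ y) T.≈ᴹ gen (g G.∙ l) ⊗[ M ] y
    pure-L g {l} pl y = T.≈ᴹ-trans (⊗-cong kG.refl (project-L pl y))
      (T.≈ᴹ-sym (⊗-balanced (gen g) (kP.gen (l , (l , G.ε) , pl , U.ε-closed , G.sym (G.identityʳ l)))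
        (e_U *ₗ y , y , ≈ᴹ-refl)))

    module _ {N : LeftModule k.ring 0ℓ 0ℓ} where
      private module N = LeftModule N

      -- With u = l u₀ the factor u₀ is absorbed by e_U, and l crosses the tensor sign to give W l =
      -- (W l W⁻¹) W, whose left factor lies in U_h.
      pure-invariant : ∀ h (θ : LinearMap (overScalars (Indf (Resf M))) N) → Invariant (Indf (Resf M)) {N} h θ →
        ∀ ℓ → Invariant M {N} (nextHeight h (proj₁ ℓ)) (θ ∘ₗ pure M (gen (W ℓ)))
      pure-invariant h θ inv ℓ {u} un y with unitriangular⇒P un
      ... | (l , u₀) , pl , pu₀ , u≈lu₀ = N.≈ᴹ-trans (⟦⟧-cong θ (T.≈ᴹ-trans (⊗-cong kG.refl absorb)
              (T.≈ᴹ-trans (pure-L (W ℓ) pl y) (⊗-cong (gen-cong regroup) ≈ᴹ-refl))))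
            (inv (conjugate h ℓ un pl pu₀ u≈lu₀) (gen (W ℓ) ⊗[ M ] y))
        where
        absorb : e_U *ₗ (gen u *ₗ y) ≈ᴹ e_U *ₗ (gen l *ₗ y)
        absorb = ≈ᴹ-trans (*ₗ-congˡ (≈ᴹ-trans (*ₗ-congʳ (gen-cong u≈lu₀)) (gen-∙ M l u₀ y)))
          (≈ᴹ-trans (project-L pl (gen u₀ *ₗ y)) (≈ᴹ-trans (*ₗ-congˡ (e_U-fixed M pu₀ y)) (≈ᴹ-sym (project-L pl y))))
        regroup : W ℓ G.∙ l G.≈ (W ℓ G.∙ (l G.∙ W ℓ G.⁻¹)) G.∙ W ℓ
        regroup = G.trans (G.∙-congˡ (G.sym (//-rightDividesˡ (W ℓ) l))) (G.sym (G.assoc (W ℓ) (l G.∙ W ℓ G.⁻¹) (W ℓ)))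

      pure-ext : (φ ψ : LinearMap (overScalars (Indf (Resf M))) N) →
        (∀ ℓ y → ⟦ φ ⟧ (gen (W ℓ) ⊗[ M ] y) N.≈ᴹ ⟦ ψ ⟧ (gen (W ℓ) ⊗[ M ] y)) → ∀ x → ⟦ φ ⟧ x N.≈ᴹ ⟦ ψ ⟧ x
      pure-ext φ ψ e = tensor-ext M {N} φ ψ λ g w → let
          ℓ = line g
          p = W ℓ G.⁻¹ G.∙ g
          y , collected = collect (W ℓ) p (cofactor∈P g) w
          eq = T.≈ᴹ-trans (⊗-cong (gen-cong (G.sym (\\-leftDividesˡ (W ℓ) g))) (≈ᴹ-refl {proj₁ w})) collected
        in N.≈ᴹ-trans (⟦⟧-cong φ eq) (N.≈ᴹ-trans (e ℓ y) (N.≈ᴹ-sym (⟦⟧-cong ψ eq)))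

  module _ (recip-inverse : ∀ j .{{_ : NonZero j}} → recip j k.* (j ×ℕ k.1#) k.≈ k.1#) where

    -- U is contained in U_h as soon as h ≥ 1, which holds at every height reached after the first
    -- entry.
    e_U-average : ∀ M {N : LeftModule k.ring 0ℓ 0ℓ} {h} → 1 ≤ h → (φ : LinearMap (overScalars M) N) →
      Invariant M {N} h φ → ∀ x → let open LeftModule in _≈ᴹ_ N (⟦ φ ⟧ (_*ₗ_ M e_U x)) (⟦ φ ⟧ x)
    e_U-average M {N} 1≤h φ inv x = average-constant {N} (φ ∘ₗ orbit M x) (⟦ φ ⟧ x) ∣U∣ (recip-inverse ∣U∣)
      (λ i → proj₁ (Inverse.to enumerateU i)) (λ i → inv (U⇒unitriangular 1≤h (proj₂ (Inverse.to enumerateU i))) x)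

    module StandardBasis
      (w : ∀ h (κ : Fin n) → Vec F.Carrier (toℕ κ ∸ toℕ κ ⊓ h) → FormalSum)
      (w-average : ∀ h κ a → w h κ a ≋ recip (q ^ (toℕ κ ⊓ h)) {{ℕₚ.m^n≢0 q (toℕ κ ⊓ h) {{F.q-nonZero}}}}
        · sum (λ i → gen (W (κ , join h (Inverse.to (F.enumerateVec (toℕ κ ⊓ h)) i) a))))
      (vFrom : ∀ h {r} (κs : Vec (Fin n) r) → Parameters h κs → LeftModule.Carrierᴹ (IR r))
      (vFrom-[] : ∀ h → vFrom h [] [] ≡ k.1#)
      (vFrom-∷ : ∀ h {r} κ (κs : Vec (Fin n) r) a as →
        vFrom h (κ ∷ κs) (a ∷ as) ≡ w h κ a ⊗[ IR r ] vFrom (nextHeight h κ) κs as)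
      where

      v : ∀ h {r} → Index n h r → LeftModule.Carrierᴹ (IR r)
      v h (κs , as) = vFrom h κs as

      v-cons : ∀ h {r} κ a (K : Index n (nextHeight h κ) r) → v h (cons κ a K) ≡ w h κ a ⊗[ IR r ] v (nextHeight h κ) K
      v-cons h κ a (κs , as) = vFrom-∷ h κ κs a as

      -- All terms of the mean in w have upper part a and hence lie in one U_h-orbit of lines, so
      -- any c with that upper part can stand for them.
      w-constant : ∀ r h {N : LeftModule k.ring 0ℓ 0ℓ} (θ : LinearMap (overScalars (IR (suc r))) N) →
        Invariant (IR (suc r)) {N} h θ → ∀ κ c a → upper h c ≡ a → ∀ y → let open LeftModule in
        _≈ᴹ_ N (⟦ θ ⟧ (w h κ a ⊗[ IR r ] y)) (⟦ θ ⟧ (gen (W (κ , c)) ⊗[ IR r ] y))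
      w-constant r h {N} θ inv κ c a c≡a y = ≈ᴹ-trans N (⟦⟧-cong φ (w-average h κ a))
        (average-constant {N} φ (⟦ θ ⟧ (gen (W (κ , c)) ⊗[ IR r ] y)) (q ^ (toℕ κ ⊓ h)) {{nz}} (recip-inverse _ {{nz}})
          (λ i → W (κ , c′ i)) λ i → ≈ᴹ-trans N
            (⟦⟧-cong φ (gen-cong (G.sym (//-rightDividesˡ (W (κ , c)) (W (κ , c′ i))))))
            (inv (transfer h κ c (c′ i) (≡.trans c≡a (≡.sym (upper-join h _ a)))) (gen (W (κ , c)) ⊗[ IR r ] y)))
        where
        open LeftModule
        nz = ℕₚ.m^n≢0 q (toℕ κ ⊓ h) {{F.q-nonZero}}
        φ : LinearMap kG.freeModule N
        φ = θ ∘ₗ tensorˡ (IR r) (⟦ project (IR r) ⟧ y)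
        c′ : Fin (q ^ (toℕ κ ⊓ h)) → Vec F.Carrier (toℕ κ)
        c′ i = join h (Inverse.to (F.enumerateVec (toℕ κ ⊓ h)) i) a

      -- Invariance removes the means one at a time: that of w at height h, then e_U at the next
      -- height. Between the two, W ℓ is evaluated on its own line, where its cofactor is 1.
      coordinate-v : ∀ r h f (K : Index n h r) → ⟦ coordinate r h f ⟧ (v h K) k.≈ f K
      coordinate-v zero h f ([] , []) = k.trans (k.*-congʳ (k.reflexive (vFrom-[] h))) (k.*-identityˡ (f ([] , [])))
      coordinate-v (suc r) h f (κ ∷ κs , a ∷ as) = k.trans
        (k.reflexive (≡.cong ⟦ coordinate (suc r) h f ⟧ (vFrom-∷ h κ κs a as)))
        (k.trans (w-constant r h {scalars} (coordinate (suc r) h f) (λ {u} → coordinate-invariant (suc r) h f {u}) κ c a c≡a v′)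
        (k.trans (lift-gen (IR r) {scalars} (coordinateAt r h f) (W (κ , c)) (⟦ project (IR r) ⟧ v′) (line-W (κ , c)))
        (k.trans (⟦⟧-cong rest (≈ᴹ-trans (IR r) (*ₗ-congʳ (IR r) (gen-cong (G.inverseˡ (W (κ , c))))) (*ₗ-identityˡ (IR r) _)))
        (k.trans (e_U-average (IR r) {scalars} (ℕₚ.≤-trans (s≤s z≤n) (ℕₚ.m≤n⊔m h (suc (toℕ κ ⊓ h)))) rest
          (λ {u} → coordinate-invariant r (nextHeight h κ) _ {u}) v′)
        (k.trans (coordinate-v r (nextHeight h κ) _ (κs , as))
          (k.reflexive (≡.cong (λ a → f (cons κ a (κs , as))) c≡a)))))))
        where
        open LeftModule
        v′ = vFrom (nextHeight h κ) κs as
        -- Zeros are one choice for the averaged entries; only the upper part a matters.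
        c = join h (replicate (toℕ κ ⊓ h) F.0#) a
        c≡a = upper-join h (replicate (toℕ κ ⊓ h) F.0#) a
        rest = coordinateAt r h f (κ , c)

      -- The elements W ℓ ⊗_U y span, and for fixed ℓ each of the two maps is invariant at height h′
      -- in y. Its values at the v_K of that height are values at longer v_K, as an invariant map
      -- does not distinguish w from W ℓ.
      invariant-unique : ∀ r h {N : LeftModule k.ring 0ℓ 0ℓ} (θ θ′ : LinearMap (overScalars (IR r)) N) →
        Invariant (IR r) {N} h θ → Invariant (IR r) {N} h θ′ → let open LeftModule N in
        (∀ (K : Index n h r) → ⟦ θ ⟧ (v h K) ≈ᴹ ⟦ θ′ ⟧ (v h K)) → ∀ x → ⟦ θ ⟧ x ≈ᴹ ⟦ θ′ ⟧ x
      invariant-unique zero h {N} θ θ′ inv inv′ e x = ≈ᴹ-trans (via θ)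
          (≈ᴹ-trans (*ₗ-congˡ (e ([] , []))) (≈ᴹ-sym (via θ′)))
        where
        open LeftModule N
        via : ∀ θ → ⟦ θ ⟧ x ≈ᴹ x *ₗ ⟦ θ ⟧ (v h ([] , []))
        via θ = ≈ᴹ-trans (⟦⟧-cong θ (k.trans (k.sym (k.*-identityʳ x))
            (k.*-cong (k.sym (k.*-identityʳ x)) (k.sym (k.reflexive (vFrom-[] h))))))
          (*-homo θ x (v h ([] , [])))
      invariant-unique (suc r) h {N} θ θ′ inv inv′ e = pure-ext (IR r) {N} θ θ′ λ ℓ y →
        invariant-unique r (nextHeight h (proj₁ ℓ)) {N} (at θ ℓ) (at θ′ ℓ)
          (λ {u} → pure-invariant (IR r) {N} h θ inv ℓ {u}) (λ {u} → pure-invariant (IR r) {N} h θ′ inv′ ℓ {u})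
          (λ K → ≈ᴹ-trans (via θ inv ℓ K) (≈ᴹ-trans (e (cons (proj₁ ℓ) (upper h (proj₂ ℓ)) K)) (≈ᴹ-sym (via θ′ inv′ ℓ K)))) y
        where
        open LeftModule N
        at : LinearMap (overScalars (IR (suc r))) N → Line n → LinearMap (overScalars (IR r)) N
        at θ ℓ = θ ∘ₗ pure (IR r) (gen (W ℓ))
        via : ∀ (θ : LinearMap (overScalars (IR (suc r))) N) → Invariant (IR (suc r)) {N} h θ →
          ∀ ℓ (K : Index n (nextHeight h (proj₁ ℓ)) r) →
          ⟦ at θ ℓ ⟧ (v (nextHeight h (proj₁ ℓ)) K) ≈ᴹ ⟦ θ ⟧ (v h (cons (proj₁ ℓ) (upper h (proj₂ ℓ)) K))
        via θ inv (κ , c) K = ≈ᴹ-trans (≈ᴹ-sym (w-constant r h {N} θ inv κ c (upper h c) ≡.refl (v (nextHeight h κ) K)))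
          (≈ᴹ-reflexive (≡.cong ⟦ θ ⟧ (≡.sym (v-cons h κ (upper h c) K))))

      -- The expansion inherits invariance from the coordinates, and by duality only the term of K
      -- survives at v_K, so uniqueness applies.
      straighten : ∀ r h {N : LeftModule k.ring 0ℓ 0ℓ} (θ : LinearMap (overScalars (IR r)) N) →
        Invariant (IR r) {N} h θ → let open LeftModule N
                                       open Inverse (enumerateIndex h r) using (to) in
        ∀ x → ⟦ θ ⟧ x ≈ᴹ ⟦ expansion {N} {overScalars (IR r)}
          (λ j → coordinate r h (indicator (to j))) (λ j → ⟦ θ ⟧ (v h (to j))) ⟧ x
      straighten r h {N} θ inv = invariant-unique r h {N} θ expand inv expand-invariant expand-v
        where
        open LeftModule N
        open Inverse (enumerateIndex h r) using (to; from; strictlyInverseˡ; strictlyInverseʳ)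
        open import Algebra.Properties.CommutativeMonoid.Sum +ᴹ-commutativeMonoid using (sum-cong-≋)
        expand : LinearMap (overScalars (IR r)) N
        expand = expansion {N} {overScalars (IR r)} (λ j → coordinate r h (indicator (to j))) (λ j → ⟦ θ ⟧ (v h (to j)))
        expand-invariant : Invariant (IR r) {N} h expand
        expand-invariant {u} un x = sum-cong-≋ (λ j → *ₗ-congʳ (coordinate-invariant r h (indicator (to j)) {u} un x))
        expand-v : ∀ (K : Index n h r) → ⟦ θ ⟧ (v h K) ≈ᴹ ⟦ expand ⟧ (v h K)
        expand-v K = ≈ᴹ-sym (≈ᴹ-trans
          (sum-single {N} (λ j → ⟦ coordinate r h (indicator (to j)) ⟧ (v h K) *ₗ ⟦ θ ⟧ (v h (to j))) (from K)
            (λ j j≢ → ≈ᴹ-trans (*ₗ-congʳ (k.trans (coordinate-v r h (indicator (to j)) K)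
              (indicator-≢ (λ e → j≢ (≡.trans (≡.sym (strictlyInverseʳ j)) (≡.cong from e)))))) (*ₗ-zeroˡ _)))
          (≈ᴹ-trans (*ₗ-congʳ (≡.subst (λ K′ → ⟦ coordinate r h (indicator K′) ⟧ (v h K) k.≈ k.1#)
              (≡.sym (strictlyInverseˡ K)) (k.trans (coordinate-v r h (indicator K) K) (indicator-refl K))))
            (≈ᴹ-trans (*ₗ-identityˡ _) (≈ᴹ-reflexive (≡.cong (λ K → ⟦ θ ⟧ (v h K)) (strictlyInverseˡ K))))))

      private
        τ : ∀ {h r} → Index n h r → Functional (overScalars (IR r))
        τ {h} {r} K = coordinate r h (indicator K)

        τ-dual : ∀ {h r} (K : Index n h r) → ⟦ τ K ⟧ (v h K) k.≈ k.1#
        τ-dual {h} {r} K = k.trans (coordinate-v r h (indicator K) K) (indicator-refl K)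

        τ-dual-≢ : ∀ {h r} (K K′ : Index n h r) → K ≢ K′ → ⟦ τ K ⟧ (v h K′) k.≈ k.0#
        τ-dual-≢ {h} {r} K K′ ne = k.trans (coordinate-v r h (indicator K) K′) (indicator-≢ ne)

        id-invariant : ∀ r → Invariant (IR r) {overScalars (IR r)} 0 (idₗ (overScalars (IR r)))
        id-invariant r un x = ≈ᴹ-trans (*ₗ-congʳ (gen-cong (unitriangular-zero un))) (*ₗ-identityˡ x)
          where open LeftModule (IR r)

      module _ (r : ℕ) where
        open LinearAlgebra k (overScalars (IR r))
        open LeftModule (overScalars (IR r)) using (_≈ᴹ_; _*ₗ_; +ᴹ-commutativeMonoid)
        open import Algebra.Properties.CommutativeMonoid.Sum +ᴹ-commutativeMonoid using () renaming (sum to sumᴹ)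

        private
          spanning-IR : ∀ x → ⊤ → let open Inverse (enumerateIndex 0 r) using (to) in
            Σ (Index n 0 r → k.Carrier) λ c → x ≈ᴹ sumᴹ (λ j → c (to j) *ₗ v 0 (to j))
          spanning-IR x _ = (λ K → ⟦ τ K ⟧ x) , straighten r 0 {overScalars (IR r)} (idₗ (overScalars (IR r))) (id-invariant r) x

        basis-IR : IsBasis (v 0 {r})
        basis-IR = dual-basis {overScalars (IR r)} (v 0) τ τ-dual τ-dual-≢ (enumerateIndex 0 r) (λ _ → ⊤) (λ _ → tt) spanning-IR

        dimension-IR : HasDimension (indexCount 0 r)
        dimension-IR = v 0 ∘ Inverse.to (enumerateIndex 0 r)
          , dual-basis-Fin {overScalars (IR r)} (v 0) τ τ-dual τ-dual-≢ (enumerateIndex 0 r) (λ _ → ⊤) (λ _ → tt) spanning-IR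

      module _ (r : ℕ) where
        private
          module M = LeftModule (IR r)

          τ½ : Index n 1 r → Functional (overScalarsL (IR½ r))
          τ½ K = τ K ∘ₗ forget (IR r)

          v½ : Index n 1 r → LeftModule.Carrierᴹ (IR½ r)
          v½ K = ⟦ project (IR r) ⟧ (v 1 K)

          τ-e_U : ∀ (K : Index n 1 r) y → ⟦ τ K ⟧ (e_U M.*ₗ y) k.≈ ⟦ τ K ⟧ y
          τ-e_U K = e_U-average (IR r) {scalars} ℕₚ.≤-refl (τ K) (λ {u} → coordinate-invariant r 1 (indicator K) {u})

        -- Height-1 coordinates do not see e_U, so their duality with the v_K passes to the elements
        -- e_U v_K. The expansion of x = e_U y comes from straightening `project` at y.
        dimension-IR½ : LinearAlgebra.HasDimension k (overScalarsL (IR½ r)) (indexCount 1 r)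
        dimension-IR½ = v½ ∘ Inverse.to (enumerateIndex 1 r)
          , dual-basis-Fin {overScalarsL (IR½ r)} v½ τ½
              (λ K → k.trans (τ-e_U K (v 1 K)) (τ-dual K))
              (λ K K′ ne → k.trans (τ-e_U K (v 1 K′)) (τ-dual-≢ K K′ ne))
              (enumerateIndex 1 r) (λ _ → ⊤) (λ _ → tt)
              (λ (x , y , e) _ → (λ K → ⟦ τ K ⟧ y) , M.≈ᴹ-trans e
                (straighten r 1 {overScalarsL (IR½ r)} (project (IR r))
                  (λ un x → e_U-fixed (IR r) (unitriangular-one un) x) y))

      module _ (r : ℕ) where
        private
          module M = LeftModule (IR r)
          module T = LeftModule (IR (suc r))
          open Ind (Resf (IR r)) using (⊗-cong)

        private
          onZero : Line n → LinearMap (overScalars (IR r)) (overScalars (IR r))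
          onZero (zero , _)  = idₗ (overScalars (IR r))
          onZero (suc _ , _) = 0ₗ (overScalars (IR r)) (overScalars (IR r))

        -- The component at the line of e_1, that is, at the coset P itself, which is where ι lands.
        retraction : LinearMap (overScalars (IR (suc r))) (overScalars (IR r))
        retraction = lift (IR r) {overScalars (IR r)} onZero

        retraction-ι : ∀ w → ⟦ retraction ⟧ (ι r w) M.≈ᴹ proj₁ w
        retraction-ι w = M.≈ᴹ-trans
          (lift-gen (IR r) {overScalars (IR r)} onZero G.ε w
            (≡.trans (line-cong (G.sym W-zero)) (line-W (zero , []))))
          (M.≈ᴹ-trans (M.*ₗ-congʳ (gen-cong (G.trans (G.∙-congˡ (G.sym W-zero)) (G.inverseˡ (W (zero , []))))))
            (M.*ₗ-identityˡ (proj₁ w)))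

        ι-injective : ∀ {w w′} → ι r w T.≈ᴹ ι r w′ → proj₁ w M.≈ᴹ proj₁ w′
        ι-injective {w} {w′} e = M.≈ᴹ-trans (M.≈ᴹ-sym (retraction-ι w))
          (M.≈ᴹ-trans (⟦⟧-cong retraction e) (retraction-ι w′))

        Index₀ : Set
        Index₀ = Σ (Index n 0 (suc r)) λ (κs , _) → toℕ (Vec.head κs) ≡ 0

        -- A first entry 0 carries no parameters and raises the height from 0 to 1, so what follows
        -- it is an arbitrary index of height 1.
        enumerateIndex₀ : Fin (indexCount 1 r) ↔ Index₀
        enumerateIndex₀ = ↔-trans (enumerateIndex 1 r) (mk↔ₛ′ (λ K → cons zero [] K , ≡.refl)
          (λ { ((zero ∷ κs , [] ∷ as) , _) → κs , as ; ((suc _ ∷ _ , _ ∷ _) , ()) })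
          (λ { ((zero ∷ κs , [] ∷ as) , ≡.refl) → ≡.refl ; ((suc _ ∷ _ , _ ∷ _) , ()) })
          (λ { (κs , as) → ≡.refl }))

        private
          v₀ : Index₀ → T.Carrierᴹ
          v₀ K = v 0 (proj₁ K)

          θ : LinearMap (overScalars (IR r)) (overScalars (IR (suc r)))
          θ = pure (IR r) (gen G.ε)

          -- The identity map is invariant at height 0, so `w-constant` equates the factor w for κ =
          -- 0 with the representative of the line of e_1, which is 1.
          θ-v : ∀ (K : Index n 1 r) → ⟦ θ ⟧ (v 1 K) T.≈ᴹ v 0 (cons zero [] K)
          θ-v K = T.≈ᴹ-sym (T.≈ᴹ-trans (T.≈ᴹ-reflexive (v-cons 0 zero [] K))
            (T.≈ᴹ-trans (w-constant r 0 {overScalars (IR (suc r))} (idₗ (overScalars (IR (suc r))))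
                (id-invariant (suc r)) zero [] [] ≡.refl (v 1 K))
              (⊗-cong (gen-cong W-zero) M.≈ᴹ-refl)))

          S : T.Carrierᴹ → Set
          S x = ∃ λ w → x T.≈ᴹ ι r w

          members : ∀ K → S (v₀ K)
          members ((suc _ ∷ _ , _ ∷ _) , ())
          members ((zero ∷ κs , [] ∷ as) , _) = ⟦ project (IR r) ⟧ (v 1 (κs , as)) , T.≈ᴹ-sym (θ-v (κs , as))

          open import Algebra.Properties.CommutativeMonoid.Sum T.+ᴹ-commutativeMonoid using (sum-cong-≋)

        basis-ι : LinearAlgebra.IsBasisOf k (overScalars (IR (suc r))) S v₀
        basis-ι = dual-basis {overScalars (IR (suc r))} v₀ (λ K → τ (proj₁ K)) (λ K → τ-dual (proj₁ K))
          (λ { (K , p) (K′ , p′) ne → τ-dual-≢ K K′ (λ { ≡.refl → ne (≡.cong (K ,_) (ℕₚ.≡-irrelevant p p′)) }) })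
          enumerateIndex₀ S members
          -- An element of the subspace is 1 ⊗ e_U y. Its coefficients are the height-1 coordinates
          -- of y, by straightening the map y ↦ 1 ⊗ e_U y.
          (λ x (w@(_ , y , e) , x≈) → (λ { ((zero ∷ κs , [] ∷ as) , _) → ⟦ τ (κs , as) ⟧ y ; ((suc _ ∷ _ , _ ∷ _) , ()) })
            , T.≈ᴹ-trans x≈ (T.≈ᴹ-trans (⊗-cong kG.refl e)
                (T.≈ᴹ-trans (straighten r 1 {overScalars (IR (suc r))} θ
                    (λ un y → ⊗-cong kG.refl (e_U-fixed (IR r) (unitriangular-one un) y)) y)
                  (sum-cong-≋ (λ j → T.*ₗ-congˡ (θ-v (Inverse.to (enumerateIndex 1 r) j)))))))

-- Reciprocals of positive integers in the complex numbers.

open import Algebra.Properties.Monoid.Mult (CommutativeRing.+-monoid ℂ) using () renaming (_×_ to _×ℂ_)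

-- All Cauchy sequences involved are constant, so the claim reduces to an identity of rationals at
-- each index.
recipℂ-inverse : ∀ j .{{_ : NonZero j}} → let open CommutativeRing ℂ in recipℂ j * (j ×ℂ 1#) ≈ 1#
recipℂ-inverse (suc j) = pointwise re , pointwise im
  where
  open ≡.≡-Reasoning
  pointwise : ∀ {x y} → (∀ i → ℝ.seq x i ≡ ℝ.seq y i) → x ≈ℝ y
  pointwise {x} {y} e = mk≈ℝ (At.null-0 λ i →
    ≡.trans (≡.cong (ℚ._- ℝ.seq y i) (e i)) (ℚₚ.+-inverseʳ (ℝ.seq y i)))
  fromℕ : ℕ → ℚ
  fromℕ j = ℤ.+ j ℚ./ 1
  -- Among unnormalised fractions no common divisors are cancelled, and the identity becomes one of
  -- integers.
  fromℕ-suc : ∀ j → 1ℚ ℚ.+ fromℕ j ≡ fromℕ (suc j)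
  fromℕ-suc j = ℚₚ.toℚᵘ-injective (ℚᵘₚ.≃-trans (ℚₚ.toℚᵘ-homo-+ 1ℚ (fromℕ j))
    (ℚᵘₚ.≃-trans (ℚᵘₚ.+-congʳ ℚᵘ.1ℚᵘ (ℚₚ.toℚᵘ-fromℚᵘ (ℚᵘ.mkℚᵘ (ℤ.+ j) 0)))
      (ℚᵘₚ.≃-trans (ℚᵘ.*≡* (≡.cong (ℤ._* ℤ.+ 1) (≡.cong (λ z → ℤ.1ℤ ℤ.+ z) (ℤₚ.*-identityʳ (ℤ.+ j)))))
        (ℚᵘₚ.≃-sym (ℚₚ.toℚᵘ-fromℚᵘ (ℚᵘ.mkℚᵘ (ℤ.+ suc j) 0))))))
  realPart imaginaryPart : ℕ → ℕ → ℚ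
  realPart j = ℝ.seq (proj₁ (j ×ℂ CommutativeRing.1# ℂ))
  imaginaryPart j = ℝ.seq (proj₂ (j ×ℂ CommutativeRing.1# ℂ))
  re-seq : ∀ j i → realPart j i ≡ fromℕ j
  re-seq zero i = ≡.refl
  re-seq (suc j) i = ≡.trans (≡.cong (1ℚ ℚ.+_) (re-seq j i)) (fromℕ-suc j)
  im-seq : ∀ j i → imaginaryPart j i ≡ 0ℚ
  im-seq zero i = ≡.refl
  im-seq (suc j) i = ≡.cong (0ℚ ℚ.+_) (im-seq j i)
  inverse : (ℤ.+ 1 ℚ./ suc j) ℚ.* fromℕ (suc j) ≡ 1ℚ
  inverse = ℚₚ.toℚᵘ-injective (ℚᵘₚ.≃-trans (ℚₚ.toℚᵘ-homo-* (ℤ.+ 1 ℚ./ suc j) (fromℕ (suc j)))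
    (ℚᵘₚ.≃-trans (ℚᵘₚ.*-cong (ℚₚ.toℚᵘ-fromℚᵘ (ℚᵘ.mkℚᵘ (ℤ.+ 1) j)) (ℚₚ.toℚᵘ-fromℚᵘ (ℚᵘ.mkℚᵘ (ℤ.+ suc j) 0)))
      (ℚᵘ.*≡* (≡.trans (ℤₚ.*-identityʳ _) (≡.sym (≡.trans (ℤₚ.*-identityˡ _)
        (≡.cong (λ n → ℤ.+ suc n) (≡.trans (ℕₚ.*-identityʳ j) (≡.sym (ℕₚ.+-identityʳ j))))))))))
  re : ∀ i → (ℤ.+ 1 ℚ./ suc j) ℚ.* realPart (suc j) i ℚ.+ ℚ.- (0ℚ ℚ.* imaginaryPart (suc j) i) ≡ 1ℚ
  re i = ≡.trans (≡.cong₂ (λ a b → (ℤ.+ 1 ℚ./ suc j) ℚ.* a ℚ.+ ℚ.- b) (re-seq (suc j) i) (ℚₚ.*-zeroˡ (imaginaryPart (suc j) i)))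
    (≡.trans (ℚₚ.+-identityʳ _) inverse)
  im : ∀ i → (ℤ.+ 1 ℚ./ suc j) ℚ.* imaginaryPart (suc j) i ℚ.+ 0ℚ ℚ.* realPart (suc j) i ≡ 0ℚ
  im i = ≡.trans (≡.cong₂ (λ a b → (ℤ.+ 1 ℚ./ suc j) ℚ.* a ℚ.+ b) (im-seq (suc j) i) (ℚₚ.*-zeroˡ (realPart (suc j) i)))
    (≡.trans (ℚₚ.+-identityʳ _) (ℚₚ.*-zeroʳ (ℤ.+ 1 ℚ./ suc j)))

-- The cells of GL_n, and assembly of both parts of the theorem.

module _ {q : ℕ} (F : FiniteField q) (m : ℕ) where
  open Matrices F using (GL; levi; matrix)
  open Lines F
  open Elements F m
  open Steps F m

  GL-cells : Cells F m (GL (suc m)) (levi m)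
  GL-cells = record
    { W = W
    ; line = line
    ; Unitriangular = λ h u → Unitriangular h (matrix u)
    ; W-zero = wMatrix-zero (column (zero , []))
    ; line-cong = λ {g} {h} → line-cong g h
    ; line-P = λ g {p} → line-P g p
    ; line-W = line-W
    ; cofactor∈P = cofactor∈P
    ; unitriangular-zero = λ {u} → Unitriangular-zero {u}
    ; unitriangular-one = λ {u} → Unitriangular-one {u}
    ; U⇒unitriangular = λ {h} {u} 1≤h → U⇒Unitriangular 1≤h {u}
    ; unitriangular⇒P = λ {h} {u} → unitriangular⇒P {h} u
    ; transfer = λ h κ c c′ e → transfer-unitriangular h κ (column (κ , c)) (column (κ , c′))
        (λ i p → ≡.trans (cut-column (κ , c) i) (≡.trans (column-upper h κ c c′ e i p) (≡.sym (cut-column (κ , c′) i))))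
    ; conjugate = λ h ℓ {u} {l} {u₀} → conjugate-unitriangular h ℓ u l u₀
    ; move = λ h {u} un g → let open Translate h u g un in
        moved , line-moved , upper-moved , stabiliser-unitriangular
    }

module _ (k : CommutativeRing 0ℓ 0ℓ)
  (recip : (j : ℕ) .{{_ : NonZero j}} → CommutativeRing.Carrier k)
  {q : ℕ} (F : FiniteField q) (m : ℕ) where
  open CommutativeRing k using (_≈_; 1#; _*_; +-monoid)
  open import Algebra.Properties.Monoid.Mult +-monoid using () renaming (_×_ to _×ℕ_)
  open Lines F
  open LinearAlgebra k

  -- The group and its Levi pair are implicit so that they are inferred in the form
  -- in which IteratedIR states them.
  straightening : ∀ {G : Group 0ℓ 0ℓ} {levi : LeviPair G} → let
      open HarishChandra k recip G levi
      n = suc m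
      in
    (vFrom : ∀ h {r} (κs : Vec (Fin n) r) → Parameters h κs → LeftModule.Carrierᴹ (IR r))
    (w : ∀ h (κ : Fin n) → Vec (FiniteField.Carrier F) (toℕ κ ∸ toℕ κ ⊓ h) → GroupAlgebra.FormalSum k G)
    (cells : Cells F m G levi) → let
      open GroupAlgebra k G using (gen; _·_; _≋_; groupAlgebra)
      open CommutativeMonoidSum (Ring.+-commutativeMonoid groupAlgebra) using (sum)
      in
    (∀ j .{{_ : NonZero j}} → recip j * (j ×ℕ 1#) ≈ 1#) →
    (∀ h κ a → w h κ a ≋ recip (q ^ (toℕ κ ⊓ h)) {{ℕₚ.m^n≢0 q (toℕ κ ⊓ h) {{FiniteField.q-nonZero F}}}}
        · sum (λ i → gen (Cells.W cells (κ , join h (Inverse.to (FiniteField.enumerateVec F (toℕ κ ⊓ h)) i) a)))) →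
    (∀ h → vFrom h [] [] ≡ 1#) →
    (∀ h {r} κ (κs : Vec (Fin n) r) a as →
        vFrom h (κ ∷ κs) (a ∷ as) ≡ w h κ a ⊗[ IR r ] vFrom (nextHeight h κ) κs as) →
    ∀ r → let
      open IndexCount q {{FiniteField.q-nonZero F}} {{FiniteField.q∸1-nonZero F}} n
      _≈½_ = LeftModule._≈ᴹ_ (IR½ r)
      _≈₊_ = LeftModule._≈ᴹ_ (IR (suc r))
      in
    (IsBasis (overScalars (IR r)) (λ ((κs , as) : Index n 0 r) → vFrom 0 κs as)
       × HasDimension (overScalars (IR r)) (indexCount 0 r))
      ×
    (Injective _≈½_ _≈₊_ (ι r)
       × IsBasisOf (overScalars (IR (suc r))) (λ x → ∃ λ y → x ≈₊ ι r y)
           (λ (K : Σ (Index n 0 (suc r)) λ (κs , _) → toℕ (head κs) ≡ 0) → vFrom 0 (proj₁ (proj₁ K)) (proj₂ (proj₁ K)))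
       × HasDimension (overScalarsL (IR½ r)) (indexCount 1 r))
  straightening {G} {levi} vFrom w cells recip-inverse w-average vFrom-[] vFrom-∷ r =
    (basis-IR r , dimension-IR r) , (λ {x} {y} → ι-injective r {x} {y}) , basis-ι r , dimension-IR½ r
    where
    open Straightening k recip F m G levi cells
    open StandardBasis recip-inverse w w-average vFrom vFrom-[] vFrom-∷

theorem3p2 : (q : ℕ) → IsPrimePower q → (F : FiniteField q) → (m r : ℕ) →
    let open IteratedIR ℂ recipℂ F m
        open Counting q {{FiniteField.q∸1-nonZero F}}
        open LinearAlgebra ℂ
        n = suc m
        _≈½_ = LeftModule._≈ᴹ_ (IR½ r)
        _≈₊_ = LeftModule._≈ᴹ_ (IR (suc r))
    in
      (IsBasis (overScalars (IR r)) (λ (K : 𝒫 r) → v K)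
       × HasDimension (overScalars (IR r)) (d n r))
      ×
      (Injective _≈½_ _≈₊_ (ι r)
       × IsBasisOf (overScalars (IR (suc r))) (λ x → ∃ λ y → x ≈₊ ι r y) (λ (K : 𝒫₀ r) → v (proj₁ K))
       × Σ ([ n ] ∣ d n (suc r)) λ [n]∣d → HasDimension (overScalarsL (IR½ r)) (quotient [n]∣d))
theorem3p2 q _ F m r =
  let open IteratedIR ℂ recipℂ F m
      open LinearAlgebra ℂ
      open IndexCount q {{FiniteField.q-nonZero F}} {{FiniteField.q∸1-nonZero F}} (suc m)
      (basis , dimension) , injective , basis½ , dimension½ =
        straightening ℂ recipℂ F m vFrom (λ h κ a → w κ _ (ℕₚ.m⊓n≤m (toℕ κ) h) a) (GL-cells F m) recipℂ-inverse
          (λ h κ a → ConcreteExpansion.w-average ℂ recipℂ F m h κ (ℕₚ.m⊓n≤m (toℕ κ) h) a)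
          (λ _ → ≡.refl) (λ _ _ _ _ _ → ≡.refl) r
  in (basis , ≡.subst (HasDimension (overScalars (IR r))) (indexCount-0 r) dimension)
   -- The quotient of this divisibility proof is `indexCount 1 r` by definition, which is the
   -- dimension found for the restricted module.
   , injective , basis½ , divides (indexCount 1 r) (indexCount-1 r) , dimension½
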